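{- Let $(a_n)_{n\ge0}$ be the sequence, listed in increasing order, of the non-negative integers $m$ such that $840m+289$ is a perfect square. Define $t(n)=0$ if $n\equiv 0,1,3,5,10,12,14,15 \pmod{16}$ and $t(n)=1$ otherwise. Then $$\sum_{n=0}^\infty(-1)^{t(n)}q^{a_n}=\frac{(q^2,q^5,q^7;q^7)_\infty}{(q^2,q^3;q^5)_\infty}.$$
   Context: Here $q$ is a complex number with $|q|<1$ (equivalently, the identity may be read as an identity of formal power series in $q$). For a complex number $a$, $(a;q)_\infty:=\prod_{i=0}^\infty(1-aq^i)$, and $(a_1,a_2,\dots,a_m;q)_\infty:=\prod_{j=1}^m(a_j;q)_\infty$. -}

module Defs where

open import Data.Nat as ℕ using (ℕ; zero; suc; _∸_; _%_; _≡ᵇ_)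
open import Data.Integer as ℤ using (ℤ; 0ℤ; 1ℤ; -1ℤ)
open import Data.Bool using (Bool; true; false; if_then_else_; _∨_)

-- Formal power series in q with integer coefficients:
-- f n is the coefficient of q^n.
FPS : Set
FPS = ℕ → ℤ

sumBelow : ℕ → (ℕ → ℤ) → ℤ
sumBelow zero    f = 0ℤ
sumBelow (suc n) f = sumBelow n f ℤ.+ f n

_⊛_ : FPS → FPS → FPS
(f ⊛ g) n = sumBelow (suc n) (λ i → f i ℤ.* g (n ∸ i))

infixl 7 _⊛_

oneS : FPS
oneS zero    = 1ℤ
oneS (suc _) = 0ℤ

prodBelow : ℕ → (ℕ → FPS) → FPS
prodBelow zero    F = oneS
prodBelow (suc k) F = prodBelow k F ⊛ F k

oneMinusQ : ℕ → FPS
oneMinusQ e n = (if n ≡ᵇ 0 then 1ℤ else 0ℤ) ℤ.- (if n ≡ᵇ e then 1ℤ else 0ℤ)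

-- The series 1/(1 - q^(suc e)) = Σ_k q^(k (e+1)).
geomQ : ℕ → FPS
geomQ e n = if (n % suc e) ≡ᵇ 0 then 1ℤ else 0ℤ

-- (q^(b+1); q^(c+1))_∞ = ∏_{i≥0} (1 - q^(b+1+i(c+1))) as a formal power series.
-- Factor i has exponent ≥ i+1, so factors with i ≥ n+1 do not affect the
-- coefficient of q^n: that coefficient is the one of the partial product over i ≤ n.
qPoch : ℕ → ℕ → FPS
qPoch b c n = prodBelow (suc n) (λ i → oneMinusQ (suc b ℕ.+ i ℕ.* suc c)) n

-- 1 / (q^(b+1); q^(c+1))_∞ = ∏_{i≥0} 1/(1 - q^(b+1+i(c+1))), same truncation.
qPochInv : ℕ → ℕ → FPS
qPochInv b c n = prodBelow (suc n) (λ i → geomQ (b ℕ.+ i ℕ.* suc c)) n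

tZero : ℕ → Bool
tZero n = let r = n % 16 in
  (r ≡ᵇ 0) ∨ (r ≡ᵇ 1) ∨ (r ≡ᵇ 3) ∨ (r ≡ᵇ 5) ∨
  (r ≡ᵇ 10) ∨ (r ≡ᵇ 12) ∨ (r ≡ᵇ 14) ∨ (r ≡ᵇ 15)

sgnT : ℕ → ℤ
sgnT n = if tZero n then 1ℤ else -1ℤ

-- Σ_{n≥0} (-1)^{t(n)} q^{a n} for a strictly increasing a (so a n ≥ n and only
-- n ≤ N can contribute to the coefficient of q^N).
lhsSeries : (ℕ → ℕ) → FPS
lhsSeries a N = sumBelow (suc N) (λ n → if a n ≡ᵇ N then sgnT n else 0ℤ)

rhsSeries : FPS
rhsSeries = qPoch 1 6 ⊛ qPoch 4 6 ⊛ qPoch 6 6 ⊛ qPochInv 1 4 ⊛ qPochInv 2 4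

{-# OPTIONS --safe #-}
-- By the Jacobi triple product the right-hand side is Θ₇ Θ₅ / (q;q)_∞, where
-- Θ₇ = Σ (-1)^m q^((7m²+3m)/2) and Θ₅ = Σ (-1)^n q^((5n²+3n)/2), because
-- 1 / (q²,q³;q⁵)_∞ = (q,q⁴,q⁵;q⁵)_∞ / (q;q)_∞.  Hence one has to show L (q;q)_∞ = Θ₇ Θ₅ for the
-- left-hand side L.  Write θ(j, r) = Σ q^((35K²+R²-324)/840) over K ≡ j (mod 12), R ≡ r (mod 420).
-- Since 840m + 289 = R² means R ≡ ±17, ±53, ±67, ±73, ±137, ±143, ±157, ±193 (mod 420), L (q;q)_∞ is a
-- signed sum of the θ(1, r) and θ(5, r).  With X = 14m+3 and Y = 10n+3, Θ₇ Θ₅ is the sum of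
-- (-1)^(m+n) q^((15X²+21Y²-324)/840), and 15X² + 21Y² = 35K² + R² both for
-- (K, R) = ((X+Y)/2, (5X-7Y)/2), used when m+n is even, and for (K, R) = ((X-Y)/2, (5X+7Y)/2), used when
-- m+n is odd.  Each half becomes a sum of six θ(j, r).  The two sides then differ by a relation which
-- results from expanding, in both ways, the analogous sum with X = 14m+4, Y = 10n-2 and m+n even.
-- The triple product is the limit of Rothe's q-binomial theorem.

module Submission where

open import Defs
open import Data.Nat using (ℕ; zero; suc; _*_; _+_; _<_; _≤_; _∸_; _/_; _%_; _≡ᵇ_; _<ᵇ_; z≤n; s≤s; _<?_; _≟_)
import Data.Nat.Properties as ℕₚ
import Data.Nat.DivMod as ℕ-DivMod
import Data.Nat.Tactic.RingSolver as ℕ-Solver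
open import Data.Integer as ℤ using (ℤ; 0ℤ; 1ℤ; -1ℤ; +_; -[1+_]; ∣_∣)
import Data.Integer.Properties as ℤₚ
import Data.Integer.Tactic.RingSolver as ℤ-Solver
open import Data.Bool using (Bool; true; false; if_then_else_; T; _∨_)
open import Data.Empty using (⊥)
open import Data.Maybe using (Maybe; just; nothing)
open import Data.Product using (∃-syntax; _,_; _×_; proj₁; proj₂)
open import Data.Sum using (_⊎_; inj₁; inj₂)
open import Data.Unit using (tt)
open import Level using (0ℓ)
open import Algebra.Bundles using (CommutativeRing)
import Algebra.Solver.Ring
import Algebra.Solver.Ring.AlmostCommutativeRing as ACR
open import Function.Bundles using (_⇔_; Equivalence)
open import Relation.Binary.Definitions using (tri<; tri≈; tri>)
import Relation.Binary.Reasoning.Setoid as SetoidReasoning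
open import Relation.Nullary using (yes; no; contradiction)
open import Relation.Nullary.Decidable using (True; toWitness; _→-dec_)
open import Relation.Binary.PropositionalEquality using (_≡_; _≢_; refl; sym; trans; cong; cong₂; subst; subst₂; module ≡-Reasoning)

-- Both diagonalisations are instances of 15X² + 21Y² = 35((X±Y)/2)² + ((5X∓7Y)/2)². Choosing the
-- sign by the parity of m+n keeps K odd, so only K ≡ ±1, ±3, ±5 (mod 12) occur, just as K = 6k+1 is
-- odd in the expansion of L (q;q)_∞. The image of (m, n) ↦ (7m+5n, 35(m-n)) contains 12ℤ × 420ℤ
-- with index 12, and the parity of m-n keeps half of the twelve cosets: hence six theta series per
-- half. The shift is 324 = 289 + 35 = 9(15 + 21). Only Θ₇ Θ₅ involves classes with 3 | K, so the
-- two sides cannot be matched class by class; the second lattice sum trades these classes for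
-- others. The obstacle is formal: sums over ℤ² have to be made finite, so everything is proved one
-- coefficient at a time. The coefficient of q^N becomes a signed count of points with 35K² + R² =
-- 840N + 324, a sum over one box, large enough that every change of variables used keeps all these
-- points inside. Halving is avoided by carrying doubled sums and cancelling the 2 at the end.

-- Finite sums of integers

sum-cong< : ∀ n {f g : ℕ → ℤ} → (∀ i → i < n → f i ≡ g i) → sumBelow n f ≡ sumBelow n g
sum-cong< zero    e = refl
sum-cong< (suc n) e = cong₂ ℤ._+_ (sum-cong< n (λ i i<n → e i (ℕₚ.m<n⇒m<1+n i<n))) (e n (ℕₚ.n<1+n n))

sum-cong : ∀ n {f g : ℕ → ℤ} → (∀ i → f i ≡ g i) → sumBelow n f ≡ sumBelow n g
sum-cong n e = sum-cong< n (λ i _ → e i)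

sum-zero : ∀ n {f : ℕ → ℤ} → (∀ i → i < n → f i ≡ 0ℤ) → sumBelow n f ≡ 0ℤ
sum-zero zero    z = refl
sum-zero (suc n) z =
  cong₂ ℤ._+_ (sum-zero n (λ i i<n → z i (ℕₚ.m<n⇒m<1+n i<n))) (z n (ℕₚ.n<1+n n))

+-interchange : ∀ a b c d → (a ℤ.+ b) ℤ.+ (c ℤ.+ d) ≡ (a ℤ.+ c) ℤ.+ (b ℤ.+ d)
+-interchange = ℤ-Solver.solve-∀

sum-+ : ∀ n (f g : ℕ → ℤ) → sumBelow n (λ i → f i ℤ.+ g i) ≡ sumBelow n f ℤ.+ sumBelow n g
sum-+ zero    f g = refl
sum-+ (suc n) f g =
  trans (cong (ℤ._+ (f n ℤ.+ g n)) (sum-+ n f g)) (+-interchange (sumBelow n f) (sumBelow n g) (f n) (g n))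

sum-*ˡ : ∀ n c (f : ℕ → ℤ) → sumBelow n (λ i → c ℤ.* f i) ≡ c ℤ.* sumBelow n f
sum-*ˡ zero    c f = sym (ℤₚ.*-zeroʳ c)
sum-*ˡ (suc n) c f =
  trans (cong (ℤ._+ c ℤ.* f n) (sum-*ˡ n c f)) (sym (ℤₚ.*-distribˡ-+ c (sumBelow n f) (f n)))

sum-swap : ∀ m n (f : ℕ → ℕ → ℤ) →
  sumBelow m (λ i → sumBelow n (f i)) ≡ sumBelow n (λ j → sumBelow m (λ i → f i j))
sum-swap zero    n f = sym (sum-zero n (λ _ _ → refl))
sum-swap (suc m) n f =
  trans (cong (ℤ._+ sumBelow n (f m)) (sum-swap m n f))
        (sym (sum-+ n (λ j → sumBelow m (λ i → f i j)) (f m)))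

sum-append : ∀ m n (f : ℕ → ℤ) →
  sumBelow (m + n) f ≡ sumBelow m f ℤ.+ sumBelow n (λ i → f (m + i))
sum-append m zero    f rewrite ℕₚ.+-identityʳ m = sym (ℤₚ.+-identityʳ (sumBelow m f))
sum-append m (suc n) f rewrite ℕₚ.+-suc m n =
  trans (cong (ℤ._+ f (m + n)) (sum-append m n f))
        (ℤₚ.+-assoc (sumBelow m f) (sumBelow n (λ i → f (m + i))) (f (m + n)))

sum-first : ∀ n (f : ℕ → ℤ) → sumBelow (suc n) f ≡ f 0 ℤ.+ sumBelow n (λ i → f (suc i))
sum-first n f =
  trans (sum-append 1 n f) (cong (ℤ._+ sumBelow n (λ i → f (suc i))) (ℤₚ.+-identityˡ (f 0)))

sum-extend : ∀ {m n} {f : ℕ → ℤ} → m ≤ n → (∀ i → m ≤ i → f i ≡ 0ℤ) → sumBelow n f ≡ sumBelow m f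
sum-extend {m} {n} {f} m≤n z = begin
  sumBelow n f                                              ≡⟨ cong (λ k → sumBelow k f) (sym (ℕₚ.m+[n∸m]≡n m≤n)) ⟩
  sumBelow (m + (n ∸ m)) f                                  ≡⟨ sum-append m (n ∸ m) f ⟩
  sumBelow m f ℤ.+ sumBelow (n ∸ m) (λ i → f (m + i))       ≡⟨ cong (ℤ._+_ (sumBelow m f)) (sum-zero (n ∸ m) (λ i _ → z (m + i) (ℕₚ.m≤m+n m i))) ⟩
  sumBelow m f ℤ.+ 0ℤ                                       ≡⟨ ℤₚ.+-identityʳ (sumBelow m f) ⟩
  sumBelow m f                                              ∎
  where open ≡-Reasoning

sum-reverse : ∀ n (f : ℕ → ℤ) → sumBelow n f ≡ sumBelow n (λ i → f (n ∸ suc i))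
sum-reverse zero    f = refl
sum-reverse (suc n) f = begin
  sumBelow n f ℤ.+ f n                              ≡⟨ ℤₚ.+-comm (sumBelow n f) (f n) ⟩
  f n ℤ.+ sumBelow n f                              ≡⟨ cong (ℤ._+_ (f n)) (sum-reverse n f) ⟩
  f n ℤ.+ sumBelow n (λ i → f (n ∸ suc i))          ≡⟨ sym (sum-first n (λ i → f (n ∸ i))) ⟩
  sumBelow (suc n) (λ i → f (n ∸ i))                ∎
  where open ≡-Reasoning

sum-blocks : ∀ p M (f : ℕ → ℤ) →
  sumBelow (M * p) f ≡ sumBelow p (λ d → sumBelow M (λ i → f (i * p + d)))
sum-blocks p zero    f = sym (sum-zero p (λ _ _ → refl))
sum-blocks p (suc M) f = begin
  sumBelow (p + M * p) f
    ≡⟨ cong (λ k → sumBelow k f) (ℕₚ.+-comm p (M * p)) ⟩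
  sumBelow (M * p + p) f
    ≡⟨ sum-append (M * p) p f ⟩
  sumBelow (M * p) f ℤ.+ sumBelow p (λ d → f (M * p + d))
    ≡⟨ cong (ℤ._+ sumBelow p (λ d → f (M * p + d))) (sum-blocks p M f) ⟩
  sumBelow p (λ d → sumBelow M (λ i → f (i * p + d))) ℤ.+ sumBelow p (λ d → f (M * p + d))
    ≡⟨ sym (sum-+ p (λ d → sumBelow M (λ i → f (i * p + d))) (λ d → f (M * p + d))) ⟩
  sumBelow p (λ d → sumBelow (suc M) (λ i → f (i * p + d))) ∎
  where open ≡-Reasoning

-- Formal power series

infix 4 _≋_ _≈[_]_
infixl 7 _·_
infixl 6 _⊕_
infix 8 ⊖_

-- A record rather than the bare pointwise statement, so that unification can recover both series
-- from the type of a proof.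
record _≋_ (f g : FPS) : Set where
  constructor mk
  field at : ∀ n → f n ≡ g n
open _≋_ public

_⊕_ : FPS → FPS → FPS
(f ⊕ g) n = f n ℤ.+ g n

⊖_ : FPS → FPS
(⊖ f) n = ℤ.- f n

zeroS : FPS
zeroS n = 0ℤ

const : ℤ → FPS
const c zero    = c
const c (suc n) = 0ℤ

tail : FPS → FPS
tail f n = f (suc n)

scale : ℤ → FPS → FPS
scale c f n = c ℤ.* f n

⊛-suc : ∀ f g n → (f ⊛ g) (suc n) ≡ f 0 ℤ.* g (suc n) ℤ.+ (tail f ⊛ g) n
⊛-suc f g n = sum-first (suc n) (λ i → f i ℤ.* g (suc n ∸ i))

⊛-cong≤ : ∀ {f f′ g g′} n → (∀ i → i ≤ n → f i ≡ f′ i) → (∀ i → i ≤ n → g i ≡ g′ i) →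
          (f ⊛ g) n ≡ (f′ ⊛ g′) n
⊛-cong≤ n p q = sum-cong< (suc n) λ i i<1+n →
  cong₂ ℤ._*_ (p i (ℕₚ.≤-pred i<1+n)) (q (n ∸ i) (ℕₚ.m∸n≤m n i))

⊛-comm : ∀ f g n → (f ⊛ g) n ≡ (g ⊛ f) n
⊛-comm f g n = trans (sum-reverse (suc n) (λ i → f i ℤ.* g (n ∸ i)))
  (sum-cong< (suc n) λ i i<1+n →
    trans (cong (λ k → f (n ∸ i) ℤ.* g k) (ℕₚ.m∸[m∸n]≡n (ℕₚ.≤-pred i<1+n)))
          (ℤₚ.*-comm (f (n ∸ i)) (g i)))

⊛-distribʳ : ∀ f g h n → ((f ⊕ g) ⊛ h) n ≡ (f ⊛ h) n ℤ.+ (g ⊛ h) n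
⊛-distribʳ f g h n = trans
  (sum-cong (suc n) (λ i → ℤₚ.*-distribʳ-+ (h (n ∸ i)) (f i) (g i)))
  (sum-+ (suc n) (λ i → f i ℤ.* h (n ∸ i)) (λ i → g i ℤ.* h (n ∸ i)))

⊛-scaleˡ : ∀ c f g n → (scale c f ⊛ g) n ≡ c ℤ.* (f ⊛ g) n
⊛-scaleˡ c f g n = trans
  (sum-cong (suc n) (λ i → ℤₚ.*-assoc c (f i) (g (n ∸ i))))
  (sum-*ˡ (suc n) c (λ i → f i ℤ.* g (n ∸ i)))

-- Since f is `f 0` plus q times `tail f`, a product recurses on its left factor (`⊛-suc`), and
-- induction on the coefficient index replaces the reindexing of a double sum.
⊛-assoc : ∀ f g h n → ((f ⊛ g) ⊛ h) n ≡ (f ⊛ (g ⊛ h)) n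
⊛-assoc f g h zero    = lem (f 0) (g 0) (h 0)
  where
  lem : ∀ a b c → 0ℤ ℤ.+ (0ℤ ℤ.+ a ℤ.* b) ℤ.* c ≡ 0ℤ ℤ.+ a ℤ.* (0ℤ ℤ.+ b ℤ.* c)
  lem = ℤ-Solver.solve-∀
⊛-assoc f g h (suc n) = begin
  ((f ⊛ g) ⊛ h) (suc n)
    ≡⟨ ⊛-suc (f ⊛ g) h n ⟩
  (0ℤ ℤ.+ f 0 ℤ.* g 0) ℤ.* h (suc n) ℤ.+ (tail (f ⊛ g) ⊛ h) n
    ≡⟨ cong (ℤ._+_ ((0ℤ ℤ.+ f 0 ℤ.* g 0) ℤ.* h (suc n))) tail-⊛ ⟩
  (0ℤ ℤ.+ f 0 ℤ.* g 0) ℤ.* h (suc n) ℤ.+ (f 0 ℤ.* (tail g ⊛ h) n ℤ.+ (tail f ⊛ (g ⊛ h)) n)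
    ≡⟨ lem (f 0) (g 0) (h (suc n)) ((tail g ⊛ h) n) ((tail f ⊛ (g ⊛ h)) n) ⟩
  f 0 ℤ.* (g 0 ℤ.* h (suc n) ℤ.+ (tail g ⊛ h) n) ℤ.+ (tail f ⊛ (g ⊛ h)) n
    ≡⟨ cong (λ z → f 0 ℤ.* z ℤ.+ (tail f ⊛ (g ⊛ h)) n) (sym (⊛-suc g h n)) ⟩
  f 0 ℤ.* (g ⊛ h) (suc n) ℤ.+ (tail f ⊛ (g ⊛ h)) n
    ≡⟨ sym (⊛-suc f (g ⊛ h) n) ⟩
  (f ⊛ (g ⊛ h)) (suc n) ∎
  where
  open ≡-Reasoning
  lem : ∀ a b c d e → (0ℤ ℤ.+ a ℤ.* b) ℤ.* c ℤ.+ (a ℤ.* d ℤ.+ e) ≡ a ℤ.* (b ℤ.* c ℤ.+ d) ℤ.+ e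
  lem = ℤ-Solver.solve-∀
  tail-⊛ : (tail (f ⊛ g) ⊛ h) n ≡ f 0 ℤ.* (tail g ⊛ h) n ℤ.+ (tail f ⊛ (g ⊛ h)) n
  tail-⊛ = begin
    (tail (f ⊛ g) ⊛ h) n
      ≡⟨ ⊛-cong≤ {g = h} n (λ i _ → ⊛-suc f g i) (λ _ _ → refl) ⟩
    ((scale (f 0) (tail g) ⊕ (tail f ⊛ g)) ⊛ h) n
      ≡⟨ ⊛-distribʳ (scale (f 0) (tail g)) (tail f ⊛ g) h n ⟩
    (scale (f 0) (tail g) ⊛ h) n ℤ.+ ((tail f ⊛ g) ⊛ h) n
      ≡⟨ cong₂ ℤ._+_ (⊛-scaleˡ (f 0) (tail g) h n) (⊛-assoc (tail f) g h n) ⟩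
    f 0 ℤ.* (tail g ⊛ h) n ℤ.+ (tail f ⊛ (g ⊛ h)) n ∎

const-⊛ : ∀ c f n → (const c ⊛ f) n ≡ c ℤ.* f n
const-⊛ c f n = trans (sum-first n (λ i → const c i ℤ.* f (n ∸ i)))
  (trans (cong (ℤ._+_ (c ℤ.* f n)) (sum-zero n (λ _ _ → refl))) (ℤₚ.+-identityʳ (c ℤ.* f n)))

const-1 : ∀ n → const 1ℤ n ≡ oneS n
const-1 zero    = refl
const-1 (suc n) = refl

⊛-identityˡ : ∀ f n → (oneS ⊛ f) n ≡ f n
⊛-identityˡ f n = trans (⊛-cong≤ {g = f} n (λ i _ → sym (const-1 i)) (λ _ _ → refl))
  (trans (const-⊛ 1ℤ f n) (ℤₚ.*-identityˡ (f n)))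

opaque
  -- The product is made opaque because unification at the function type FPS would unfold it.
  _·_ : FPS → FPS → FPS
  f · g = f ⊛ g

  ·-def : ∀ f g → f · g ≋ f ⊛ g
  ·-def f g = mk λ _ → refl

  ·-cong≤ : ∀ {f f′ g g′} n → (∀ i → i ≤ n → f i ≡ f′ i) → (∀ i → i ≤ n → g i ≡ g′ i) →
            (f · g) n ≡ (f′ · g′) n
  ·-cong≤ {f} {f′} {g} {g′} = ⊛-cong≤ {f} {f′} {g} {g′}

  ·-comm : ∀ f g n → (f · g) n ≡ (g · f) n
  ·-comm = ⊛-comm

  ·-assoc : ∀ f g h n → ((f · g) · h) n ≡ (f · (g · h)) n
  ·-assoc = ⊛-assoc

  ·-distribʳ : ∀ f g h n → ((f ⊕ g) · h) n ≡ (f · h) n ℤ.+ (g · h) n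
  ·-distribʳ = ⊛-distribʳ

  ·-identityˡ : ∀ f n → (oneS · f) n ≡ f n
  ·-identityˡ = ⊛-identityˡ

  const-· : ∀ c f n → (const c · f) n ≡ c ℤ.* f n
  const-· = const-⊛

  ·-suc : ∀ f g n → (f · g) (suc n) ≡ f 0 ℤ.* g (suc n) ℤ.+ (tail f · g) n
  ·-suc = ⊛-suc

  ·-zero : ∀ f g → (f · g) 0 ≡ f 0 ℤ.* g 0
  ·-zero f g = ℤₚ.+-identityˡ (f 0 ℤ.* g 0)

FPS-commutativeRing : CommutativeRing 0ℓ 0ℓ
FPS-commutativeRing = record
  { Carrier = FPS
  ; _≈_ = _≋_
  ; _+_ = _⊕_
  ; _*_ = _·_
  ; -_ = ⊖_
  ; 0# = zeroS
  ; 1# = oneS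
  ; isCommutativeRing = record
    { isRing = record
      { +-isAbelianGroup = record
        { isGroup = record
          { isMonoid = record
            { isSemigroup = record
              { isMagma = record
                { isEquivalence = record
                  { refl = mk λ _ → refl
                  ; sym = λ p → mk λ n → sym (at p n)
                  ; trans = λ p q → mk λ n → trans (at p n) (at q n)
                  }
                ; ∙-cong = λ p q → mk λ n → cong₂ ℤ._+_ (at p n) (at q n)
                }
              ; assoc = λ f g h → mk λ n → ℤₚ.+-assoc (f n) (g n) (h n)
              }
            ; identity = (λ f → mk λ n → ℤₚ.+-identityˡ (f n)) , (λ f → mk λ n → ℤₚ.+-identityʳ (f n))
            }
          ; inverse = (λ f → mk λ n → ℤₚ.+-inverseˡ (f n)) , (λ f → mk λ n → ℤₚ.+-inverseʳ (f n))
          ; ⁻¹-cong = λ p → mk λ n → cong ℤ.-_ (at p n)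
          }
        ; comm = λ f g → mk λ n → ℤₚ.+-comm (f n) (g n)
        }
      ; *-cong = λ p q → mk λ n → ·-cong≤ n (λ i _ → at p i) (λ i _ → at q i)
      ; *-assoc = λ f g h → mk (·-assoc f g h)
      ; *-identity = (λ f → mk (·-identityˡ f)) , (λ f → mk λ n → trans (·-comm f oneS n) (·-identityˡ f n))
      ; distrib = (λ f g h → mk λ n → trans (·-comm f (g ⊕ h) n)
                      (trans (·-distribʳ g h f n) (cong₂ ℤ._+_ (·-comm g f n) (·-comm h f n))))
                , (λ f g h → mk (·-distribʳ g h f))
      }
    ; *-comm = λ f g → mk (·-comm f g)
    }
  }

module R = CommutativeRing FPS-commutativeRing
module ≋-Reasoning = SetoidReasoning R.setoid

FPS-ACR : ACR.AlmostCommutativeRing 0ℓ 0ℓ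
FPS-ACR = ACR.fromCommutativeRing FPS-commutativeRing

-- The ring solver has to compare coefficients, which cannot be decided for series; integers,
-- embedded as constant series, serve as coefficients instead.
const-morphism : ℤ.+-*-rawRing ACR.-Raw-AlmostCommutative⟶ FPS-ACR
const-morphism = record
  { ⟦_⟧ = const
  ; +-homo = λ a b → mk λ { zero → refl ; (suc n) → refl }
  ; *-homo = λ a b → mk λ n → sym (trans (const-· a (const b) n) (scaled a b n))
  ; -‿homo = λ a → mk λ { zero → refl ; (suc n) → refl }
  ; 0-homo = mk λ { zero → refl ; (suc n) → refl }
  ; 1-homo = mk const-1
  }
  where
  scaled : ∀ a b n → a ℤ.* const b n ≡ const (a ℤ.* b) n
  scaled a b zero    = refl
  scaled a b (suc n) = ℤₚ.*-zeroʳ a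

const-≟ : ∀ a b → Maybe (const a ≋ const b)
const-≟ a b with a ℤ.≟ b
... | yes refl = just R.refl
... | no _     = nothing

module FPS-Solver = Algebra.Solver.Ring ℤ.+-*-rawRing FPS-ACR const-morphism const-≟

-- Congruence modulo q^(N+1), and monomials

_≈[_]_ : FPS → ℕ → FPS → Set
f ≈[ N ] g = ∀ n → n ≤ N → f n ≡ g n

≈-· : ∀ {N f f′ g g′} → f ≈[ N ] f′ → g ≈[ N ] g′ → (f · g) ≈[ N ] (f′ · g′)
≈-· p q n n≤N = ·-cong≤ n (λ i i≤n → p i (ℕₚ.≤-trans i≤n n≤N)) (λ i i≤n → q i (ℕₚ.≤-trans i≤n n≤N))

≋⇒≈ : ∀ {N f g} → f ≋ g → f ≈[ N ] g
≋⇒≈ p n _ = at p n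

≈-trans : ∀ {N f g h} → f ≈[ N ] g → g ≈[ N ] h → f ≈[ N ] h
≈-trans p q n n≤N = trans (p n n≤N) (q n n≤N)

≈-sym : ∀ {N f g} → f ≈[ N ] g → g ≈[ N ] f
≈-sym p n n≤N = sym (p n n≤N)

≈-weaken : ∀ {M N f g} → M ≤ N → f ≈[ N ] g → f ≈[ M ] g
≈-weaken M≤N p n n≤M = p n (ℕₚ.≤-trans n≤M M≤N)

≈⇒≋ : ∀ {f g} → (∀ N → f ≈[ N ] g) → f ≋ g
≈⇒≋ p = mk λ n → p n n ℕₚ.≤-refl

mono : ℕ → FPS
mono e n = if n ≡ᵇ e then 1ℤ else 0ℤ

mono-0 : mono 0 ≋ oneS
mono-0 = mk λ { zero → refl ; (suc n) → refl }

mono-·-+ : ∀ e f k → (mono e · f) (e + k) ≡ f k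
mono-·-+ zero    f k = trans (at (R.*-congʳ mono-0) k) (·-identityˡ f k)
mono-·-+ (suc e) f k = trans (·-suc (mono (suc e)) f (e + k))
  (trans (ℤₚ.+-identityˡ ((mono e · f) (e + k))) (mono-·-+ e f k))

mono-·-< : ∀ e f {n} → n < e → (mono e · f) n ≡ 0ℤ
mono-·-< (suc e) f {zero}  _ = ·-zero (mono (suc e)) f
mono-·-< (suc e) f {suc n} (s≤s n<e) = trans (·-suc (mono (suc e)) f n)
  (trans (ℤₚ.+-identityˡ ((mono e · f) n)) (mono-·-< e f n<e))

mono-· : ∀ e f g → (∀ {n} → n < e → g n ≡ 0ℤ) → (∀ k → g (e + k) ≡ f k) → mono e · f ≋ g
mono-· e f g below above = mk λ n → helper n (ℕₚ.≤-<-connex e n)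
  where
  helper : ∀ n → e ≤ n ⊎ n < e → (mono e · f) n ≡ g n
  helper n (inj₂ n<e) = trans (mono-·-< e f n<e) (sym (below n<e))
  helper n (inj₁ e≤n) rewrite sym (ℕₚ.m+[n∸m]≡n e≤n) =
    trans (mono-·-+ e f (n ∸ e)) (sym (above (n ∸ e)))

mono-·-cancel : ∀ e {f g} → mono e · f ≋ mono e · g → f ≋ g
mono-·-cancel e {f} {g} p = mk λ k →
  trans (sym (mono-·-+ e f k)) (trans (at p (e + k)) (mono-·-+ e g k))

≡ᵇ-refl : ∀ n → (n ≡ᵇ n) ≡ true
≡ᵇ-refl zero    = refl
≡ᵇ-refl (suc n) = ≡ᵇ-refl n

≡ᵇ-+ : ∀ d m n → (d + m ≡ᵇ d + n) ≡ (m ≡ᵇ n)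
≡ᵇ-+ zero    m n = refl
≡ᵇ-+ (suc d) m n = ≡ᵇ-+ d m n

≡ᵇ-< : ∀ {m n} → m < n → (m ≡ᵇ n) ≡ false
≡ᵇ-< {zero}  {suc n} _       = refl
≡ᵇ-< {suc m} {suc n} (s≤s p) = ≡ᵇ-< p

if-cong : ∀ {b c : Bool} {x y : ℤ} → b ≡ c → (if b then x else y) ≡ (if c then x else y)
if-cong refl = refl

mono-+ : ∀ d e → mono d · mono e ≋ mono (d + e)
mono-+ d e = mono-· d (mono e) (mono (d + e))
  (λ n<d → if-cong (≡ᵇ-< (ℕₚ.<-≤-trans n<d (ℕₚ.m≤m+n d e))))
  (λ k → if-cong (≡ᵇ-+ d k e))

-- Multiplication by q^e gains `e` orders of precision. The triple product depends on this gain: one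
-- of its factors is accurate only up to order `n ∸ k`.
≈-mono-· : ∀ e {N f g} → f ≈[ N ] g → (mono e · f) ≈[ e + N ] (mono e · g)
≈-mono-· e {N} {f} {g} p n n≤ with ℕₚ.≤-<-connex e n
... | inj₂ n<e = trans (mono-·-< e f n<e) (sym (mono-·-< e g n<e))
... | inj₁ e≤n rewrite sym (ℕₚ.m+[n∸m]≡n e≤n) =
  trans (mono-·-+ e f (n ∸ e))
    (trans (p (n ∸ e) (ℕₚ.+-cancelˡ-≤ e (n ∸ e) N n≤)) (sym (mono-·-+ e g (n ∸ e))))

oneMinusQ-mono : ∀ e → oneMinusQ e ≋ oneS ⊕ ⊖ mono e
oneMinusQ-mono e = mk λ { zero → refl ; (suc n) → refl }

geomQ-unfold : ∀ e → geomQ e ≋ oneS ⊕ mono (suc e) · geomQ e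
-- `oneS` enters the solver as an indeterminate, because `con 1ℤ` denotes `const 1ℤ`, which agrees
-- with `oneS` only pointwise.
geomQ-unfold e = R.trans (R.sym (solve 2 (λ g o → o :+ (g :+ :- o) := g) R.refl (geomQ e) oneS))
  (R.+-congˡ {oneS} (R.sym (mono-· (suc e) (geomQ e) (geomQ e ⊕ ⊖ oneS) below above)))
  where
  open FPS-Solver
  below : ∀ {n} → n < suc e → (geomQ e ⊕ ⊖ oneS) n ≡ 0ℤ
  below {zero}  n<e = refl
  below {suc n} n<e rewrite ℕ-DivMod.m<n⇒m%n≡m n<e = refl
  above : ∀ k → (geomQ e ⊕ ⊖ oneS) (suc e + k) ≡ geomQ e k
  above k = trans (ℤₚ.+-identityʳ (geomQ e (suc e + k))) (if-cong (cong (_≡ᵇ 0)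
    (trans (cong (_% suc e) (ℕₚ.+-comm (suc e) k)) (ℕ-DivMod.[m+n]%n≡m%n k (suc e)))))

oneMinusQ-geomQ : ∀ e → oneMinusQ (suc e) · geomQ e ≋ oneS
oneMinusQ-geomQ e = begin
  oneMinusQ (suc e) · geomQ e
    ≈⟨ R.*-congʳ (oneMinusQ-mono (suc e)) ⟩
  (oneS ⊕ ⊖ mono (suc e)) · geomQ e
    ≈⟨ solve 3 (λ o m g → (o :+ :- m) :* g := o :* g :+ :- (m :* g)) R.refl oneS (mono (suc e)) (geomQ e) ⟩
  oneS · geomQ e ⊕ ⊖ (mono (suc e) · geomQ e)
    ≈⟨ R.+-congʳ (R.*-identityˡ (geomQ e)) ⟩
  geomQ e ⊕ ⊖ (mono (suc e) · geomQ e)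
    ≈⟨ R.+-congʳ (geomQ-unfold e) ⟩
  (oneS ⊕ mono (suc e) · geomQ e) ⊕ ⊖ (mono (suc e) · geomQ e)
    ≈⟨ solve 2 (λ o x → (o :+ x) :+ :- x := o) R.refl oneS (mono (suc e) · geomQ e) ⟩
  oneS ∎
  where
  open ≋-Reasoning
  open FPS-Solver

-- Finite and infinite products

∏ : ℕ → (ℕ → FPS) → FPS
∏ zero    F = oneS
∏ (suc k) F = ∏ k F · F k

prodBelow-∏ : ∀ n F → prodBelow n F ≋ ∏ n F
prodBelow-∏ zero    F = R.refl
prodBelow-∏ (suc n) F =
  R.trans (R.sym (·-def (prodBelow n F) (F n))) (R.*-congʳ (prodBelow-∏ n F))

∏-cong< : ∀ n {F G} → (∀ i → i < n → F i ≋ G i) → ∏ n F ≋ ∏ n G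
∏-cong< zero    e = R.refl
∏-cong< (suc n) e = R.*-cong (∏-cong< n (λ i i<n → e i (ℕₚ.m<n⇒m<1+n i<n))) (e n (ℕₚ.n<1+n n))

∏-cong : ∀ n {F G} → (∀ i → F i ≋ G i) → ∏ n F ≋ ∏ n G
∏-cong n e = ∏-cong< n (λ i _ → e i)

∏-one : ∀ n → ∏ n (λ _ → oneS) ≋ oneS
∏-one zero    = R.refl
∏-one (suc n) = R.trans (R.*-identityʳ _) (∏-one n)

∏-· : ∀ n F G → ∏ n (λ i → F i · G i) ≋ ∏ n F · ∏ n G
∏-· zero    F G = R.sym (R.*-identityˡ oneS)
∏-· (suc n) F G = R.trans (R.*-congʳ (∏-· n F G))
  (solve 4 (λ a b c d → (a :* b) :* (c :* d) := (a :* c) :* (b :* d)) R.refl (∏ n F) (∏ n G) (F n) (G n))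
  where open FPS-Solver

∏-append : ∀ m n F → ∏ (m + n) F ≋ ∏ m F · ∏ n (λ i → F (m + i))
∏-append m zero    F rewrite ℕₚ.+-identityʳ m = R.sym (R.*-identityʳ (∏ m F))
∏-append m (suc n) F rewrite ℕₚ.+-suc m n =
  R.trans (R.*-congʳ (∏-append m n F)) (R.*-assoc (∏ m F) (∏ n (λ i → F (m + i))) (F (m + n)))

∏-first : ∀ n F → ∏ (suc n) F ≋ F 0 · ∏ n (λ i → F (suc i))
∏-first n F = R.trans (∏-append 1 n F) (R.*-congʳ (R.*-identityˡ (F 0)))

∏-reverse : ∀ n F → ∏ n F ≋ ∏ n (λ i → F (n ∸ suc i))
∏-reverse zero    F = R.refl
∏-reverse (suc n) F = begin
  ∏ n F · F n                              ≈⟨ R.*-comm (∏ n F) (F n) ⟩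
  F n · ∏ n F                              ≈⟨ R.*-congˡ (∏-reverse n F) ⟩
  F n · ∏ n (λ i → F (n ∸ suc i))          ≈⟨ R.sym (∏-first n (λ i → F (n ∸ i))) ⟩
  ∏ (suc n) (λ i → F (n ∸ i))              ∎
  where open ≋-Reasoning

∏-blocks : ∀ p M F → ∏ (M * p) F ≋ ∏ p (λ r → ∏ M (λ i → F (i * p + r)))
∏-blocks p zero    F = R.sym (∏-one p)
∏-blocks p (suc M) F = begin
  ∏ (p + M * p) F
    ≡⟨ cong (λ k → ∏ k F) (ℕₚ.+-comm p (M * p)) ⟩
  ∏ (M * p + p) F
    ≈⟨ ∏-append (M * p) p F ⟩
  ∏ (M * p) F · ∏ p (λ r → F (M * p + r))
    ≈⟨ R.*-congʳ (∏-blocks p M F) ⟩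
  ∏ p (λ r → ∏ M (λ i → F (i * p + r))) · ∏ p (λ r → F (M * p + r))
    ≈⟨ R.sym (∏-· p (λ r → ∏ M (λ i → F (i * p + r))) (λ r → F (M * p + r))) ⟩
  ∏ p (λ r → ∏ (suc M) (λ i → F (i * p + r))) ∎
  where open ≋-Reasoning

∏∞ : (ℕ → FPS) → FPS
∏∞ F n = ∏ (suc n) F n

-- Factor i is 1 modulo q^(i+1), so the coefficient of q^n is settled by the factors with index
-- below n, and any longer partial product may stand in for the infinite one.
Convergent : (ℕ → FPS) → Set
Convergent F = ∀ i → F i ≈[ i ] oneS

·-≈one : ∀ {N f g} → g ≈[ N ] oneS → (f · g) ≈[ N ] f
·-≈one {f = f} p = ≈-trans (≈-· (λ _ _ → refl) p) (≋⇒≈ (R.*-identityʳ f))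

∏-stable : ∀ {F} → Convergent F → ∀ N k → ∏ (k + N) F ≈[ N ] ∏ N F
∏-stable conv N zero    = λ _ _ → refl
∏-stable conv N (suc k) =
  ≈-trans (·-≈one (≈-weaken (ℕₚ.m≤n+m N k) (conv (k + N)))) (∏-stable conv N k)

∏∞-≈ : ∀ {F} → Convergent F → ∀ {N M} → N ≤ M → ∏∞ F ≈[ N ] ∏ M F
∏∞-≈ {F} conv {N} {M} N≤M n n≤N = trans (∏-stable conv n 1 n ℕₚ.≤-refl) (sym
  (trans (cong (λ k → ∏ k F n) (sym (ℕₚ.m∸n+n≡m n≤M))) (∏-stable conv n (M ∸ n) n ℕₚ.≤-refl)))
  where n≤M = ℕₚ.≤-trans n≤N N≤M

∏∞-inverse : ∀ {F G} → Convergent F → Convergent G → (∀ i → F i · G i ≋ oneS) → ∏∞ F · ∏∞ G ≋ oneS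
∏∞-inverse {F} {G} cF cG inv = ≈⇒≋ λ N →
  ≈-trans (≈-· (∏∞-≈ cF ℕₚ.≤-refl) (∏∞-≈ cG ℕₚ.≤-refl))
    (≋⇒≈ (R.trans (R.sym (∏-· N F G)) (R.trans (∏-cong N inv) (∏-one N))))

∏-≈ : ∀ {N} n {F G} → (∀ i → F i ≈[ N ] G i) → ∏ n F ≈[ N ] ∏ n G
∏-≈ zero    p = λ _ _ → refl
∏-≈ (suc n) p = ≈-· (∏-≈ n p) (p n)

∏∞-blocks : ∀ p F → Convergent F → (∀ r → Convergent (λ i → F (i * suc p + r))) →
  ∏∞ F ≋ ∏ (suc p) (λ r → ∏∞ (λ i → F (i * suc p + r)))
∏∞-blocks p F cF cB = ≈⇒≋ λ N →
  ≈-trans (∏∞-≈ cF (ℕₚ.m≤m*n N (suc p)))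
  (≈-trans (≋⇒≈ (∏-blocks (suc p) N F))
           (∏-≈ (suc p) (λ r → ≈-sym (∏∞-≈ (cB r) ℕₚ.≤-refl))))

≡ᵇ-sym : ∀ m n → (m ≡ᵇ n) ≡ (n ≡ᵇ m)
≡ᵇ-sym zero    zero    = refl
≡ᵇ-sym zero    (suc n) = refl
≡ᵇ-sym (suc m) zero    = refl
≡ᵇ-sym (suc m) (suc n) = ≡ᵇ-sym m n

oneMinusQ-≈ : ∀ {e N} → N < e → oneMinusQ e ≈[ N ] oneS
oneMinusQ-≈ {e} N<e n n≤N = trans (at (oneMinusQ-mono e) n)
  (trans (cong (λ b → oneS n ℤ.+ ℤ.- (if b then 1ℤ else 0ℤ)) (≡ᵇ-< (ℕₚ.≤-<-trans n≤N N<e)))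
         (ℤₚ.+-identityʳ (oneS n)))

geomQ-≈ : ∀ {e N} → N ≤ e → geomQ e ≈[ N ] oneS
geomQ-≈ {e} N≤e n n≤N = trans (at (geomQ-unfold e) n)
  (trans (cong (ℤ._+_ (oneS n)) (mono-·-< (suc e) (geomQ e) (s≤s (ℕₚ.≤-trans n≤N N≤e)))) (ℤₚ.+-identityʳ (oneS n)))

progression-≤ : ∀ b c i → i ≤ b + i * suc c
progression-≤ b c i = ℕₚ.≤-trans (ℕₚ.m≤m*n i (suc c)) (ℕₚ.m≤n+m (i * suc c) b)

oneMinusQ-convergent : ∀ b c → Convergent (λ i → oneMinusQ (suc b + i * suc c))
oneMinusQ-convergent b c i = oneMinusQ-≈ (s≤s (progression-≤ b c i))

geomQ-convergent : ∀ b c → Convergent (λ i → geomQ (b + i * suc c))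
geomQ-convergent b c i = geomQ-≈ (progression-≤ b c i)

qPoch-∏∞ : ∀ b c → qPoch b c ≋ ∏∞ (λ i → oneMinusQ (suc b + i * suc c))
qPoch-∏∞ b c = mk λ n → at (prodBelow-∏ (suc n) (λ i → oneMinusQ (suc b + i * suc c))) n

qPochInv-∏∞ : ∀ b c → qPochInv b c ≋ ∏∞ (λ i → geomQ (b + i * suc c))
qPochInv-∏∞ b c = mk λ n → at (prodBelow-∏ (suc n) (λ i → geomQ (b + i * suc c))) n

qPoch-inverse : ∀ b c → qPoch b c · qPochInv b c ≋ oneS
qPoch-inverse b c = R.trans (R.*-cong (qPoch-∏∞ b c) (qPochInv-∏∞ b c))
  (∏∞-inverse (oneMinusQ-convergent b c) (geomQ-convergent b c) (λ i → oneMinusQ-geomQ (b + i * suc c)))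

-- Sorts the exponents by their class modulo p+1. With p = 2 it identifies the product side of `Θ₃`
-- with (q;q)_∞; with p = 4 it splits (q;q)_∞ into the factors cancelled at the end.
qPoch-dissect : ∀ p → qPoch 0 0 ≋ ∏ (suc p) (λ r → qPoch r p)
qPoch-dissect p = begin
  qPoch 0 0
    ≈⟨ qPoch-∏∞ 0 0 ⟩
  ∏∞ F
    ≈⟨ ∏∞-blocks p F (oneMinusQ-convergent 0 0) conv ⟩
  ∏ (suc p) (λ r → ∏∞ (λ i → F (i * suc p + r)))
    ≈⟨ ∏-cong (suc p) (λ r → R.sym (R.trans (qPoch-∏∞ r p) (mk λ n → at (∏-cong (suc n) (λ i → R.reflexive (cong oneMinusQ (exponent r i)))) n))) ⟩
  ∏ (suc p) (λ r → qPoch r p) ∎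
  where
  open ≋-Reasoning
  F : ℕ → FPS
  F i = oneMinusQ (1 + i * 1)
  exponent : ∀ r i → suc r + i * suc p ≡ 1 + (i * suc p + r) * 1
  exponent r i = cong suc (trans (ℕₚ.+-comm r (i * suc p)) (sym (ℕₚ.*-identityʳ (i * suc p + r))))
  conv : ∀ r → Convergent (λ i → F (i * suc p + r))
  conv r i = subst (λ e → oneMinusQ e ≈[ i ] oneS) (exponent r i) (oneMinusQ-convergent r p i)

ΣS : ℕ → (ℕ → FPS) → FPS
ΣS n F N = sumBelow n (λ j → F j N)

ΣS-cong< : ∀ n {F G} → (∀ i → i < n → F i ≋ G i) → ΣS n F ≋ ΣS n G
ΣS-cong< n e = mk λ N → sum-cong< n (λ i i<n → at (e i i<n) N)

ΣS-·ˡ : ∀ n f F → f · ΣS n F ≋ ΣS n (λ j → f · F j)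
ΣS-·ˡ zero    f F = R.zeroʳ f
ΣS-·ˡ (suc n) f F = R.trans (R.distribˡ f (ΣS n F) (F n)) (R.+-congʳ (ΣS-·ˡ n f F))

-- Rothe's q-binomial theorem, homogeneous in x and y, with base q^(c′+1).
module Rothe (c′ : ℕ) (x y : FPS) where

  c : ℕ
  c = suc c′

  -- `A j` is (-x)^j q^(c j(j-1)/2) / (q^c;q^c)_j and `B i` is y^i / (q^c;q^c)_i. The versions with
  -- ⁻ lack the last denominator factor, that is, they are multiplied by 1 - q^(jc) or 1 - q^(ic);
  -- this is 0 at index 0.
  A B A⁻ B⁻ : ℕ → FPS
  A zero    = oneS
  A (suc j) = A⁻ (suc j) · geomQ (c′ + j * c)
  B zero    = oneS
  B (suc i) = B⁻ (suc i) · geomQ (c′ + i * c)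
  A⁻ zero    = zeroS
  A⁻ (suc j) = ⊖ (x · mono (j * c)) · A j
  B⁻ zero    = zeroS
  B⁻ (suc i) = y · B i

  oneMinusQ-0 : oneMinusQ 0 ≋ zeroS
  oneMinusQ-0 = mk λ { zero → refl ; (suc n) → refl }

  A-lower : ∀ j → oneMinusQ (j * c) · A j ≋ A⁻ j
  A-lower zero    = R.trans (R.*-congʳ oneMinusQ-0) (R.zeroˡ oneS)
  A-lower (suc j) = begin
    o · (A⁻ (suc j) · g)
      ≈⟨ solve 3 (λ o a g → o :* (a :* g) := a :* (o :* g)) R.refl o (A⁻ (suc j)) g ⟩
    A⁻ (suc j) · (o · g)
      ≈⟨ R.*-congˡ (oneMinusQ-geomQ (c′ + j * c)) ⟩
    A⁻ (suc j) · oneS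
      ≈⟨ R.*-identityʳ (A⁻ (suc j)) ⟩
    A⁻ (suc j) ∎
    where
    open ≋-Reasoning
    open FPS-Solver
    o g : FPS
    o = oneMinusQ (suc j * c)
    g = geomQ (c′ + j * c)

  B-lower : ∀ i → oneMinusQ (i * c) · B i ≋ B⁻ i
  B-lower zero    = R.trans (R.*-congʳ oneMinusQ-0) (R.zeroˡ oneS)
  B-lower (suc i) = begin
    o · (B⁻ (suc i) · g)
      ≈⟨ solve 3 (λ o a g → o :* (a :* g) := a :* (o :* g)) R.refl o (B⁻ (suc i)) g ⟩
    B⁻ (suc i) · (o · g)
      ≈⟨ R.*-congˡ (oneMinusQ-geomQ (c′ + i * c)) ⟩
    B⁻ (suc i) · oneS
      ≈⟨ R.*-identityʳ (B⁻ (suc i)) ⟩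
    B⁻ (suc i) ∎
    where
    open ≋-Reasoning
    open FPS-Solver
    o g : FPS
    o = oneMinusQ (suc i * c)
    g = geomQ (c′ + i * c)

  -- The q-binomial sum divided by (q^c;q^c)_m. In this form the denominators sit inside `A` and
  -- `B`, and no q-binomial coefficient has to be defined.
  H : ℕ → FPS
  H m = ΣS (suc m) (λ j → A j · B (m ∸ j))

  oneMinusQ-split : ∀ d e → oneMinusQ (d + e) ≋ oneMinusQ e ⊕ mono e · oneMinusQ d
  oneMinusQ-split d e = begin
    oneMinusQ (d + e)
      ≈⟨ oneMinusQ-mono (d + e) ⟩
    oneS ⊕ ⊖ mono (d + e)
      ≈⟨ R.+-congˡ {oneS} (R.-‿cong (R.sym (mono-+ d e))) ⟩
    oneS ⊕ ⊖ (mono d · mono e)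
      ≈⟨ solve 3 (λ o d e → o :+ :- (d :* e) := (o :+ :- e) :+ (e :+ :- (e :* d))) R.refl oneS (mono d) (mono e) ⟩
    (oneS ⊕ ⊖ mono e) ⊕ (mono e ⊕ ⊖ (mono e · mono d))
      ≈⟨ R.+-cong (R.sym (oneMinusQ-mono e)) (R.trans (R.+-congʳ (R.sym (R.*-identityʳ (mono e))))
           (solve 3 (λ o d e → e :* o :+ :- (e :* d) := e :* (o :+ :- d)) R.refl oneS (mono d) (mono e))) ⟩
    oneMinusQ e ⊕ mono e · (oneS ⊕ ⊖ mono d)
      ≈⟨ R.+-congˡ {oneMinusQ e} (R.*-congˡ (R.sym (oneMinusQ-mono d))) ⟩
    oneMinusQ e ⊕ mono e · oneMinusQ d ∎
    where
    open ≋-Reasoning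
    open FPS-Solver

  -- In the term with j + i = m + 1, the factor 1 - q^((j+i)c) splits as (1 - q^(ic)) + q^(ic) (1 -
  -- q^(jc)). The first part lowers `B i` and yields y times `H m`; the second lowers `A j` and
  -- yields -x q^(mc) times `H m`. This plays the role of the q-Pascal rule.
  H-step : ∀ m → oneMinusQ (suc m * c) · H (suc m) ≋ (y ⊕ ⊖ (x · mono (m * c))) · H m
  H-step m = begin
    o · H (suc m)
      ≈⟨ ΣS-·ˡ (suc (suc m)) o (λ j → A j · B (suc m ∸ j)) ⟩
    ΣS (suc (suc m)) (λ j → o · (A j · B (suc m ∸ j)))
      ≈⟨ ΣS-cong< (suc (suc m)) (λ j j<2+m → term j (ℕₚ.≤-pred j<2+m)) ⟩
    ΣS (suc (suc m)) (λ j → U j ⊕ V j)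
      ≈⟨ mk (λ N → sum-+ (suc (suc m)) (λ j → U j N) (λ j → V j N)) ⟩
    (ΣS (suc m) U ⊕ U (suc m)) ⊕ ΣS (suc (suc m)) V
      ≈⟨ R.+-cong (R.+-cong U-sum U-last) (R.trans (mk λ N → sum-first (suc m) (λ j → V j N)) (R.+-cong V-first V-sum)) ⟩
    (y · H m ⊕ zeroS) ⊕ (zeroS ⊕ ⊖ (x · mono (m * c)) · H m)
      ≈⟨ R.+-cong (R.+-identityʳ (y · H m)) (R.+-identityˡ (⊖ (x · mono (m * c)) · H m)) ⟩
    y · H m ⊕ ⊖ (x · mono (m * c)) · H m
      ≈⟨ R.sym (R.distribʳ (H m) y (⊖ (x · mono (m * c)))) ⟩
    (y ⊕ ⊖ (x · mono (m * c))) · H m ∎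
    where
    open ≋-Reasoning
    open FPS-Solver
    o : FPS
    o = oneMinusQ (suc m * c)
    U V : ℕ → FPS
    U j = A j · B⁻ (suc m ∸ j)
    V j = mono ((suc m ∸ j) * c) · B (suc m ∸ j) · A⁻ j
    term : ∀ j → j ≤ suc m → o · (A j · B (suc m ∸ j)) ≋ U j ⊕ V j
    term j j≤ = begin
      o · (A j · B i)
        ≡⟨ cong (λ e → oneMinusQ e · (A j · B i)) (trans (cong (_* c) (sym (ℕₚ.m+[n∸m]≡n j≤))) (ℕₚ.*-distribʳ-+ c j i)) ⟩
      oneMinusQ (j * c + i * c) · (A j · B i)
        ≈⟨ R.*-congʳ (oneMinusQ-split (j * c) (i * c)) ⟩
      (oneMinusQ (i * c) ⊕ mono (i * c) · oneMinusQ (j * c)) · (A j · B i)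
        ≈⟨ solve 5 (λ oi mi oj a b → (oi :+ mi :* oj) :* (a :* b) := a :* (oi :* b) :+ mi :* b :* (oj :* a))
             R.refl (oneMinusQ (i * c)) (mono (i * c)) (oneMinusQ (j * c)) (A j) (B i) ⟩
      A j · (oneMinusQ (i * c) · B i) ⊕ mono (i * c) · B i · (oneMinusQ (j * c) · A j)
        ≈⟨ R.+-cong (R.*-congˡ (B-lower i)) (R.*-congˡ (A-lower j)) ⟩
      U j ⊕ V j ∎
      where
      i : ℕ
      i = suc m ∸ j
    U-last : U (suc m) ≋ zeroS
    U-last = R.trans (R.reflexive (cong (λ k → A (suc m) · B⁻ k) (ℕₚ.n∸n≡0 (suc m)))) (R.zeroʳ (A (suc m)))
    U-sum : ΣS (suc m) U ≋ y · H m
    U-sum = R.trans (ΣS-cong< (suc m) (λ j j<1+m →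
        R.trans (R.reflexive (cong (λ k → A j · B⁻ k) (ℕₚ.+-∸-assoc 1 (ℕₚ.≤-pred j<1+m))))
          (solve 3 (λ a y b → a :* (y :* b) := y :* (a :* b)) R.refl (A j) y (B (m ∸ j)))))
      (R.sym (ΣS-·ˡ (suc m) y (λ j → A j · B (m ∸ j))))
    V-first : V 0 ≋ zeroS
    V-first = R.zeroʳ (mono (suc m * c) · B (suc m))
    V-term : ∀ j → j ≤ m → V (suc j) ≋ ⊖ (x · mono (m * c)) · (A j · B (m ∸ j))
    V-term j j≤m = begin
      mono (i * c) · B i · (⊖ (x · mono (j * c)) · A j)
        ≈⟨ solve 5 (λ mi b x mj a → mi :* b :* (:- (x :* mj) :* a) := :- (x :* (mj :* mi)) :* (a :* b))
             R.refl (mono (i * c)) (B i) x (mono (j * c)) (A j) ⟩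
      ⊖ (x · (mono (j * c) · mono (i * c))) · (A j · B i)
        ≈⟨ R.*-congʳ (R.-‿cong (R.*-congˡ (R.trans (mono-+ (j * c) (i * c))
             (R.reflexive (cong mono (trans (sym (ℕₚ.*-distribʳ-+ c j i)) (cong (_* c) (ℕₚ.m+[n∸m]≡n j≤m)))))))) ⟩
      ⊖ (x · mono (m * c)) · (A j · B i) ∎
      where
      i : ℕ
      i = m ∸ j
    V-sum : ΣS (suc m) (λ j → V (suc j)) ≋ ⊖ (x · mono (m * c)) · H m
    V-sum = R.trans (ΣS-cong< (suc m) (λ j j<1+m → V-term j (ℕₚ.≤-pred j<1+m)))
      (R.sym (ΣS-·ˡ (suc m) (⊖ (x · mono (m * c))) (λ j → A j · B (m ∸ j))))

  rothe : ∀ m → ∏ m (λ i → oneMinusQ (suc i * c)) · H m ≋ ∏ m (λ i → y ⊕ ⊖ (x · mono (i * c)))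
  rothe zero    = R.trans (R.*-identityˡ (H 0)) (R.trans (mk λ N → ℤₚ.+-identityˡ ((oneS · oneS) N)) (R.*-identityˡ oneS))
  rothe (suc m) = begin
    P · o · H (suc m)
      ≈⟨ R.*-assoc P o (H (suc m)) ⟩
    P · (o · H (suc m))
      ≈⟨ R.*-congˡ (H-step m) ⟩
    P · (z · H m)
      ≈⟨ solve 3 (λ p z h → p :* (z :* h) := (p :* h) :* z) R.refl P z (H m) ⟩
    (P · H m) · z
      ≈⟨ R.*-congʳ (rothe m) ⟩
    ∏ (suc m) (λ i → y ⊕ ⊖ (x · mono (i * c))) ∎
    where
    open ≋-Reasoning
    open FPS-Solver
    P o z : FPS
    P = ∏ m (λ i → oneMinusQ (suc i * c))
    o = oneMinusQ (suc m * c)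
    z = y ⊕ ⊖ (x · mono (m * c))

-- The Jacobi triple product

-- The value is k p + c k(k-1)/2, given by recursion so that no division by 2 occurs.
arithSum : ℕ → ℕ → ℕ → ℕ
arithSum p c zero    = 0
arithSum p c (suc k) = arithSum p c k + (p + k * c)

arithSum-+ : ∀ p c t k → arithSum p c (t + k) ≡ arithSum p c t + arithSum p c k + k * (t * c)
arithSum-+ p c t zero    rewrite ℕₚ.+-identityʳ t = lem (arithSum p c t)
  where
  lem : ∀ x → x ≡ x + 0 + 0
  lem = ℕ-Solver.solve-∀
arithSum-+ p c t (suc k) rewrite ℕₚ.+-suc t k | arithSum-+ p c t k =
  lem (arithSum p c t) (arithSum p c k) p c t k
  where
  lem : ∀ X Y p c t k → X + Y + k * (t * c) + (p + (t + k) * c) ≡ X + (Y + (p + k * c)) + suc k * (t * c)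
  lem = ℕ-Solver.solve-∀

-- The exponents of the indices k and -k in the triple product add up to (a+b)k². This converts the
-- lower half of Rothe's sum from the progression of a to that of b.
arithSum-pair : ∀ a b k → arithSum a (a + b) k + arithSum b (a + b) k ≡ k * (k * (a + b))
arithSum-pair a b zero    = refl
arithSum-pair a b (suc k) = trans (lem₁ (arithSum a (a + b) k) (arithSum b (a + b) k) a b k)
  (trans (cong (λ z → z + (a + b) + 2 * (k * (a + b))) (arithSum-pair a b k)) (lem₂ a b k))
  where
  lem₁ : ∀ X Y a b k → (X + (a + k * (a + b))) + (Y + (b + k * (a + b))) ≡ (X + Y) + (a + b) + 2 * (k * (a + b))
  lem₁ = ℕ-Solver.solve-∀
  lem₂ : ∀ a b k → k * (k * (a + b)) + (a + b) + 2 * (k * (a + b)) ≡ suc k * (suc k * (a + b))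
  lem₂ = ℕ-Solver.solve-∀

arithSum-≥ : ∀ p c k → k ≤ arithSum (suc p) c k
arithSum-≥ p c zero    = z≤n
arithSum-≥ p c (suc k) = subst (_≤ arithSum (suc p) c k + (suc p + k * c)) (ℕₚ.+-comm k 1)
  (ℕₚ.+-mono-≤ (arithSum-≥ p c k) (s≤s z≤n))

sgn : ℕ → ℤ
sgn zero    = 1ℤ
sgn (suc k) = ℤ.- sgn k

sgn-+ : ∀ m n → sgn (m + n) ≡ sgn m ℤ.* sgn n
sgn-+ zero    n = sym (ℤₚ.*-identityˡ (sgn n))
sgn-+ (suc m) n = trans (cong ℤ.-_ (sgn-+ m n)) (ℤₚ.neg-distribˡ-* (sgn m) (sgn n))

sgn-sq : ∀ m → sgn m ℤ.* sgn m ≡ 1ℤ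
sgn-sq zero    = refl
sgn-sq (suc m) = trans (lem (sgn m)) (sgn-sq m)
  where
  lem : ∀ x → (ℤ.- x) ℤ.* (ℤ.- x) ≡ x ℤ.* x
  lem = ℤ-Solver.solve-∀

-- The range is -B ≤ k < B. It is not symmetric, so even the reflection k ↦ -k needs a support
-- condition.
ΣZ : ℕ → (ℤ → ℤ) → ℤ
ΣZ B f = sumBelow B (λ k → f (+ k)) ℤ.+ sumBelow B (λ k → f -[1+ k ])

-- expo a b k = ((a + b) k² + (a - b) k) / 2
expo : ℕ → ℕ → ℤ → ℕ
expo a b (+ k)    = arithSum a (a + b) k
expo a b -[1+ k ] = arithSum b (a + b) (suc k)

sg : ℤ → ℤ
sg k = sgn ∣ k ∣

-- Σ_{k∈ℤ} w(k) q^{E(k)}; the truncation is only correct for exponents with E(k) ≥ |k|.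
gen : (ℤ → ℕ) → (ℤ → ℤ) → FPS
gen E w N = ΣZ (suc N) (λ k → if E k ≡ᵇ N then w k else 0ℤ)

const-* : ∀ a b → const a · const b ≋ const (a ℤ.* b)
const-* a b = R.sym (ACR._-Raw-AlmostCommutative⟶_.*-homo const-morphism a b)

const-neg : ∀ a → const (ℤ.- a) ≋ ⊖ const a
const-neg a = ACR._-Raw-AlmostCommutative⟶_.-‿homo const-morphism a

signedMono : ℤ → ℕ → FPS
signedMono s e = const s · mono e

signedMono-coeff : ∀ s e N → signedMono s e N ≡ (if e ≡ᵇ N then s else 0ℤ)
signedMono-coeff s e N = trans (const-· s (mono e) N)
  (trans (lem (N ≡ᵇ e)) (cong (λ b → if b then s else 0ℤ) (≡ᵇ-sym N e)))
  where
  lem : ∀ b → s ℤ.* (if b then 1ℤ else 0ℤ) ≡ (if b then s else 0ℤ)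
  lem true  = ℤₚ.*-identityʳ s
  lem false = ℤₚ.*-zeroʳ s

signedMono-· : ∀ s d r e → signedMono s d · signedMono r e ≋ signedMono (s ℤ.* r) (d + e)
signedMono-· s d r e = R.trans
  (solve 4 (λ s d r e → (s :* d) :* (r :* e) := (s :* r) :* (d :* e)) R.refl (const s) (mono d) (const r) (mono e))
  (R.*-cong (const-* s r) (mono-+ d e))
  where open FPS-Solver

signedMono-cancel : ∀ s e {f g} → s ℤ.* s ≡ 1ℤ → signedMono s e · f ≋ signedMono s e · g → f ≋ g
signedMono-cancel s e {f} {g} ss p = mono-·-cancel e (begin
  mono e · f                              ≈⟨ clear f ⟩
  const s · (signedMono s e · f)          ≈⟨ R.*-congˡ p ⟩
  const s · (signedMono s e · g)          ≈⟨ R.sym (clear g) ⟩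
  mono e · g                              ∎)
  where
  open ≋-Reasoning
  open FPS-Solver
  clear : ∀ h → mono e · h ≋ const s · (signedMono s e · h)
  clear h = begin
    mono e · h
      ≈⟨ R.sym (R.*-identityˡ (mono e · h)) ⟩
    oneS · (mono e · h)
      ≈⟨ R.*-congʳ (R.sym (R.trans (const-* s s) (R.trans (R.reflexive (cong const ss)) (mk const-1)))) ⟩
    const s · const s · (mono e · h)
      ≈⟨ solve 3 (λ s m h → s :* s :* (m :* h) := s :* ((s :* m) :* h)) R.refl (const s) (mono e) h ⟩
    const s · (signedMono s e · h) ∎

module JacobiTripleProduct (a′ b′ : ℕ) where

  a b c c′ : ℕ
  a = suc a′
  b = suc b′
  c′ = a′ + suc b′
  c = suc c′

  Qf I : ℕ → FPS
  Qf n = ∏ n (λ i → oneMinusQ (c + i * c))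
  I n = ∏ n (λ i → geomQ (c′ + i * c))

  module Finite (n : ℕ) where

    -- Rothe's identity is used with 2n factors q^(nc) - q^(a+ic). For i < n such a factor is
    -- -q^(a+ic) (1 - q^(b+(n-1-i)c)), as a + b = c; for index n+i it is q^(nc) (1 - q^(a+ic)).
    -- Taking y = q^(nc) instead of dividing x by q^(nc) keeps all exponents non-negative.
    open Rothe c′ (mono a) (mono (n * c)) hiding (c)

    A-closed : ∀ j → A j ≋ signedMono (sgn j) (arithSum a c j) · I j
    A-closed zero = R.sym (R.trans (R.*-identityʳ (signedMono 1ℤ 0))
      (R.trans (R.*-cong (mk const-1) mono-0) (R.*-identityˡ oneS)))
    A-closed (suc j) = begin
      ⊖ (mono a · mono (j * c)) · A j · g
        ≈⟨ R.*-congʳ (R.*-cong (R.-‿cong (mono-+ a (j * c))) (A-closed j)) ⟩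
      ⊖ mono (a + j * c) · (const s · mono X · I j) · g
        ≈⟨ solve 5 (λ m s x i g → :- m :* (s :* x :* i) :* g := :- s :* (x :* m) :* (i :* g)) R.refl
             (mono (a + j * c)) (const s) (mono X) (I j) g ⟩
      ⊖ const s · (mono X · mono (a + j * c)) · (I j · g)
        ≈⟨ R.*-congʳ (R.*-cong (R.sym (const-neg s)) (mono-+ X (a + j * c))) ⟩
      signedMono (sgn (suc j)) (arithSum a c (suc j)) · I (suc j) ∎
      where
      open ≋-Reasoning
      open FPS-Solver
      g : FPS
      g = geomQ (c′ + j * c)
      s : ℤ
      s = sgn j
      X : ℕ
      X = arithSum a c j

    B-closed : ∀ i → B i ≋ mono (i * (n * c)) · I i
    B-closed zero = R.sym (R.trans (R.*-identityʳ (mono 0)) mono-0)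
    B-closed (suc i) = begin
      mono (n * c) · B i · g
        ≈⟨ R.*-congʳ (R.*-congˡ (B-closed i)) ⟩
      mono (n * c) · (mono (i * (n * c)) · I i) · g
        ≈⟨ solve 4 (λ m x i g → m :* (x :* i) :* g := (m :* x) :* (i :* g)) R.refl
             (mono (n * c)) (mono (i * (n * c))) (I i) g ⟩
      (mono (n * c) · mono (i * (n * c))) · (I i · g)
        ≈⟨ R.*-congʳ (mono-+ (n * c) (i * (n * c))) ⟩
      mono (suc i * (n * c)) · I (suc i) ∎
      where
      open ≋-Reasoning
      open FPS-Solver
      g : FPS
      g = geomQ (c′ + i * c)

    -- The monomial of the central term j = n. Both sides of Rothe's identity are divisible by it,
    -- and dividing it out centres the sum at k = j - n.
    lead : FPS
    lead = signedMono (sgn n) (arithSum a c n + n * (n * c))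

    AB-term : ∀ j i s e → sgn j ≡ sgn n ℤ.* s →
      arithSum a c j + i * (n * c) ≡ (arithSum a c n + n * (n * c)) + e →
      A j · B i ≋ lead · (signedMono s e · (I j · I i))
    AB-term j i s e sign exponent = begin
      A j · B i
        ≈⟨ R.*-cong (A-closed j) (B-closed i) ⟩
      const (sgn j) · mono X · I j · (mono Y · I i)
        ≈⟨ solve 5 (λ s x ij y ii → s :* x :* ij :* (y :* ii) := s :* (x :* y) :* (ij :* ii)) R.refl
             (const (sgn j)) (mono X) (I j) (mono Y) (I i) ⟩
      const (sgn j) · (mono X · mono Y) · (I j · I i)
        ≈⟨ R.*-congʳ (R.*-cong (R.reflexive (cong const sign)) (R.trans (mono-+ X Y) (R.reflexive (cong mono exponent)))) ⟩
      signedMono (sgn n ℤ.* s) ((arithSum a c n + n * (n * c)) + e) · (I j · I i)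
        ≈⟨ R.*-congʳ (R.sym (signedMono-· (sgn n) (arithSum a c n + n * (n * c)) s e)) ⟩
      lead · signedMono s e · (I j · I i)
        ≈⟨ R.*-assoc lead (signedMono s e) (I j · I i) ⟩
      lead · (signedMono s e · (I j · I i)) ∎
      where
      open ≋-Reasoning
      open FPS-Solver
      X Y : ℕ
      X = arithSum a c j
      Y = i * (n * c)

    S⁺ S⁻ : ℕ → FPS
    S⁺ k = signedMono (sgn k) (arithSum a c k) · (I (n + k) · I (n ∸ k))
    S⁻ k = signedMono (sgn (suc k)) (arithSum b c (suc k)) · (I (n ∸ suc k) · I (n + suc k))

    upper : ∀ k → k ≤ n → A (n + k) · B ((n + n) ∸ (n + k)) ≋ lead · S⁺ k
    upper k k≤n rewrite ℕₚ.[m+n]∸[m+o]≡n∸o n n k =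
      AB-term (n + k) (n ∸ k) (sgn k) (arithSum a c k) (sgn-+ n k) (begin
        arithSum a c (n + k) + i * (n * c)
          ≡⟨ cong (_+ i * (n * c)) (arithSum-+ a c n k) ⟩
        arithSum a c n + arithSum a c k + k * (n * c) + i * (n * c)
          ≡⟨ lem (arithSum a c n) (arithSum a c k) k i (n * c) ⟩
        arithSum a c n + (k + i) * (n * c) + arithSum a c k
          ≡⟨ cong (λ z → arithSum a c n + z * (n * c) + arithSum a c k) (ℕₚ.m+[n∸m]≡n k≤n) ⟩
        arithSum a c n + n * (n * c) + arithSum a c k ∎)
      where
      open ≡-Reasoning
      i : ℕ
      i = n ∸ k
      lem : ∀ X Y k i z → X + Y + k * z + i * z ≡ X + (k + i) * z + Y
      lem = ℕ-Solver.solve-∀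

    lower : ∀ k → k < n → A (n ∸ suc k) · B ((n + n) ∸ (n ∸ suc k)) ≋ lead · S⁻ k
    lower k k<n = R.trans (R.reflexive (cong (λ i → A j · B i) index))
      (AB-term j (n + κ) (sgn κ) (arithSum b c κ) sign exponent)
      where
      open ≡-Reasoning
      κ j : ℕ
      κ = suc k
      j = n ∸ κ
      j+κ : j + κ ≡ n
      j+κ = ℕₚ.m∸n+n≡m k<n
      index : (n + n) ∸ j ≡ n + κ
      index = trans (ℕₚ.+-∸-assoc n (ℕₚ.m∸n≤m n κ)) (cong (_+_ n) (ℕₚ.m∸[m∸n]≡n k<n))
      sign : sgn j ≡ sgn n ℤ.* sgn κ
      sign = begin
        sgn j                              ≡⟨ sym (ℤₚ.*-identityʳ (sgn j)) ⟩
        sgn j ℤ.* 1ℤ                       ≡⟨ cong (ℤ._*_ (sgn j)) (sym (sgn-sq κ)) ⟩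
        sgn j ℤ.* (sgn κ ℤ.* sgn κ)        ≡⟨ sym (ℤₚ.*-assoc (sgn j) (sgn κ) (sgn κ)) ⟩
        sgn j ℤ.* sgn κ ℤ.* sgn κ          ≡⟨ cong (ℤ._* sgn κ) (sym (sgn-+ j κ)) ⟩
        sgn (j + κ) ℤ.* sgn κ              ≡⟨ cong (λ m → sgn m ℤ.* sgn κ) j+κ ⟩
        sgn n ℤ.* sgn κ                    ∎
      exponent : arithSum a c j + (n + κ) * (n * c) ≡ (arithSum a c n + n * (n * c)) + arithSum b c κ
      exponent = begin
        X j + (n + κ) * (n * c)
          ≡⟨ lem₁ (X j) n κ c ⟩
        X j + κ * (n * c) + n * (n * c)
          ≡⟨ cong (λ m → X j + κ * (m * c) + n * (n * c)) (sym j+κ) ⟩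
        X j + κ * ((j + κ) * c) + n * (n * c)
          ≡⟨ lem₂ (X j) j κ c (n * (n * c)) ⟩
        X j + κ * (j * c) + κ * (κ * c) + n * (n * c)
          ≡⟨ cong (λ z → X j + κ * (j * c) + z + n * (n * c)) (sym (arithSum-pair a b κ)) ⟩
        X j + κ * (j * c) + (X κ + arithSum b c κ) + n * (n * c)
          ≡⟨ lem₃ (X j) (κ * (j * c)) (X κ) (arithSum b c κ) (n * (n * c)) ⟩
        (X j + X κ + κ * (j * c)) + n * (n * c) + arithSum b c κ
          ≡⟨ cong (λ z → z + n * (n * c) + arithSum b c κ) (trans (sym (arithSum-+ a c j κ)) (cong X j+κ)) ⟩
        X n + n * (n * c) + arithSum b c κ ∎
        where
        X : ℕ → ℕ
        X = arithSum a c
        lem₁ : ∀ x n k c → x + (n + k) * (n * c) ≡ x + k * (n * c) + n * (n * c)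
        lem₁ = ℕ-Solver.solve-∀
        lem₂ : ∀ x j k c z → x + k * ((j + k) * c) + z ≡ x + k * (j * c) + k * (k * c) + z
        lem₂ = ℕ-Solver.solve-∀
        lem₃ : ∀ x y z w v → x + y + (z + w) + v ≡ (x + z + y) + v + w
        lem₃ = ℕ-Solver.solve-∀

    H-closed : H (n + n) ≋ lead · (ΣS n S⁻ ⊕ ΣS (suc n) S⁺)
    H-closed = begin
      ΣS (suc (n + n)) t
        ≡⟨ cong (λ m → ΣS m t) (sym (ℕₚ.+-suc n n)) ⟩
      ΣS (n + suc n) t
        ≈⟨ mk (λ N → sum-append n (suc n) (λ j → t j N)) ⟩
      ΣS n t ⊕ ΣS (suc n) (λ k → t (n + k))
        ≈⟨ R.+-cong (R.trans (mk λ N → sum-reverse n (λ j → t j N)) (ΣS-cong< n lower))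
                    (ΣS-cong< (suc n) (λ k k<1+n → upper k (ℕₚ.≤-pred k<1+n))) ⟩
      ΣS n (λ k → lead · S⁻ k) ⊕ ΣS (suc n) (λ k → lead · S⁺ k)
        ≈⟨ R.+-cong (R.sym (ΣS-·ˡ n lead S⁻)) (R.sym (ΣS-·ˡ (suc n) lead S⁺)) ⟩
      lead · ΣS n S⁻ ⊕ lead · ΣS (suc n) S⁺
        ≈⟨ R.sym (R.distribˡ lead (ΣS n S⁻) (ΣS (suc n) S⁺)) ⟩
      lead · (ΣS n S⁻ ⊕ ΣS (suc n) S⁺) ∎
      where
      open ≋-Reasoning
      t : ℕ → FPS
      t j = A j · B ((n + n) ∸ j)

    Pa Pb : FPS
    Pa = ∏ n (λ i → oneMinusQ (a + i * c))
    Pb = ∏ n (λ i → oneMinusQ (b + i * c))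

    factor : ℕ → FPS
    factor i = mono (n * c) ⊕ ⊖ (mono a · mono (i * c))

    mono-difference : ∀ d e → mono d ⊕ ⊖ mono (d + e) ≋ mono d · oneMinusQ e
    mono-difference d e = begin
      mono d ⊕ ⊖ mono (d + e)
        ≈⟨ R.+-cong (R.sym (R.*-identityʳ (mono d))) (R.-‿cong (R.sym (mono-+ d e))) ⟩
      mono d · oneS ⊕ ⊖ (mono d · mono e)
        ≈⟨ solve 3 (λ d o e → d :* o :+ :- (d :* e) := d :* (o :+ :- e)) R.refl (mono d) oneS (mono e) ⟩
      mono d · (oneS ⊕ ⊖ mono e)
        ≈⟨ R.*-congˡ (R.sym (oneMinusQ-mono e)) ⟩
      mono d · oneMinusQ e ∎
      where
      open ≋-Reasoning
      open FPS-Solver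

    factor-lower : ∀ i → i < n → factor i ≋ signedMono -1ℤ (a + i * c) · oneMinusQ (b + (n ∸ suc i) * c)
    factor-lower i i<n = begin
      mono (n * c) ⊕ ⊖ (mono a · mono (i * c))
        ≈⟨ R.+-congˡ {mono (n * c)} (R.-‿cong (mono-+ a (i * c))) ⟩
      mono (n * c) ⊕ ⊖ mono d
        ≡⟨ cong (λ e → mono e ⊕ ⊖ mono d) (sym exponent) ⟩
      mono (d + e) ⊕ ⊖ mono d
        ≈⟨ solve 2 (λ x y → x :+ :- y := :- (y :+ :- x)) R.refl (mono (d + e)) (mono d) ⟩
      ⊖ (mono d ⊕ ⊖ mono (d + e))
        ≈⟨ R.-‿cong (mono-difference d e) ⟩
      ⊖ (mono d · oneMinusQ e)
        ≈⟨ solve 2 (λ x y → :- (x :* y) := con -1ℤ :* x :* y) R.refl (mono d) (oneMinusQ e) ⟩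
      signedMono -1ℤ d · oneMinusQ e ∎
      where
      open ≋-Reasoning
      open FPS-Solver
      d e : ℕ
      d = a + i * c
      e = b + (n ∸ suc i) * c
      exponent : d + e ≡ n * c
      exponent = trans (lem a b i (n ∸ suc i)) (cong (_* c) (ℕₚ.m∸n+n≡m i<n))
        where
        lem : ∀ a b i m → a + i * (a + b) + (b + m * (a + b)) ≡ (m + suc i) * (a + b)
        lem = ℕ-Solver.solve-∀

    factor-upper : ∀ i → factor (n + i) ≋ mono (n * c) · oneMinusQ (a + i * c)
    factor-upper i = R.trans
      (R.+-congˡ {mono (n * c)} (R.-‿cong (R.trans (mono-+ a ((n + i) * c)) (R.reflexive (cong mono (lem a n i c))))))
      (mono-difference (n * c) (a + i * c))
      where
      lem : ∀ a n i c → a + (n + i) * c ≡ n * c + (a + i * c)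
      lem = ℕ-Solver.solve-∀

    ∏-signedMono : ∀ k → ∏ k (λ i → signedMono -1ℤ (a + i * c)) ≋ signedMono (sgn k) (arithSum a c k)
    ∏-signedMono zero    = R.sym (R.trans (R.*-cong (mk const-1) mono-0) (R.*-identityˡ oneS))
    ∏-signedMono (suc k) = R.trans (R.*-congʳ (∏-signedMono k))
      (R.trans (signedMono-· (sgn k) (arithSum a c k) -1ℤ (a + k * c))
        (R.reflexive (cong (λ s → signedMono s (arithSum a c (suc k)))
          (trans (ℤₚ.*-comm (sgn k) -1ℤ) (ℤₚ.-1*i≡-i (sgn k))))))

    ∏-mono : ∀ k → ∏ k (λ _ → mono (n * c)) ≋ mono (k * (n * c))
    ∏-mono zero    = R.sym mono-0
    ∏-mono (suc k) = R.trans (R.*-congʳ (∏-mono k))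
      (R.trans (mono-+ (k * (n * c)) (n * c)) (R.reflexive (cong mono (ℕₚ.+-comm (k * (n * c)) (n * c)))))

    factors : ∏ (n + n) factor ≋ lead · (Pa · Pb)
    factors = begin
      ∏ (n + n) factor
        ≈⟨ ∏-append n n factor ⟩
      ∏ n factor · ∏ n (λ i → factor (n + i))
        ≈⟨ R.*-cong (∏-cong< n factor-lower) (∏-cong n factor-upper) ⟩
      ∏ n (λ i → signedMono -1ℤ (a + i * c) · oneMinusQ (b + (n ∸ suc i) * c)) · ∏ n (λ i → mono (n * c) · oneMinusQ (a + i * c))
        ≈⟨ R.*-cong (∏-· n (λ i → signedMono -1ℤ (a + i * c)) (λ i → oneMinusQ (b + (n ∸ suc i) * c)))
                    (∏-· n (λ _ → mono (n * c)) (λ i → oneMinusQ (a + i * c))) ⟩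
      ∏ n (λ i → signedMono -1ℤ (a + i * c)) · ∏ n (λ i → oneMinusQ (b + (n ∸ suc i) * c)) · (∏ n (λ _ → mono (n * c)) · Pa)
        ≈⟨ R.*-cong (R.*-cong (∏-signedMono n) (R.sym (∏-reverse n (λ i → oneMinusQ (b + i * c))))) (R.*-congʳ (∏-mono n)) ⟩
      const (sgn n) · mono X · Pb · (mono Y · Pa)
        ≈⟨ solve 5 (λ s x pb y pa → s :* x :* pb :* (y :* pa) := s :* (x :* y) :* (pa :* pb)) R.refl
             (const (sgn n)) (mono X) Pb (mono Y) Pa ⟩
      const (sgn n) · (mono X · mono Y) · (Pa · Pb)
        ≈⟨ R.*-congʳ (R.*-congˡ (mono-+ X Y)) ⟩
      lead · (Pa · Pb) ∎
      where
      open ≋-Reasoning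
      open FPS-Solver
      X Y : ℕ
      X = arithSum a c n
      Y = n * (n * c)

    finite-triple-product : Pa · Pb ≋ Qf (n + n) · (ΣS n S⁻ ⊕ ΣS (suc n) S⁺)
    finite-triple-product = signedMono-cancel (sgn n) (arithSum a c n + n * (n * c)) (sgn-sq n) (begin
      lead · (Pa · Pb)
        ≈⟨ R.sym factors ⟩
      ∏ (n + n) factor
        ≈⟨ R.sym (rothe (n + n)) ⟩
      Qf (n + n) · H (n + n)
        ≈⟨ R.*-congˡ H-closed ⟩
      Qf (n + n) · (lead · S)
        ≈⟨ solve 3 (λ q l s → q :* (l :* s) := l :* (q :* s)) R.refl (Qf (n + n)) lead S ⟩
      lead · (Qf (n + n) · S) ∎)
      where
      open ≋-Reasoning
      open FPS-Solver
      S : FPS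
      S = ΣS n S⁻ ⊕ ΣS (suc n) S⁺

    Q∞ : FPS
    Q∞ = qPoch c′ c′

    -- Up to q^n, `Qf (n + n)` equals `Q∞` and `I i` its inverse. `I j` approximates the inverse
    -- only up to order n ∸ k, but the monomial q^e with k ≤ e restores the missing k orders. The
    -- second copy of `Q∞`, needed to cancel both denominators, is the third product of the triple
    -- product.
    term-limit : ∀ s e {i j k} → n ≤ i → n ∸ k ≤ j → k ≤ e →
      (Q∞ · Qf (n + n) · (signedMono s e · (I i · I j))) ≈[ n ] signedMono s e
    term-limit s e {i} {j} {k} n≤i n∸k≤j k≤e =
      ≈-trans (≋⇒≈ (solve 5 (λ q p m i j → q :* p :* (m :* (i :* j)) := p :* (i :* (q :* (m :* j)))) R.refl
                      Q∞ (Qf (n + n)) (signedMono s e) (I i) (I j)))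
      (≈-trans (≈-· Qf-≈ (≈-· (I-≈ n≤i) (λ _ _ → refl)))
      (≈-trans (≋⇒≈ (R.trans (R.sym (R.*-assoc Q∞ I∞ (Q∞ · (signedMono s e · I j))))
                   (R.trans (R.*-congʳ (qPoch-inverse c′ c′)) (R.*-identityˡ (Q∞ · (signedMono s e · I j))))))
      (≈-trans (≋⇒≈ (solve 4 (λ q s m j → q :* ((s :* m) :* j) := q :* (s :* (m :* j))) R.refl Q∞ (const s) (mono e) (I j)))
      (≈-trans (≈-· {f = Q∞} (λ _ _ → refl) (≈-· {f = const s} (λ _ _ → refl)
                  (≈-weaken (ℕₚ.≤-trans (ℕₚ.m≤n+m∸n n k) (ℕₚ.+-monoˡ-≤ (n ∸ k) k≤e)) (≈-mono-· e (I-≈ n∸k≤j)))))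
      (≋⇒≈ (R.trans (solve 4 (λ q s m j → q :* (s :* (m :* j)) := (q :* j) :* (s :* m)) R.refl Q∞ (const s) (mono e) I∞)
             (R.trans (R.*-congʳ (qPoch-inverse c′ c′)) (R.*-identityˡ (signedMono s e)))))))))
      where
      open FPS-Solver
      I∞ : FPS
      I∞ = qPochInv c′ c′
      Qf-≈ : Qf (n + n) ≈[ n ] Q∞
      Qf-≈ = ≈-sym (≈-trans (≋⇒≈ (qPoch-∏∞ c′ c′)) (∏∞-≈ (oneMinusQ-convergent c′ c′) (ℕₚ.m≤m+n n n)))
      I-≈ : ∀ {M N} → N ≤ M → I M ≈[ N ] I∞
      I-≈ N≤M = ≈-sym (≈-trans (≋⇒≈ (qPochInv-∏∞ c′ c′)) (∏∞-≈ (geomQ-convergent c′ c′) N≤M))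

    coefficient : (qPoch a′ c′ · qPoch b′ c′ · qPoch c′ c′) n ≡ gen (expo a b) sg n
    coefficient = begin
      (qPoch a′ c′ · qPoch b′ c′ · Q∞) n
        ≡⟨ ≈-· (≈-· (Pinf a′) (Pinf b′)) (λ _ _ → refl) n ℕₚ.≤-refl ⟩
      (Pa · Pb · Q∞) n
        ≡⟨ at (R.trans (R.*-comm (Pa · Pb) Q∞) (R.trans (R.*-congˡ finite-triple-product)
             (R.trans (R.sym (R.*-assoc Q∞ (Qf (n + n)) (ΣS n S⁻ ⊕ ΣS (suc n) S⁺)))
             (R.trans (R.distribˡ QQ (ΣS n S⁻) (ΣS (suc n) S⁺))
               (R.+-cong (ΣS-·ˡ n QQ S⁻) (ΣS-·ˡ (suc n) QQ S⁺)))))) n ⟩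
      sumBelow n (λ k → (QQ · S⁻ k) n) ℤ.+ sumBelow (suc n) (λ k → (QQ · S⁺ k) n)
        ≡⟨ cong₂ ℤ._+_
             (sum-cong n (λ k → trans
               (at (R.*-congˡ (R.*-congˡ {signedMono (sgn (suc k)) (arithSum b c (suc k))} (R.*-comm (I (n ∸ suc k)) (I (n + suc k))))) n)
               (trans (term-limit (sgn (suc k)) (arithSum b c (suc k)) (ℕₚ.m≤m+n n (suc k)) ℕₚ.≤-refl (arithSum-≥ b′ c (suc k)) n ℕₚ.≤-refl)
                      (signedMono-coeff (sgn (suc k)) (arithSum b c (suc k)) n))))
             (sum-cong (suc n) (λ k → trans
               (term-limit (sgn k) (arithSum a c k) (ℕₚ.m≤m+n n k) ℕₚ.≤-refl (arithSum-≥ a′ c k) n ℕₚ.≤-refl)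
               (signedMono-coeff (sgn k) (arithSum a c k) n))) ⟩
      sumBelow n w⁻ ℤ.+ sumBelow (suc n) w⁺
        -- The finite identity has only n terms with negative index where `gen` has n+1; the
        -- additional one has exponent at least n+1 and does not reach the coefficient of q^n.
        ≡⟨ cong (ℤ._+ sumBelow (suc n) w⁺) (sym (sum-extend (ℕₚ.n≤1+n n)
             (λ k n≤k → if-cong (trans (≡ᵇ-sym (arithSum b c (suc k)) n) (≡ᵇ-< (ℕₚ.<-≤-trans (s≤s n≤k) (arithSum-≥ b′ c (suc k)))))))) ⟩
      sumBelow (suc n) w⁻ ℤ.+ sumBelow (suc n) w⁺
        ≡⟨ ℤₚ.+-comm (sumBelow (suc n) w⁻) (sumBelow (suc n) w⁺) ⟩
      gen (expo a b) sg n ∎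
      where
      open ≡-Reasoning
      QQ : FPS
      QQ = Q∞ · Qf (n + n)
      w⁻ w⁺ : ℕ → ℤ
      w⁻ k = if arithSum b c (suc k) ≡ᵇ n then sgn (suc k) else 0ℤ
      w⁺ k = if arithSum a c k ≡ᵇ n then sgn k else 0ℤ
      Pinf : ∀ d → qPoch d c′ ≈[ n ] ∏ n (λ i → oneMinusQ (suc d + i * c))
      Pinf d = ≈-trans (≋⇒≈ (qPoch-∏∞ d c′)) (∏∞-≈ (oneMinusQ-convergent d c′) ℕₚ.≤-refl)

  triple-product : qPoch a′ c′ · qPoch b′ c′ · qPoch c′ c′ ≋ gen (expo a b) sg
  triple-product = mk λ n → Finite.coefficient n

-- Finitely supported sums over ℤ

ΣZ-cong : ∀ B {f g : ℤ → ℤ} → (∀ k → f k ≡ g k) → ΣZ B f ≡ ΣZ B g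
ΣZ-cong B e = cong₂ ℤ._+_ (sum-cong B (λ k → e (+ k))) (sum-cong B (λ k → e -[1+ k ]))

ΣZ-zero : ∀ B {f : ℤ → ℤ} → (∀ k → f k ≡ 0ℤ) → ΣZ B f ≡ 0ℤ
ΣZ-zero B z = cong₂ ℤ._+_ (sum-zero B (λ k _ → z (+ k))) (sum-zero B (λ k _ → z -[1+ k ]))

ΣZ-+ : ∀ B (f g : ℤ → ℤ) → ΣZ B (λ k → f k ℤ.+ g k) ≡ ΣZ B f ℤ.+ ΣZ B g
ΣZ-+ B f g = trans
  (cong₂ ℤ._+_ (sum-+ B (λ k → f (+ k)) (λ k → g (+ k))) (sum-+ B (λ k → f -[1+ k ]) (λ k → g -[1+ k ])))
  (+-interchange (sumBelow B (λ k → f (+ k))) (sumBelow B (λ k → g (+ k)))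
                 (sumBelow B (λ k → f -[1+ k ])) (sumBelow B (λ k → g -[1+ k ])))

ΣZ-*ˡ : ∀ B c (f : ℤ → ℤ) → ΣZ B (λ k → c ℤ.* f k) ≡ c ℤ.* ΣZ B f
ΣZ-*ˡ B c f = trans
  (cong₂ ℤ._+_ (sum-*ˡ B c (λ k → f (+ k))) (sum-*ˡ B c (λ k → f -[1+ k ])))
  (sym (ℤₚ.*-distribˡ-+ c (sumBelow B (λ k → f (+ k))) (sumBelow B (λ k → f -[1+ k ]))))

sum-ΣZ-swap : ∀ n B (f : ℕ → ℤ → ℤ) →
  sumBelow n (λ i → ΣZ B (f i)) ≡ ΣZ B (λ k → sumBelow n (λ i → f i k))
sum-ΣZ-swap n B f = trans
  (sum-+ n (λ i → sumBelow B (λ k → f i (+ k))) (λ i → sumBelow B (λ k → f i -[1+ k ])))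
  (cong₂ ℤ._+_ (sum-swap n B (λ i k → f i (+ k))) (sum-swap n B (λ i k → f i -[1+ k ])))

ΣZ-swap : ∀ B B′ (f : ℤ → ℤ → ℤ) → ΣZ B (λ k → ΣZ B′ (f k)) ≡ ΣZ B′ (λ l → ΣZ B (λ k → f k l))
ΣZ-swap B B′ f = trans
  (cong₂ ℤ._+_ (sum-ΣZ-swap B B′ (λ i → f (+ i))) (sum-ΣZ-swap B B′ (λ i → f -[1+ i ])))
  (sym (ΣZ-+ B′ (λ l → sumBelow B (λ i → f (+ i) l)) (λ l → sumBelow B (λ i → f -[1+ i ] l))))

Supp : ℕ → (ℤ → ℤ) → Set
Supp B f = ∀ k → B ≤ ∣ k ∣ → f k ≡ 0ℤ

ΣZ-extend : ∀ {B B′ f} → B ≤ B′ → Supp B f → ΣZ B′ f ≡ ΣZ B f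
ΣZ-extend B≤B′ supp = cong₂ ℤ._+_
  (sum-extend B≤B′ (λ k B≤k → supp (+ k) B≤k))
  (sum-extend B≤B′ (λ k B≤k → supp -[1+ k ] (ℕₚ.m≤n⇒m≤1+n B≤k)))

ΣZ-neg : ∀ {B f} → Supp B f → ΣZ B (λ k → f (ℤ.- k)) ≡ ΣZ B f
ΣZ-neg {B} {f} supp = begin
  sumBelow B (λ k → f (ℤ.- (+ k))) ℤ.+ sumBelow B (λ k → f (+ suc k))
    ≡⟨ cong (ℤ._+ sumBelow B (λ k → f (+ suc k))) (sym (sum-extend (ℕₚ.n≤1+n B)
         (λ k B≤k → supp (ℤ.- (+ k)) (subst (B ≤_) (sym (ℤₚ.∣-i∣≡∣i∣ (+ k))) B≤k)))) ⟩
  sumBelow (suc B) (λ k → f (ℤ.- (+ k))) ℤ.+ sumBelow B (λ k → f (+ suc k))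
    ≡⟨ cong (ℤ._+ sumBelow B (λ k → f (+ suc k))) (sum-first B (λ k → f (ℤ.- (+ k)))) ⟩
  (f 0ℤ ℤ.+ sumBelow B (λ k → f -[1+ k ])) ℤ.+ sumBelow B (λ k → f (+ suc k))
    ≡⟨ lem (f 0ℤ) (sumBelow B (λ k → f -[1+ k ])) (sumBelow B (λ k → f (+ suc k))) ⟩
  (f 0ℤ ℤ.+ sumBelow B (λ k → f (+ suc k))) ℤ.+ sumBelow B (λ k → f -[1+ k ])
    ≡⟨ cong (ℤ._+ sumBelow B (λ k → f -[1+ k ])) (sym (sum-first B (λ k → f (+ k)))) ⟩
  sumBelow (suc B) (λ k → f (+ k)) ℤ.+ sumBelow B (λ k → f -[1+ k ])
    ≡⟨ cong (ℤ._+ sumBelow B (λ k → f -[1+ k ])) (sum-extend (ℕₚ.n≤1+n B) (λ k → supp (+ k))) ⟩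
  ΣZ B f ∎
  where
  open ≡-Reasoning
  lem : ∀ x y z → (x ℤ.+ y) ℤ.+ z ≡ (x ℤ.+ z) ℤ.+ y
  lem = ℤ-Solver.solve-∀

ΣZ-suc : ∀ {B f} → Supp B f → ΣZ (suc B) (λ k → f (1ℤ ℤ.+ k)) ≡ ΣZ B f
ΣZ-suc {B} {f} supp = begin
  sumBelow (suc B) (λ k → f (+ suc k)) ℤ.+ sumBelow (suc B) (λ k → f (1ℤ ℤ.+ -[1+ k ]))
    ≡⟨ cong (ℤ._+_ (sumBelow (suc B) (λ k → f (+ suc k)))) (sum-first B (λ k → f (1ℤ ℤ.+ -[1+ k ]))) ⟩
  sumBelow (suc B) (λ k → f (+ suc k)) ℤ.+ (f 0ℤ ℤ.+ sumBelow B (λ k → f -[1+ k ]))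
    ≡⟨ lem (sumBelow (suc B) (λ k → f (+ suc k))) (f 0ℤ) (sumBelow B (λ k → f -[1+ k ])) ⟩
  (f 0ℤ ℤ.+ sumBelow (suc B) (λ k → f (+ suc k))) ℤ.+ sumBelow B (λ k → f -[1+ k ])
    ≡⟨ cong (ℤ._+ sumBelow B (λ k → f -[1+ k ])) (sym (sum-first (suc B) (λ k → f (+ k)))) ⟩
  sumBelow (suc (suc B)) (λ k → f (+ k)) ℤ.+ sumBelow B (λ k → f -[1+ k ])
    ≡⟨ cong (ℤ._+ sumBelow B (λ k → f -[1+ k ])) (sum-extend (ℕₚ.m≤n+m B 2) (λ k → supp (+ k))) ⟩
  ΣZ B f ∎
  where
  open ≡-Reasoning
  lem : ∀ x y z → x ℤ.+ (y ℤ.+ z) ≡ (y ℤ.+ x) ℤ.+ z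
  lem = ℤ-Solver.solve-∀

∣k∣≤∣1+k∣+1 : ∀ k → ∣ k ∣ ≤ suc ∣ 1ℤ ℤ.+ k ∣
∣k∣≤∣1+k∣+1 (+ k)          = ℕₚ.m≤n+m k 2
∣k∣≤∣1+k∣+1 -[1+ zero ]  = s≤s z≤n
∣k∣≤∣1+k∣+1 -[1+ suc k ] = ℕₚ.≤-refl

Supp-suc : ∀ {B f} → Supp B f → Supp (suc B) (λ k → f (1ℤ ℤ.+ k))
Supp-suc supp k B<k = supp (1ℤ ℤ.+ k) (ℕₚ.≤-pred (ℕₚ.≤-trans B<k (∣k∣≤∣1+k∣+1 k)))

Supp-cong : ∀ {B f g} → (∀ k → f k ≡ g k) → Supp B f → Supp B g
Supp-cong e supp k B≤k = trans (sym (e k)) (supp k B≤k)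

-- Each unit shift widens the support bound by one. As the shifted function is itself supported
-- below `B`, the range can be enlarged to `n + B`, shifted there, and cut back.
ΣZ-shift⁺ : ∀ n {B B′ f} → B ≤ B′ → Supp B f → Supp B (λ k → f (k ℤ.+ + n)) →
  ΣZ B′ (λ k → f (k ℤ.+ + n)) ≡ ΣZ B′ f
ΣZ-shift⁺ n {B} {B′} {f} B≤B′ supp supp′ =
  trans (ΣZ-extend B≤B′ supp′)
  (trans (sym (ΣZ-extend (ℕₚ.m≤n+m B n) supp′))
  (trans (go n B f supp) (sym (ΣZ-extend B≤B′ supp))))
  where
  go : ∀ n B f → Supp B f → ΣZ (n + B) (λ k → f (k ℤ.+ + n)) ≡ ΣZ B f
  go zero    B f supp = ΣZ-cong B (λ k → cong f (ℤₚ.+-identityʳ k))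
  go (suc n) B f supp = begin
    ΣZ (suc n + B) (λ k → f (k ℤ.+ + suc n))
      ≡⟨ cong (λ M → ΣZ M (λ k → f (k ℤ.+ + suc n))) (sym (ℕₚ.+-suc n B)) ⟩
    ΣZ (n + suc B) (λ k → f (k ℤ.+ + suc n))
      ≡⟨ ΣZ-cong (n + suc B) (λ k → cong f (lem k (+ n))) ⟩
    ΣZ (n + suc B) (λ k → f (1ℤ ℤ.+ (k ℤ.+ + n)))
      ≡⟨ go n (suc B) (λ k → f (1ℤ ℤ.+ k)) (Supp-suc supp) ⟩
    ΣZ (suc B) (λ k → f (1ℤ ℤ.+ k))
      ≡⟨ ΣZ-suc supp ⟩
    ΣZ B f ∎
    where
    open ≡-Reasoning
    lem : ∀ k n → k ℤ.+ (1ℤ ℤ.+ n) ≡ 1ℤ ℤ.+ (k ℤ.+ n)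
    lem = ℤ-Solver.solve-∀

ΣZ-shift : ∀ c {B f} → Supp B f → Supp B (λ k → f (k ℤ.+ c)) → ΣZ B (λ k → f (k ℤ.+ c)) ≡ ΣZ B f
ΣZ-shift (+ n)    supp supp′ = ΣZ-shift⁺ n ℕₚ.≤-refl supp supp′
ΣZ-shift -[1+ n ] {B} {f} supp supp′ = sym (trans (ΣZ-cong B (λ k → cong f (sym (back k))))
  (ΣZ-shift⁺ (suc n) ℕₚ.≤-refl supp′ (Supp-cong (λ k → cong f (sym (back k))) supp)))
  where
  back : ∀ k → (k ℤ.+ + suc n) ℤ.+ -[1+ n ] ≡ k
  back k = trans (ℤₚ.+-assoc k (+ suc n) -[1+ n ])
    (trans (cong (ℤ._+_ k) (ℤₚ.+-inverseʳ (+ suc n))) (ℤₚ.+-identityʳ k))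

ΣZ-blocks : ∀ p {B f} → Supp B f →
  ΣZ B f ≡ sumBelow (suc p) (λ d → ΣZ B (λ v → f (v ℤ.* + suc p ℤ.+ + d)))
ΣZ-blocks p′ {B} {f} supp = begin
  ΣZ B f
    ≡⟨ sym (ΣZ-extend (ℕₚ.m≤m*n B p) supp) ⟩
  sumBelow (B * p) (λ k → f (+ k)) ℤ.+ sumBelow (B * p) (λ k → f -[1+ k ])
    ≡⟨ cong₂ ℤ._+_ (sum-blocks p B (λ k → f (+ k))) (sum-blocks p B (λ k → f -[1+ k ])) ⟩
  sumBelow p (λ d → sumBelow B (λ i → f (+ (i * p + d)))) ℤ.+ sumBelow p (λ d → sumBelow B (λ i → f -[1+ (i * p + d) ]))
    ≡⟨ cong₂ ℤ._+_
        (sum-cong p (λ d → sum-cong B (λ i → cong f (positive i d))))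
        -- Since -(1 + ip + e) has residue p - 1 - e modulo p, the negative half meets the residues
        -- in reverse order.
        (trans (sum-reverse p (λ d → sumBelow B (λ i → f -[1+ (i * p + d) ])))
          (sum-cong< p (λ d d<p → sum-cong B (λ i → cong f (negative i d (p′ ∸ d) (ℕₚ.m+[n∸m]≡n (ℕₚ.≤-pred d<p))))))) ⟩
  sumBelow p (λ d → sumBelow B (λ i → f (+ i ℤ.* + p ℤ.+ + d))) ℤ.+ sumBelow p (λ d → sumBelow B (λ i → f (-[1+ i ] ℤ.* + p ℤ.+ + d)))
    ≡⟨ sym (sum-+ p (λ d → sumBelow B (λ i → f (+ i ℤ.* + p ℤ.+ + d))) (λ d → sumBelow B (λ i → f (-[1+ i ] ℤ.* + p ℤ.+ + d)))) ⟩
  sumBelow p (λ d → ΣZ B (λ v → f (v ℤ.* + p ℤ.+ + d))) ∎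
  where
  open ≡-Reasoning
  p : ℕ
  p = suc p′
  positive : ∀ i d → + (i * p + d) ≡ + i ℤ.* + p ℤ.+ + d
  positive i d = trans (ℤₚ.pos-+ (i * p) d) (cong (ℤ._+ + d) (ℤₚ.pos-* i p))
  negative : ∀ i d e → d + e ≡ p′ → -[1+ (i * p + e) ] ≡ -[1+ i ] ℤ.* + p ℤ.+ + d
  negative i d e refl = begin
    ℤ.- (+ suc (i * p + e))
      ≡⟨ cong ℤ.-_ (cong₂ ℤ._+_ {1ℤ} refl (positive i e)) ⟩
    ℤ.- (1ℤ ℤ.+ (+ i ℤ.* + suc (d + e) ℤ.+ + e))
      ≡⟨ lem (+ i) (+ d) (+ e) ⟩
    ℤ.- (1ℤ ℤ.+ + i) ℤ.* + suc (d + e) ℤ.+ + d ∎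
    where
    lem : ∀ i d e → ℤ.- (1ℤ ℤ.+ (i ℤ.* (1ℤ ℤ.+ (d ℤ.+ e)) ℤ.+ e)) ≡ ℤ.- (1ℤ ℤ.+ i) ℤ.* (1ℤ ℤ.+ (d ℤ.+ e)) ℤ.+ d
    lem = ℤ-Solver.solve-∀

sg-suc : ∀ k → sg (1ℤ ℤ.+ k) ≡ ℤ.- sg k
sg-suc (+ k)          = refl
sg-suc -[1+ zero ]  = refl
sg-suc -[1+ suc k ] = sym (ℤₚ.neg-involutive (sgn (suc k)))

sg-+⁺ : ∀ n k → sg (+ n ℤ.+ k) ≡ sgn n ℤ.* sg k
sg-+⁺ zero    k = trans (cong sg (ℤₚ.+-identityˡ k)) (sym (ℤₚ.*-identityˡ (sg k)))
sg-+⁺ (suc n) k = trans (cong sg (ℤₚ.+-assoc 1ℤ (+ n) k)) (trans (sg-suc (+ n ℤ.+ k))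
  (trans (cong ℤ.-_ (sg-+⁺ n k)) (ℤₚ.neg-distribˡ-* (sgn n) (sg k))))

sg-+ : ∀ i j → sg (i ℤ.+ j) ≡ sg i ℤ.* sg j
sg-+ (+ n)    j = sg-+⁺ n j
sg-+ -[1+ n ] j = begin
  sg k                                 ≡⟨ sym (ℤₚ.*-identityˡ (sg k)) ⟩
  1ℤ ℤ.* sg k                          ≡⟨ cong (ℤ._* sg k) (sym (sgn-sq (suc n))) ⟩
  s ℤ.* s ℤ.* sg k                     ≡⟨ ℤₚ.*-assoc s s (sg k) ⟩
  s ℤ.* (s ℤ.* sg k)                   ≡⟨ cong (ℤ._*_ s) (sym (sg-+⁺ (suc n) k)) ⟩
  s ℤ.* sg (+ suc n ℤ.+ k)             ≡⟨ cong (λ z → s ℤ.* sg z) back ⟩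
  s ℤ.* sg j                           ∎
  where
  open ≡-Reasoning
  s k : ℤ
  s = sgn (suc n)
  k = -[1+ n ] ℤ.+ j
  back : + suc n ℤ.+ k ≡ j
  back = trans (sym (ℤₚ.+-assoc (+ suc n) -[1+ n ] j))
    (trans (cong (ℤ._+ j) (ℤₚ.+-inverseʳ (+ suc n))) (ℤₚ.+-identityˡ j))

sg-neg : ∀ k → sg (ℤ.- k) ≡ sg k
sg-neg k = cong sgn (ℤₚ.∣-i∣≡∣i∣ k)

sg-double : ∀ k → sg (k ℤ.+ k) ≡ 1ℤ
sg-double k = trans (sg-+ k k) (sgn-sq ∣ k ∣)

ΣZS : ℕ → (ℤ → FPS) → FPS
ΣZS B F N = ΣZ B (λ k → F k N)

ΣZS-·ˡ : ∀ B f F → f · ΣZS B F ≋ ΣZS B (λ k → f · F k)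
ΣZS-·ˡ B f F = R.trans (R.distribˡ f (ΣS B (λ k → F (+ k))) (ΣS B (λ k → F -[1+ k ])))
  (R.+-cong (ΣS-·ˡ B f (λ k → F (+ k))) (ΣS-·ˡ B f (λ k → F -[1+ k ])))

ΣZS-· : ∀ B F G → ΣZS B F · ΣZS B G ≋ ΣZS B (λ k → ΣZS B (λ l → F k · G l))
ΣZS-· B F G = R.trans (R.*-comm (ΣZS B F) (ΣZS B G)) (R.trans (ΣZS-·ˡ B (ΣZS B G) F)
  (mk λ N → ΣZ-cong B (λ k → trans (at (R.*-comm (ΣZS B G) (F k)) N) (at (ΣZS-·ˡ B (F k) G) N))))

-- Because |k| ≤ E(k), indices beyond N cannot reach a coefficient up to q^N. One fixed range B > N
-- thus serves all these coefficients, whereas `gen` truncates each one separately; products need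
-- the fixed range.
gen-≈ : ∀ E w → (∀ k → ∣ k ∣ ≤ E k) → ∀ {N B} → N < B →
  gen E w ≈[ N ] ΣZS B (λ k → signedMono (w k) (E k))
gen-≈ E w E≥ {N} {B} N<B n n≤N = trans
  (sym (ΣZ-extend (ℕₚ.≤-<-trans n≤N N<B) (λ k n<k →
    if-cong {x = w k} (trans (≡ᵇ-sym (E k) n) (≡ᵇ-< (ℕₚ.≤-trans n<k (E≥ k)))))))
  (ΣZ-cong B (λ k → sym (signedMono-coeff (w k) (E k) n)))

gen-· : ∀ E w E′ w′ → (∀ k → ∣ k ∣ ≤ E k) → (∀ k → ∣ k ∣ ≤ E′ k) → ∀ N B → N < B →
  (gen E w · gen E′ w′) N ≡ ΣZ B (λ k → ΣZ B (λ l → if E k + E′ l ≡ᵇ N then w k ℤ.* w′ l else 0ℤ))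
gen-· E w E′ w′ E≥ E′≥ N B N<B = trans
  (≈-· (gen-≈ E w E≥ N<B) (gen-≈ E′ w′ E′≥ N<B) N ℕₚ.≤-refl)
  (trans (at (ΣZS-· B (λ k → signedMono (w k) (E k)) (λ l → signedMono (w′ l) (E′ l))) N)
    (ΣZ-cong B (λ k → ΣZ-cong B (λ l → trans
      (at (signedMono-· (w k) (E k) (w′ l) (E′ l)) N)
      (signedMono-coeff (w k ℤ.* w′ l) (E k + E′ l) N)))))

expo-≥ : ∀ a b k → ∣ k ∣ ≤ expo (suc a) (suc b) k
expo-≥ a b (+ k)    = arithSum-≥ a (suc a + suc b) k
expo-≥ a b -[1+ k ] = arithSum-≥ b (suc a + suc b) (suc k)

arithSum-closed : ∀ p c k → 2 * arithSum p c k + k * c ≡ 2 * (k * p) + k * k * c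
arithSum-closed p c zero    = refl
arithSum-closed p c (suc k) = trans (lem₁ (arithSum p c k) p c k)
  (trans (cong (λ z → z + (2 * p + 2 * (k * c) + c)) (arithSum-closed p c k)) (lem₂ p c k))
  where
  lem₁ : ∀ X p c k → 2 * (X + (p + k * c)) + suc k * c ≡ (2 * X + k * c) + (2 * p + 2 * (k * c) + c)
  lem₁ = ℕ-Solver.solve-∀
  lem₂ : ∀ p c k → 2 * (k * p) + k * k * c + (2 * p + 2 * (k * c) + c) ≡ 2 * (suc k * p) + suc k * suc k * c
  lem₂ = ℕ-Solver.solve-∀

arithSum-closedℤ : ∀ p c k →
  + 2 ℤ.* + arithSum p c k ≡ + c ℤ.* (+ k ℤ.* + k) ℤ.+ (+ 2 ℤ.* + p ℤ.- + c) ℤ.* + k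
arithSum-closedℤ p c k = begin
  + 2 ℤ.* + X
    ≡⟨ lem₁ (+ X) (+ k ℤ.* + c) ⟩
  (+ 2 ℤ.* + X ℤ.+ + k ℤ.* + c) ℤ.- + k ℤ.* + c
    ≡⟨ cong (ℤ._- + k ℤ.* + c) (trans (sym cast-lhs) (trans (cong +_ (arithSum-closed p c k)) cast-rhs)) ⟩
  (+ 2 ℤ.* (+ k ℤ.* + p) ℤ.+ + k ℤ.* + k ℤ.* + c) ℤ.- + k ℤ.* + c
    ≡⟨ lem₂ (+ p) (+ c) (+ k) ⟩
  + c ℤ.* (+ k ℤ.* + k) ℤ.+ (+ 2 ℤ.* + p ℤ.- + c) ℤ.* + k ∎
  where
  open ≡-Reasoning
  X : ℕ
  X = arithSum p c k
  lem₁ : ∀ x y → + 2 ℤ.* x ≡ (+ 2 ℤ.* x ℤ.+ y) ℤ.- y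
  lem₁ = ℤ-Solver.solve-∀
  lem₂ : ∀ p c k → (+ 2 ℤ.* (k ℤ.* p) ℤ.+ k ℤ.* k ℤ.* c) ℤ.- k ℤ.* c ≡ c ℤ.* (k ℤ.* k) ℤ.+ (+ 2 ℤ.* p ℤ.- c) ℤ.* k
  lem₂ = ℤ-Solver.solve-∀
  cast-lhs : + (2 * X + k * c) ≡ + 2 ℤ.* + X ℤ.+ + k ℤ.* + c
  cast-lhs = trans (ℤₚ.pos-+ (2 * X) (k * c)) (cong₂ ℤ._+_ (ℤₚ.pos-* 2 X) (ℤₚ.pos-* k c))
  cast-rhs : + (2 * (k * p) + k * k * c) ≡ + 2 ℤ.* (+ k ℤ.* + p) ℤ.+ + k ℤ.* + k ℤ.* + c
  cast-rhs = trans (ℤₚ.pos-+ (2 * (k * p)) (k * k * c)) (cong₂ ℤ._+_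
    (trans (ℤₚ.pos-* 2 (k * p)) (cong (ℤ._*_ (+ 2)) (ℤₚ.pos-* k p)))
    (trans (ℤₚ.pos-* (k * k) c) (cong (ℤ._* + c) (ℤₚ.pos-* k k))))

expo-closed : ∀ a b k → + 2 ℤ.* + expo a b k ≡ + (a + b) ℤ.* (k ℤ.* k) ℤ.+ (+ a ℤ.- + b) ℤ.* k
expo-closed a b (+ k) = trans (arithSum-closedℤ a (a + b) k)
  (trans (cong (λ c → c ℤ.* (+ k ℤ.* + k) ℤ.+ (+ 2 ℤ.* + a ℤ.- c) ℤ.* + k) (ℤₚ.pos-+ a b))
  (trans (lem (+ a) (+ b) (+ k)) (cong (λ c → c ℤ.* (+ k ℤ.* + k) ℤ.+ (+ a ℤ.- + b) ℤ.* + k) (sym (ℤₚ.pos-+ a b)))))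
  where
  lem : ∀ a b k → (a ℤ.+ b) ℤ.* (k ℤ.* k) ℤ.+ (+ 2 ℤ.* a ℤ.- (a ℤ.+ b)) ℤ.* k ≡ (a ℤ.+ b) ℤ.* (k ℤ.* k) ℤ.+ (a ℤ.- b) ℤ.* k
  lem = ℤ-Solver.solve-∀
expo-closed a b -[1+ k ] = trans (arithSum-closedℤ b (a + b) (suc k))
  (trans (cong (λ c → c ℤ.* (κ ℤ.* κ) ℤ.+ (+ 2 ℤ.* + b ℤ.- c) ℤ.* κ) (ℤₚ.pos-+ a b))
  (trans (lem (+ a) (+ b) κ) (cong (λ c → c ℤ.* (ℤ.- κ ℤ.* ℤ.- κ) ℤ.+ (+ a ℤ.- + b) ℤ.* ℤ.- κ) (sym (ℤₚ.pos-+ a b)))))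
  where
  κ : ℤ
  κ = + suc k
  lem : ∀ a b k → (a ℤ.+ b) ℤ.* (k ℤ.* k) ℤ.+ (+ 2 ℤ.* b ℤ.- (a ℤ.+ b)) ℤ.* k ≡ (a ℤ.+ b) ℤ.* (ℤ.- k ℤ.* ℤ.- k) ℤ.+ (a ℤ.- b) ℤ.* ℤ.- k
  lem = ℤ-Solver.solve-∀

-- Theta series of the form 35K² + R²

form : ℤ → ℤ → ℤ
form K R = + 35 ℤ.* (K ℤ.* K) ℤ.+ R ℤ.* R

form-neg₁ : ∀ K R → form (ℤ.- K) R ≡ form K R
form-neg₁ = lem
  where
  lem : ∀ K R → + 35 ℤ.* (ℤ.- K ℤ.* ℤ.- K) ℤ.+ R ℤ.* R ≡ + 35 ℤ.* (K ℤ.* K) ℤ.+ R ℤ.* R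
  lem = ℤ-Solver.solve-∀

form-neg₂ : ∀ K R → form K (ℤ.- R) ≡ form K R
form-neg₂ = lem
  where
  lem : ∀ K R → + 35 ℤ.* (K ℤ.* K) ℤ.+ ℤ.- R ℤ.* ℤ.- R ≡ + 35 ℤ.* (K ℤ.* K) ℤ.+ R ℤ.* R
  lem = ℤ-Solver.solve-∀

∣xi+yj∣≤ : ∀ x y {i j c} → ∣ i ∣ ≤ c → ∣ j ∣ ≤ c → ∣ x ℤ.* i ℤ.+ y ℤ.* j ∣ ≤ (∣ x ∣ + ∣ y ∣) * c
∣xi+yj∣≤ x y {i} {j} {c} i≤c j≤c = begin
  ∣ x ℤ.* i ℤ.+ y ℤ.* j ∣             ≤⟨ ℤₚ.∣i+j∣≤∣i∣+∣j∣ (x ℤ.* i) (y ℤ.* j) ⟩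
  ∣ x ℤ.* i ∣ + ∣ y ℤ.* j ∣           ≡⟨ cong₂ _+_ (ℤₚ.∣i*j∣≡∣i∣*∣j∣ x i) (ℤₚ.∣i*j∣≡∣i∣*∣j∣ y j) ⟩
  ∣ x ∣ * ∣ i ∣ + ∣ y ∣ * ∣ j ∣       ≤⟨ ℕₚ.+-mono-≤ (ℕₚ.*-monoʳ-≤ ∣ x ∣ i≤c) (ℕₚ.*-monoʳ-≤ ∣ y ∣ j≤c) ⟩
  ∣ x ∣ * c + ∣ y ∣ * c               ≡⟨ sym (ℕₚ.*-distribʳ-+ c ∣ x ∣ ∣ y ∣) ⟩
  (∣ x ∣ + ∣ y ∣) * c                 ∎
  where open ℕₚ.≤-Reasoning

-- Twice the indicator function of the even (ε = 1) or odd (ε = -1) integers.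
parityWeight : ℤ → ℤ → ℤ
parityWeight ε k = 1ℤ ℤ.+ ε ℤ.* sg k

parityWeight-12 : ∀ ε v d → parityWeight ε (v ℤ.* + 12 ℤ.+ d) ≡ parityWeight ε d
parityWeight-12 ε v d = cong (λ s → 1ℤ ℤ.+ ε ℤ.* s)
  (trans (sg-+ (v ℤ.* + 12) d) (trans (cong (ℤ._* sg d) even) (ℤₚ.*-identityˡ (sg d))))
  where
  even : sg (v ℤ.* + 12) ≡ 1ℤ
  even = trans (cong sg (lem v)) (sg-double (v ℤ.* + 6))
    where
    lem : ∀ v → v ℤ.* + 12 ≡ v ℤ.* + 6 ℤ.+ v ℤ.* + 6
    lem = ℤ-Solver.solve-∀

-- `Φ` selects the coefficient under study; it will be the indicator of a single value of the form.
-- By `vanish` only points with |K|, |R| ≤ C count, which makes finite sums suffice.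
module Lattice (Φ : ℤ → ℤ) (C : ℕ)
  (vanish : ∀ K R → (∣ K ∣ ≤ C → ∣ R ∣ ≤ C → ⊥) → Φ (form K R) ≡ 0ℤ) where

  B : ℕ
  B = C + 1000

  -- The common source of all support conditions: an index t is recovered from K and R by a linear
  -- relation (p+1)t = xK + yR + z, so |K|, |R| ≤ C forces |t| < C + 1000. The slack 1000 exceeds
  -- all constant terms z that occur.
  form-supp : ∀ p x y z t K R → + suc p ℤ.* t ≡ x ℤ.* K ℤ.+ y ℤ.* R ℤ.+ z →
    ∣ x ∣ + ∣ y ∣ ≤ suc p → ∣ z ∣ < 1000 → B ≤ ∣ t ∣ → Φ (form K R) ≡ 0ℤ
  form-supp p x y z t K R eq xy≤p z<O B≤t = vanish K R λ K≤C R≤C → ℕₚ.<-irrefl refl (begin-strict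
    suc p * B                             ≤⟨ ℕₚ.*-monoʳ-≤ (suc p) B≤t ⟩
    suc p * ∣ t ∣                         ≡⟨ sym (ℤₚ.∣i*j∣≡∣i∣*∣j∣ (+ suc p) t) ⟩
    ∣ + suc p ℤ.* t ∣                     ≡⟨ cong ∣_∣ eq ⟩
    ∣ x ℤ.* K ℤ.+ y ℤ.* R ℤ.+ z ∣         ≤⟨ ℤₚ.∣i+j∣≤∣i∣+∣j∣ (x ℤ.* K ℤ.+ y ℤ.* R) z ⟩
    ∣ x ℤ.* K ℤ.+ y ℤ.* R ∣ + ∣ z ∣       ≤⟨ ℕₚ.+-monoˡ-≤ ∣ z ∣ (∣xi+yj∣≤ x y K≤C R≤C) ⟩
    (∣ x ∣ + ∣ y ∣) * C + ∣ z ∣           ≤⟨ ℕₚ.+-monoˡ-≤ ∣ z ∣ (ℕₚ.*-monoˡ-≤ C xy≤p) ⟩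
    suc p * C + ∣ z ∣                     <⟨ ℕₚ.+-monoʳ-< (suc p * C) z<O ⟩
    suc p * C + 1000                      ≤⟨ ℕₚ.+-monoʳ-≤ (suc p * C) (ℕₚ.m≤n*m 1000 (suc p)) ⟩
    suc p * C + suc p * 1000              ≡⟨ sym (ℕₚ.*-distribˡ-+ (suc p) C 1000) ⟩
    suc p * B                             ∎)
    where open ℕₚ.≤-Reasoning

  -- The coefficient of θ(j, r) selected by `Φ`.
  P : ℤ → ℤ → ℤ
  P j r = ΣZ B (λ v → ΣZ B (λ u → Φ (form (u ℤ.* + 12 ℤ.+ j) (v ℤ.* + 420 ℤ.+ r))))

  P-supp₁ : ∀ j R → ∣ j ∣ < 1000 → Supp B (λ u → Φ (form (u ℤ.* + 12 ℤ.+ j) R))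
  P-supp₁ j R j<O u = form-supp 11 1ℤ 0ℤ (ℤ.- j) u (u ℤ.* + 12 ℤ.+ j) R (lem u j R) (s≤s z≤n)
    (subst (_< 1000) (sym (ℤₚ.∣-i∣≡∣i∣ j)) j<O)
    where
    lem : ∀ u j R → + 12 ℤ.* u ≡ 1ℤ ℤ.* (u ℤ.* + 12 ℤ.+ j) ℤ.+ 0ℤ ℤ.* R ℤ.+ ℤ.- j
    lem = ℤ-Solver.solve-∀

  P-supp₂ : ∀ r (K : ℤ → ℤ) → ∣ r ∣ < 1000 → Supp B (λ v → ΣZ B (λ u → Φ (form (K u) (v ℤ.* + 420 ℤ.+ r))))
  P-supp₂ r K r<O v B≤v = ΣZ-zero B (λ u → form-supp 419 0ℤ 1ℤ (ℤ.- r) v (K u) (v ℤ.* + 420 ℤ.+ r) (lem v r (K u)) (s≤s z≤n)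
    (subst (_< 1000) (sym (ℤₚ.∣-i∣≡∣i∣ r)) r<O) B≤v)
    where
    lem : ∀ v r K → + 420 ℤ.* v ≡ 0ℤ ℤ.* K ℤ.+ 1ℤ ℤ.* (v ℤ.* + 420 ℤ.+ r) ℤ.+ ℤ.- r
    lem = ℤ-Solver.solve-∀

  -- The size conditions are implicit decisions, settled by evaluation when the classes are
  -- numerals.
  P-shift₁ : ∀ a j r → {True (∣ j ∣ <? 1000)} → {True (∣ a ℤ.* + 12 ℤ.+ j ∣ <? 1000)} →
    P (a ℤ.* + 12 ℤ.+ j) r ≡ P j r
  P-shift₁ a j r {j<} {j′<} = ΣZ-cong B λ v →
    trans (ΣZ-cong B (λ u → cong (λ K → Φ (form K (v ℤ.* + 420 ℤ.+ r))) (lem u a j)))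
      (ΣZ-shift a (P-supp₁ j (v ℤ.* + 420 ℤ.+ r) (toWitness j<))
        (Supp-cong (λ u → cong (λ K → Φ (form K (v ℤ.* + 420 ℤ.+ r))) (lem u a j))
          (P-supp₁ (a ℤ.* + 12 ℤ.+ j) (v ℤ.* + 420 ℤ.+ r) (toWitness j′<))))
    where
    lem : ∀ u a j → u ℤ.* + 12 ℤ.+ (a ℤ.* + 12 ℤ.+ j) ≡ (u ℤ.+ a) ℤ.* + 12 ℤ.+ j
    lem = ℤ-Solver.solve-∀

  P-shift₂ : ∀ b j r → {True (∣ r ∣ <? 1000)} → {True (∣ b ℤ.* + 420 ℤ.+ r ∣ <? 1000)} →
    P j (b ℤ.* + 420 ℤ.+ r) ≡ P j r
  P-shift₂ b j r {r<} {r′<} =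
    trans (ΣZ-cong B move) (ΣZ-shift b (P-supp₂ r K (toWitness r<))
      (Supp-cong move (P-supp₂ (b ℤ.* + 420 ℤ.+ r) K (toWitness r′<))))
    where
    K : ℤ → ℤ
    K u = u ℤ.* + 12 ℤ.+ j
    lem : ∀ v b r → v ℤ.* + 420 ℤ.+ (b ℤ.* + 420 ℤ.+ r) ≡ (v ℤ.+ b) ℤ.* + 420 ℤ.+ r
    lem = ℤ-Solver.solve-∀
    move : ∀ v → ΣZ B (λ u → Φ (form (K u) (v ℤ.* + 420 ℤ.+ (b ℤ.* + 420 ℤ.+ r))))
               ≡ ΣZ B (λ u → Φ (form (K u) ((v ℤ.+ b) ℤ.* + 420 ℤ.+ r)))
    move v = ΣZ-cong B (λ u → cong (λ R → Φ (form (K u) R)) (lem v b r))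

  P-neg₁ : ∀ j r → {True (∣ j ∣ <? 1000)} → P (ℤ.- j) r ≡ P j r
  P-neg₁ j r {j<} = ΣZ-cong B λ v →
    trans (ΣZ-cong B (λ u → cong Φ (trans (cong (λ K → form K (v ℤ.* + 420 ℤ.+ r)) (lem u j)) (form-neg₁ (ℤ.- u ℤ.* + 12 ℤ.+ j) (v ℤ.* + 420 ℤ.+ r)))))
      (ΣZ-neg (P-supp₁ j (v ℤ.* + 420 ℤ.+ r) (toWitness j<)))
    where
    lem : ∀ u j → u ℤ.* + 12 ℤ.+ ℤ.- j ≡ ℤ.- (ℤ.- u ℤ.* + 12 ℤ.+ j)
    lem = ℤ-Solver.solve-∀

  P-neg₂ : ∀ j r → {True (∣ r ∣ <? 1000)} → P j (ℤ.- r) ≡ P j r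
  P-neg₂ j r {r<} =
    trans (ΣZ-cong B (λ v → ΣZ-cong B (λ u → cong Φ (trans (cong (form (K u)) (lem v r)) (form-neg₂ (K u) (ℤ.- v ℤ.* + 420 ℤ.+ r))))))
      (ΣZ-neg (P-supp₂ r K (toWitness r<)))
    where
    K : ℤ → ℤ
    K u = u ℤ.* + 12 ℤ.+ j
    lem : ∀ v r → v ℤ.* + 420 ℤ.+ ℤ.- r ≡ ℤ.- (ℤ.- v ℤ.* + 420 ℤ.+ r)
    lem = ℤ-Solver.solve-∀

  P-flip₁ : ∀ a j r → {True (∣ j ∣ <? 1000)} → {True (∣ ℤ.- j ∣ <? 1000)} → {True (∣ a ℤ.* + 12 ℤ.+ ℤ.- j ∣ <? 1000)} →
    P (a ℤ.* + 12 ℤ.+ ℤ.- j) r ≡ P j r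
  P-flip₁ a j r {p} {q} {s} = trans (P-shift₁ a (ℤ.- j) r {q} {s}) (P-neg₁ j r {p})

  P-flip₂ : ∀ b j r → {True (∣ r ∣ <? 1000)} → {True (∣ ℤ.- r ∣ <? 1000)} → {True (∣ b ℤ.* + 420 ℤ.+ ℤ.- r ∣ <? 1000)} →
    P j (b ℤ.* + 420 ℤ.+ ℤ.- r) ≡ P j r
  P-flip₂ b j r {p} {q} {s} = trans (P-shift₂ b j (ℤ.- r) {q} {s}) (P-neg₂ j r {p})

  -- For X = 14m + α and Y = 10n + β these are (X+Y)/2 and (5X-7Y)/2, with κ = (α+β)/2 and ρ =
  -- (5α-7β)/2.
  linK linR : ℤ → ℤ → ℤ → ℤ
  linK κ m n = + 7 ℤ.* m ℤ.+ + 5 ℤ.* n ℤ.+ κ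
  linR ρ m n = + 35 ℤ.* (m ℤ.- n) ℤ.+ ρ

  classK classR : ℤ → ℕ → ℤ
  classK κ d = + 7 ℤ.* + d ℤ.+ κ
  classR ρ d = + 35 ℤ.* + d ℤ.+ ρ

  W : ℤ → ℤ → ℤ → ℤ
  W ε κ ρ = ΣZ B (λ m → ΣZ B (λ n → parityWeight ε (m ℤ.- n) ℤ.* Φ (form (linK κ m n) (linR ρ m n))))

  *-zero : ∀ w {x} → x ≡ 0ℤ → w ℤ.* x ≡ 0ℤ
  *-zero w refl = ℤₚ.*-zeroʳ w

  small : ∀ x y κ ρ → {True ((∣ x ∣ + ∣ y ∣) * 100 <? 1000)} → ∣ κ ∣ ≤ 100 → ∣ ρ ∣ ≤ 100 →
    ∣ x ℤ.* κ ℤ.+ y ℤ.* ρ ∣ < 1000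
  small x y κ ρ {xy} κ≤ ρ≤ = ℕₚ.≤-<-trans (∣xi+yj∣≤ x y κ≤ ρ≤) (toWitness xy)

  module _ (κ ρ : ℤ) (κ≤ : ∣ κ ∣ ≤ 100) (ρ≤ : ∣ ρ ∣ ≤ 100) where

    -- The coefficients come from eliminating one index: 7K + R = 84m + 7κ + ρ bounds m, and
    -- likewise 5K - R = 60n + 5κ - ρ bounds n in `W-supp₂`.
    W-supp₁ : ∀ n → Supp B (λ m → Φ (form (linK κ m n) (linR ρ m n)))
    W-supp₁ n m = form-supp 83 (+ 7) 1ℤ (-[1+ 6 ] ℤ.* κ ℤ.+ -1ℤ ℤ.* ρ) m (linK κ m n) (linR ρ m n) (lem m n κ ρ)
      (ℕₚ.m≤m+n 8 76) (small -[1+ 6 ] -1ℤ κ ρ κ≤ ρ≤)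
      where
      lem : ∀ m n κ ρ → + 84 ℤ.* m ≡ + 7 ℤ.* (+ 7 ℤ.* m ℤ.+ + 5 ℤ.* n ℤ.+ κ) ℤ.+ 1ℤ ℤ.* (+ 35 ℤ.* (m ℤ.- n) ℤ.+ ρ) ℤ.+ (-[1+ 6 ] ℤ.* κ ℤ.+ -1ℤ ℤ.* ρ)
      lem = ℤ-Solver.solve-∀

    W-supp₂ : ∀ m → Supp B (λ n → Φ (form (linK κ m n) (linR ρ m n)))
    W-supp₂ m n = form-supp 59 (+ 5) -1ℤ (-[1+ 4 ] ℤ.* κ ℤ.+ 1ℤ ℤ.* ρ) n (linK κ m n) (linR ρ m n) (lem m n κ ρ)
      (ℕₚ.m≤m+n 6 54) (small -[1+ 4 ] 1ℤ κ ρ κ≤ ρ≤)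
      where
      lem : ∀ m n κ ρ → + 60 ℤ.* n ≡ + 5 ℤ.* (+ 7 ℤ.* m ℤ.+ + 5 ℤ.* n ℤ.+ κ) ℤ.+ -1ℤ ℤ.* (+ 35 ℤ.* (m ℤ.- n) ℤ.+ ρ) ℤ.+ (-[1+ 4 ] ℤ.* κ ℤ.+ 1ℤ ℤ.* ρ)
      lem = ℤ-Solver.solve-∀

    diag-supp₁ : ∀ n → Supp B (λ D → Φ (form (linK κ (D ℤ.+ n) n) (linR ρ (D ℤ.+ n) n)))
    diag-supp₁ n D = form-supp 34 0ℤ 1ℤ (0ℤ ℤ.* κ ℤ.+ -1ℤ ℤ.* ρ) D (linK κ (D ℤ.+ n) n) (linR ρ (D ℤ.+ n) n) (lem D n κ ρ (linK κ (D ℤ.+ n) n))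
      (s≤s z≤n) (small 0ℤ -1ℤ κ ρ κ≤ ρ≤)
      where
      lem : ∀ D n κ ρ K → + 35 ℤ.* D ≡ 0ℤ ℤ.* K ℤ.+ 1ℤ ℤ.* (+ 35 ℤ.* ((D ℤ.+ n) ℤ.- n) ℤ.+ ρ) ℤ.+ (0ℤ ℤ.* κ ℤ.+ -1ℤ ℤ.* ρ)
      lem = ℤ-Solver.solve-∀

    diag-supp₂ : ∀ D → Supp B (λ n → Φ (form (linK κ (D ℤ.+ n) n) (linR ρ (D ℤ.+ n) n)))
    diag-supp₂ D n = form-supp 59 (+ 5) -1ℤ (-[1+ 4 ] ℤ.* κ ℤ.+ 1ℤ ℤ.* ρ) n (linK κ (D ℤ.+ n) n) (linR ρ (D ℤ.+ n) n) (lem D n κ ρ)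
      (ℕₚ.m≤m+n 6 54) (small -[1+ 4 ] 1ℤ κ ρ κ≤ ρ≤)
      where
      lem : ∀ D n κ ρ → + 60 ℤ.* n ≡ + 5 ℤ.* (+ 7 ℤ.* (D ℤ.+ n) ℤ.+ + 5 ℤ.* n ℤ.+ κ) ℤ.+ -1ℤ ℤ.* (+ 35 ℤ.* ((D ℤ.+ n) ℤ.- n) ℤ.+ ρ) ℤ.+ (-[1+ 4 ] ℤ.* κ ℤ.+ 1ℤ ℤ.* ρ)
      lem = ℤ-Solver.solve-∀

    -- With m - n = 12v + d and n = u - 7v, the form becomes diagonal in u and v.
    lattice-sum : ∀ ε → W ε κ ρ ≡ sumBelow 12 (λ d → parityWeight ε (+ d) ℤ.* P (classK κ d) (classR ρ d))
    lattice-sum ε = begin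
      ΣZ B (λ m → ΣZ B (λ n → F m n))
        ≡⟨ ΣZ-swap B B F ⟩
      ΣZ B (λ n → ΣZ B (λ m → F m n))
        ≡⟨ ΣZ-cong B (λ n → sym (ΣZ-shift n
             (λ m B≤m → *-zero (parityWeight ε (m ℤ.- n)) (W-supp₁ n m B≤m))
             (λ D B≤D → *-zero (parityWeight ε ((D ℤ.+ n) ℤ.- n)) (diag-supp₁ n D B≤D)))) ⟩
      ΣZ B (λ n → ΣZ B (λ D → G D n))
        ≡⟨ ΣZ-swap B B (λ n D → G D n) ⟩
      ΣZ B (λ D → ΣZ B (G D))
        ≡⟨ ΣZ-blocks 11 {f = λ D → ΣZ B (G D)} (λ D B≤D → ΣZ-zero B (λ n → *-zero (parityWeight ε ((D ℤ.+ n) ℤ.- n)) (diag-supp₁ n D B≤D))) ⟩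
      sumBelow 12 (λ d → ΣZ B (λ v → ΣZ B (G (v ℤ.* + 12 ℤ.+ + d))))
        ≡⟨ sum-cong< 12 {λ d → ΣZ B (λ v → ΣZ B (G (v ℤ.* + 12 ℤ.+ + d)))} {λ d → parityWeight ε (+ d) ℤ.* P (classK κ d) (classR ρ d)} (λ d d<12 → trans
             (ΣZ-cong B (λ v → trans (inner d (ℕₚ.≤-pred d<12) v) (ΣZ-*ˡ B (parityWeight ε (+ d)) (λ u → Φ (form (u ℤ.* + 12 ℤ.+ classK κ d) (v ℤ.* + 420 ℤ.+ classR ρ d))))))
             (ΣZ-*ˡ B (parityWeight ε (+ d)) (λ v → ΣZ B (λ u → Φ (form (u ℤ.* + 12 ℤ.+ classK κ d) (v ℤ.* + 420 ℤ.+ classR ρ d)))))) ⟩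
      sumBelow 12 (λ d → parityWeight ε (+ d) ℤ.* P (classK κ d) (classR ρ d)) ∎
      where
      open ≡-Reasoning
      F G : ℤ → ℤ → ℤ
      F m n = parityWeight ε (m ℤ.- n) ℤ.* Φ (form (linK κ m n) (linR ρ m n))
      G D n = F (D ℤ.+ n) n
      K-eq : ∀ u v d κ → + 7 ℤ.* ((v ℤ.* + 12 ℤ.+ d) ℤ.+ (u ℤ.+ -[1+ 6 ] ℤ.* v)) ℤ.+ + 5 ℤ.* (u ℤ.+ -[1+ 6 ] ℤ.* v) ℤ.+ κ ≡ u ℤ.* + 12 ℤ.+ (+ 7 ℤ.* d ℤ.+ κ)
      K-eq = ℤ-Solver.solve-∀
      R-eq : ∀ n v d ρ → + 35 ℤ.* (((v ℤ.* + 12 ℤ.+ d) ℤ.+ n) ℤ.- n) ℤ.+ ρ ≡ v ℤ.* + 420 ℤ.+ (+ 35 ℤ.* d ℤ.+ ρ)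
      R-eq = ℤ-Solver.solve-∀
      diff : ∀ D n → (D ℤ.+ n) ℤ.- n ≡ D
      diff = ℤ-Solver.solve-∀
      inner : ∀ d → d ≤ 11 → ∀ v → ΣZ B (G (v ℤ.* + 12 ℤ.+ + d)) ≡
        ΣZ B (λ u → parityWeight ε (+ d) ℤ.* Φ (form (u ℤ.* + 12 ℤ.+ classK κ d) (v ℤ.* + 420 ℤ.+ classR ρ d)))
      inner d d≤11 v = trans
        (sym (ΣZ-shift (-[1+ 6 ] ℤ.* v)
          (λ n B≤n → *-zero (parityWeight ε ((D ℤ.+ n) ℤ.- n)) (diag-supp₂ D n B≤n))
          (Supp-cong (λ u → sym (term u)) (λ u B≤u → *-zero (parityWeight ε (+ d)) (P-supp₁ (classK κ d) (v ℤ.* + 420 ℤ.+ classR ρ d) J<O u B≤u)))))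
        (ΣZ-cong B term)
        where
        D : ℤ
        D = v ℤ.* + 12 ℤ.+ + d
        term : ∀ u → G D (u ℤ.+ -[1+ 6 ] ℤ.* v) ≡ parityWeight ε (+ d) ℤ.* Φ (form (u ℤ.* + 12 ℤ.+ classK κ d) (v ℤ.* + 420 ℤ.+ classR ρ d))
        term u = cong₂ ℤ._*_
          (trans (cong (parityWeight ε) (diff D (u ℤ.+ -[1+ 6 ] ℤ.* v))) (parityWeight-12 ε v (+ d)))
          (cong Φ (cong₂ form (K-eq u v (+ d) κ) (R-eq (u ℤ.+ -[1+ 6 ] ℤ.* v) v (+ d) ρ)))
        J<O : ∣ classK κ d ∣ < 1000
        J<O = subst (λ z → ∣ + 7 ℤ.* + d ℤ.+ z ∣ < 1000) (ℤₚ.*-identityˡ κ)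
          (small (+ 7) 1ℤ (+ d) κ (ℕₚ.≤-trans d≤11 (ℕₚ.m≤m+n 11 89)) κ≤)

    -- Replacing n by -n preserves the parity of m - n. It turns the second diagonalisation,
    -- ((X-Y)/2, (5X+7Y)/2), into the shape of `linK` and `linR`, so one lattice computation covers
    -- both.
    W-reflect : ∀ ε κ′ ρ′ →
      (∀ m n → form (linK κ′ m n) (linR ρ′ m n) ≡ form (linK κ m (ℤ.- n)) (linR ρ m (ℤ.- n))) →
      W ε κ′ ρ′ ≡ W ε κ ρ
    W-reflect ε κ′ ρ′ eq = ΣZ-cong B λ m → trans
      (ΣZ-cong B (λ n → cong₂ ℤ._*_ (cong (λ s → 1ℤ ℤ.+ ε ℤ.* s) (parity m n)) (cong Φ (eq m n))))
      (ΣZ-neg (λ n B≤n → *-zero (parityWeight ε (m ℤ.- n)) (W-supp₂ m n B≤n)))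
      where
      parity : ∀ m n → sg (m ℤ.- n) ≡ sg (m ℤ.- ℤ.- n)
      parity m n = trans (sg-+ m (ℤ.- n)) (trans (cong (ℤ._*_ (sg m)) (sym (sg-neg (ℤ.- n)))) (sym (sg-+ m (ℤ.- ℤ.- n))))

  even-weights : ∀ (p : ℕ → ℤ) → sumBelow 12 (λ d → parityWeight 1ℤ (+ d) ℤ.* p d) ≡
    + 2 ℤ.* (p 0 ℤ.+ p 2 ℤ.+ p 4 ℤ.+ p 6 ℤ.+ p 8 ℤ.+ p 10)
  even-weights p = lem (p 0) (p 1) (p 2) (p 3) (p 4) (p 5) (p 6) (p 7) (p 8) (p 9) (p 10) (p 11)
    where
    lem : ∀ a b c d e f g h i j k l →
      0ℤ ℤ.+ + 2 ℤ.* a ℤ.+ 0ℤ ℤ.* b ℤ.+ + 2 ℤ.* c ℤ.+ 0ℤ ℤ.* d ℤ.+ + 2 ℤ.* e ℤ.+ 0ℤ ℤ.* f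
        ℤ.+ + 2 ℤ.* g ℤ.+ 0ℤ ℤ.* h ℤ.+ + 2 ℤ.* i ℤ.+ 0ℤ ℤ.* j ℤ.+ + 2 ℤ.* k ℤ.+ 0ℤ ℤ.* l
      ≡ + 2 ℤ.* (a ℤ.+ c ℤ.+ e ℤ.+ g ℤ.+ i ℤ.+ k)
    lem = ℤ-Solver.solve-∀

  odd-weights : ∀ (p : ℕ → ℤ) → sumBelow 12 (λ d → parityWeight -1ℤ (+ d) ℤ.* p d) ≡
    + 2 ℤ.* (p 1 ℤ.+ p 3 ℤ.+ p 5 ℤ.+ p 7 ℤ.+ p 9 ℤ.+ p 11)
  odd-weights p = lem (p 0) (p 1) (p 2) (p 3) (p 4) (p 5) (p 6) (p 7) (p 8) (p 9) (p 10) (p 11)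
    where
    lem : ∀ b a d c f e h g j i l k →
      0ℤ ℤ.+ 0ℤ ℤ.* b ℤ.+ + 2 ℤ.* a ℤ.+ 0ℤ ℤ.* d ℤ.+ + 2 ℤ.* c ℤ.+ 0ℤ ℤ.* f ℤ.+ + 2 ℤ.* e
        ℤ.+ 0ℤ ℤ.* h ℤ.+ + 2 ℤ.* g ℤ.+ 0ℤ ℤ.* j ℤ.+ + 2 ℤ.* i ℤ.+ 0ℤ ℤ.* l ℤ.+ + 2 ℤ.* k
      ≡ + 2 ℤ.* (a ℤ.+ c ℤ.+ e ℤ.+ g ℤ.+ i ℤ.+ k)
    lem = ℤ-Solver.solve-∀

  +-cong₆ : ∀ {a b c d e f a′ b′ c′ d′ e′ f′} → a ≡ a′ → b ≡ b′ → c ≡ c′ → d ≡ d′ → e ≡ e′ → f ≡ f′ →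
    a ℤ.+ b ℤ.+ c ℤ.+ d ℤ.+ e ℤ.+ f ≡ a′ ℤ.+ b′ ℤ.+ c′ ℤ.+ d′ ℤ.+ e′ ℤ.+ f′
  +-cong₆ refl refl refl refl refl refl = refl

  P₁ P₃ P₅ : ℕ → ℤ
  P₁ r = P (+ 1) (+ r)
  P₃ r = P (+ 3) (+ r)
  P₅ r = P (+ 5) (+ r)

  -- The classes are (7d + 3, 35d - 3) for even d < 12, brought by signs and shifts to K = 1, 3, 5
  -- and 0 < R < 210.
  W-even : W 1ℤ (+ 3) -[1+ 2 ] ≡ + 2 ℤ.* (P₃ 3 ℤ.+ P₅ 67 ℤ.+ P₅ 137 ℤ.+ P₃ 207 ℤ.+ P₁ 143 ℤ.+ P₁ 73)
  W-even = trans (lattice-sum (+ 3) -[1+ 2 ] (ℕₚ.m≤m+n 3 97) (ℕₚ.m≤m+n 3 97) 1ℤ)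
    (trans (even-weights (λ d → P (classK (+ 3) d) (classR -[1+ 2 ] d))) (cong (ℤ._*_ (+ 2)) (+-cong₆
      (P-neg₂ (+ 3) (+ 3))
      (P-shift₁ (+ 1) (+ 5) (+ 67))
      (P-flip₁ (+ 3) (+ 5) (+ 137))
      (P-flip₁ (+ 4) (+ 3) (+ 207))
      (trans (P-flip₁ (+ 5) (+ 1) (+ 277)) (P-flip₂ (+ 1) (+ 1) (+ 143)))
      (trans (P-shift₁ (+ 6) (+ 1) (+ 347)) (P-flip₂ (+ 1) (+ 1) (+ 73))))))

  -- For odd m - n the number 7m + 5n + 3 is even. Passing to (X-Y)/2 = 7m - 5n and (5X+7Y)/2 =
  -- 35(m+n) + 18 makes K odd, so the classes are again among `P₁`, `P₃`, `P₅`.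
  W-odd : W -1ℤ (+ 3) -[1+ 2 ] ≡ + 2 ℤ.* (P₅ 53 ℤ.+ P₃ 123 ℤ.+ P₁ 193 ℤ.+ P₁ 157 ℤ.+ P₃ 87 ℤ.+ P₅ 17)
  W-odd = trans (W-reflect (+ 0) (+ 18) z≤n (ℕₚ.m≤m+n 18 82) -1ℤ (+ 3) -[1+ 2 ] forms)
    (trans (lattice-sum (+ 0) (+ 18) z≤n (ℕₚ.m≤m+n 18 82) -1ℤ)
    (trans (odd-weights (λ d → P (classK (+ 0) d) (classR (+ 18) d))) (cong (ℤ._*_ (+ 2)) (+-cong₆
      (P-flip₁ (+ 1) (+ 5) (+ 53))
      (P-flip₁ (+ 2) (+ 3) (+ 123))
      (P-flip₁ (+ 3) (+ 1) (+ 193))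
      (trans (P-shift₁ (+ 4) (+ 1) (+ 263)) (P-flip₂ (+ 1) (+ 1) (+ 157)))
      (trans (P-shift₁ (+ 5) (+ 3) (+ 333)) (P-flip₂ (+ 1) (+ 3) (+ 87)))
      (trans (P-shift₁ (+ 6) (+ 5) (+ 403)) (P-flip₂ (+ 1) (+ 5) (+ 17)))))))
    where
    forms : ∀ m n →
      + 35 ℤ.* ((+ 7 ℤ.* m ℤ.+ + 5 ℤ.* n ℤ.+ + 3) ℤ.* (+ 7 ℤ.* m ℤ.+ + 5 ℤ.* n ℤ.+ + 3))
        ℤ.+ (+ 35 ℤ.* (m ℤ.- n) ℤ.+ -[1+ 2 ]) ℤ.* (+ 35 ℤ.* (m ℤ.- n) ℤ.+ -[1+ 2 ])
      ≡ + 35 ℤ.* ((+ 7 ℤ.* m ℤ.+ + 5 ℤ.* (ℤ.- n) ℤ.+ + 0) ℤ.* (+ 7 ℤ.* m ℤ.+ + 5 ℤ.* (ℤ.- n) ℤ.+ + 0))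
        ℤ.+ (+ 35 ℤ.* (m ℤ.- ℤ.- n) ℤ.+ + 18) ℤ.* (+ 35 ℤ.* (m ℤ.- ℤ.- n) ℤ.+ + 18)
    forms = ℤ-Solver.solve-∀

  -- Both sides are Σ Φ(15(14m + 4)² + 21(10n - 2)²) over m ≡ n (mod 2), diagonalised in two ways.
  exchange : P₁ 17 ℤ.+ P₃ 87 ℤ.+ P₅ 157 ℤ.+ P₅ 193 ℤ.+ P₃ 123 ℤ.+ P₁ 53 ≡ P₃ 3 ℤ.+ P₅ 73 ℤ.+ P₅ 143 ℤ.+ P₃ 207 ℤ.+ P₁ 137 ℤ.+ P₁ 67
  exchange = ℤₚ.*-cancelˡ-≡ (+ 2) _ _ (trans (sym W₁) (trans (W-reflect (+ 3) (+ 3) (ℕₚ.m≤m+n 3 97) (ℕₚ.m≤m+n 3 97) 1ℤ (+ 1) (+ 17) forms) W₂))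
    where
    forms : ∀ m n →
      + 35 ℤ.* ((+ 7 ℤ.* m ℤ.+ + 5 ℤ.* n ℤ.+ + 1) ℤ.* (+ 7 ℤ.* m ℤ.+ + 5 ℤ.* n ℤ.+ + 1))
        ℤ.+ (+ 35 ℤ.* (m ℤ.- n) ℤ.+ + 17) ℤ.* (+ 35 ℤ.* (m ℤ.- n) ℤ.+ + 17)
      ≡ + 35 ℤ.* ((+ 7 ℤ.* m ℤ.+ + 5 ℤ.* (ℤ.- n) ℤ.+ + 3) ℤ.* (+ 7 ℤ.* m ℤ.+ + 5 ℤ.* (ℤ.- n) ℤ.+ + 3))
        ℤ.+ (+ 35 ℤ.* (m ℤ.- ℤ.- n) ℤ.+ + 3) ℤ.* (+ 35 ℤ.* (m ℤ.- ℤ.- n) ℤ.+ + 3)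
    forms = ℤ-Solver.solve-∀
    W₁ : W 1ℤ (+ 1) (+ 17) ≡ + 2 ℤ.* (P₁ 17 ℤ.+ P₃ 87 ℤ.+ P₅ 157 ℤ.+ P₅ 193 ℤ.+ P₃ 123 ℤ.+ P₁ 53)
    W₁ = trans (lattice-sum (+ 1) (+ 17) (s≤s z≤n) (ℕₚ.m≤m+n 17 83) 1ℤ)
      (trans (even-weights (λ d → P (classK (+ 1) d) (classR (+ 17) d))) (cong (ℤ._*_ (+ 2)) (+-cong₆
        (refl {x = P₁ 17})
        (P-shift₁ (+ 1) (+ 3) (+ 87))
        (P-shift₁ (+ 2) (+ 5) (+ 157))
        (trans (P-flip₁ (+ 4) (+ 5) (+ 227)) (P-flip₂ (+ 1) (+ 5) (+ 193)))
        (trans (P-flip₁ (+ 5) (+ 3) (+ 297)) (P-flip₂ (+ 1) (+ 3) (+ 123)))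
        (trans (P-flip₁ (+ 6) (+ 1) (+ 367)) (P-flip₂ (+ 1) (+ 1) (+ 53))))))
    W₂ : W 1ℤ (+ 3) (+ 3) ≡ + 2 ℤ.* (P₃ 3 ℤ.+ P₅ 73 ℤ.+ P₅ 143 ℤ.+ P₃ 207 ℤ.+ P₁ 137 ℤ.+ P₁ 67)
    W₂ = trans (lattice-sum (+ 3) (+ 3) (ℕₚ.m≤m+n 3 97) (ℕₚ.m≤m+n 3 97) 1ℤ)
      (trans (even-weights (λ d → P (classK (+ 3) d) (classR (+ 3) d))) (cong (ℤ._*_ (+ 2)) (+-cong₆
        (refl {x = P₃ 3})
        (P-shift₁ (+ 1) (+ 5) (+ 73))
        (P-flip₁ (+ 3) (+ 5) (+ 143))
        (trans (P-flip₁ (+ 4) (+ 3) (+ 213)) (P-flip₂ (+ 1) (+ 3) (+ 207)))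
        (trans (P-flip₁ (+ 5) (+ 1) (+ 283)) (P-flip₂ (+ 1) (+ 1) (+ 137)))
        (trans (P-shift₁ (+ 6) (+ 1) (+ 353)) (P-flip₂ (+ 1) (+ 1) (+ 67))))))

-- The exponents of the left-hand side

-- The solutions k of k² ≡ 289 (mod 840) are the numbers congruent to some ± root i modulo 420,
-- and root i² = 840 (offset i) + 289.
root offset : ℕ → ℕ
root 0 = 17
root 1 = 53
root 2 = 67
root 3 = 73
root 4 = 137
root 5 = 143
root 6 = 157
root _ = 193
offset 0 = 0
offset 1 = 3
offset 2 = 5
offset 3 = 6
offset 4 = 22
offset 5 = 24
offset 6 = 29
offset _ = 44

-- The second component expresses `root i` ≤ 209 additively, as `expo-420` takes it.
root-spec : ∀ i → (root i * root i ≡ 840 * offset i + 289) × (root i + (209 ∸ root i) ≡ 209)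
root-spec 0 = refl , refl
root-spec 1 = refl , refl
root-spec 2 = refl , refl
root-spec 3 = refl , refl
root-spec 4 = refl , refl
root-spec 5 = refl , refl
root-spec 6 = refl , refl
root-spec (suc (suc (suc (suc (suc (suc (suc _))))))) = refl , refl

-- With r = `root i` this is ((420v + r)² - 289)/840 = 210v² + rv + `offset i`; the quadratic part
-- is `expo` for 210 + r and 210 - r.
rootExpo : ℕ → ℤ → ℕ
rootExpo i v = expo (suc (209 + root i)) (suc (209 ∸ root i)) v + offset i

rootExpo-≥ : ∀ i v → ∣ v ∣ ≤ rootExpo i v
rootExpo-≥ i v = ℕₚ.≤-trans (expo-≥ (209 + root i) (209 ∸ root i) v) (ℕₚ.m≤m+n _ (offset i))

expo-420 : ∀ r s v → r + s ≡ 209 →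
  + 2 ℤ.* + expo (suc (209 + r)) (suc s) v ≡ + 420 ℤ.* (v ℤ.* v) ℤ.+ + 2 ℤ.* + r ℤ.* v
expo-420 r s v r+s = trans (expo-closed (suc (209 + r)) (suc s) v) (cong₂ (λ c d → c ℤ.* (v ℤ.* v) ℤ.+ d ℤ.* v)
  (cong +_ (trans (lem₁ r s) (cong (_+_ 211) r+s)))
  (trans (cong₂ (λ x y → x ℤ.- y) cast₁ (ℤₚ.pos-+ 1 s))
    (trans (lem₂ (+ r) (+ s))
    (trans (cong (λ z → + 2 ℤ.* + r ℤ.+ (+ 209 ℤ.- z)) (trans (sym (ℤₚ.pos-+ r s)) (cong +_ r+s))) (ℤₚ.+-identityʳ (+ 2 ℤ.* + r))))))
  where
  lem₁ : ∀ r s → suc (209 + r) + suc s ≡ 211 + (r + s)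
  lem₁ = ℕ-Solver.solve-∀
  cast₁ : + (suc (209 + r)) ≡ + 210 ℤ.+ + r
  cast₁ = ℤₚ.pos-+ 210 r
  lem₂ : ∀ r s → (+ 210 ℤ.+ r) ℤ.- (+ 1 ℤ.+ s) ≡ + 2 ℤ.* r ℤ.+ (+ 209 ℤ.- (r ℤ.+ s))
  lem₂ = ℤ-Solver.solve-∀

offset-closed : ∀ i → + 840 ℤ.* + offset i ≡ + root i ℤ.* + root i ℤ.- + 289
offset-closed i = trans (lem (+ 840 ℤ.* + offset i)) (cong (ℤ._- + 289)
  (sym (trans (sym (ℤₚ.pos-* (root i) (root i))) (trans (cong +_ (proj₁ (root-spec i)))
    (trans (ℤₚ.pos-+ (840 * offset i) 289) (cong (ℤ._+ + 289) (ℤₚ.pos-* 840 (offset i))))))))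
  where
  lem : ∀ x → x ≡ (x ℤ.+ + 289) ℤ.- + 289
  lem = ℤ-Solver.solve-∀

rootExpo-closed : ∀ i v → + 840 ℤ.* + rootExpo i v ≡
  (v ℤ.* + 420 ℤ.+ + root i) ℤ.* (v ℤ.* + 420 ℤ.+ + root i) ℤ.- + 289
rootExpo-closed i v = begin
  + 840 ℤ.* + (e + offset i)
    ≡⟨ cong (ℤ._*_ (+ 840)) (ℤₚ.pos-+ e (offset i)) ⟩
  + 840 ℤ.* (+ e ℤ.+ + offset i)
    ≡⟨ lem₁ (+ e) (+ offset i) ⟩
  + 420 ℤ.* (+ 2 ℤ.* + e) ℤ.+ + 840 ℤ.* + offset i
    ≡⟨ cong₂ (λ x y → + 420 ℤ.* x ℤ.+ y) (expo-420 (root i) (209 ∸ root i) v (proj₂ (root-spec i))) (offset-closed i) ⟩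
  + 420 ℤ.* (+ 420 ℤ.* (v ℤ.* v) ℤ.+ + 2 ℤ.* + root i ℤ.* v) ℤ.+ (+ root i ℤ.* + root i ℤ.- + 289)
    ≡⟨ lem₂ (+ 420) v (+ root i) ⟩
  (v ℤ.* + 420 ℤ.+ + root i) ℤ.* (v ℤ.* + 420 ℤ.+ + root i) ℤ.- + 289 ∎
  where
  open ≡-Reasoning
  e : ℕ
  e = expo (suc (209 + root i)) (suc (209 ∸ root i)) v
  lem₁ : ∀ e o → + 840 ℤ.* (e ℤ.+ o) ≡ + 420 ℤ.* (+ 2 ℤ.* e) ℤ.+ + 840 ℤ.* o
  lem₁ = ℤ-Solver.solve-∀
  lem₂ : ∀ c v r → c ℤ.* (c ℤ.* (v ℤ.* v) ℤ.+ + 2 ℤ.* r ℤ.* v) ℤ.+ (r ℤ.* r ℤ.- + 289) ≡ (v ℤ.* c ℤ.+ r) ℤ.* (v ℤ.* c ℤ.+ r) ℤ.- + 289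
  lem₂ = ℤ-Solver.solve-∀

-- For d < 16, residue d lists the residues ± root i modulo 420 in increasing order, and
-- 840 (value l d) + 289 = (420 l + residue d)².
residue : ℕ → ℕ
residue d = if d <ᵇ 8 then root d else 420 ∸ root (15 ∸ d)

value : ℕ → ℕ → ℕ
value l d = if d <ᵇ 8 then rootExpo d (+ l) else rootExpo (15 ∸ d) -[1+ l ]

square-∣∣ : ∀ i → i ℤ.* i ≡ + (∣ i ∣ * ∣ i ∣)
square-∣∣ (+ n)    = sym (ℤₚ.pos-* n n)
square-∣∣ -[1+ n ] = refl

rootExpo-square : ∀ i v k → ∣ v ℤ.* + 420 ℤ.+ + root i ∣ ≡ k → k * k ≡ 840 * rootExpo i v + 289
rootExpo-square i v k refl = ℤₚ.+-injective (begin
  + (∣ z ∣ * ∣ z ∣)                           ≡⟨ sym (square-∣∣ z) ⟩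
  z ℤ.* z                                     ≡⟨ lem (z ℤ.* z) ⟩
  (z ℤ.* z ℤ.- + 289) ℤ.+ + 289               ≡⟨ cong (ℤ._+ + 289) (sym (rootExpo-closed i v)) ⟩
  + 840 ℤ.* + rootExpo i v ℤ.+ + 289          ≡⟨ cong (ℤ._+ + 289) (sym (ℤₚ.pos-* 840 (rootExpo i v))) ⟩
  + (840 * rootExpo i v) ℤ.+ + 289            ≡⟨ sym (ℤₚ.pos-+ (840 * rootExpo i v) 289) ⟩
  + (840 * rootExpo i v + 289)                ∎)
  where
  open ≡-Reasoning
  z : ℤ
  z = v ℤ.* + 420 ℤ.+ + root i
  lem : ∀ x → x ≡ (x ℤ.- + 289) ℤ.+ + 289
  lem = ℤ-Solver.solve-∀

root-complement : ∀ i → root i + (420 ∸ root i) ≡ 420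
root-complement i = ℕₚ.m+[n∸m]≡n (ℕₚ.≤-trans (subst (root i ≤_) (proj₂ (root-spec i)) (ℕₚ.m≤m+n (root i) (209 ∸ root i))) (ℕₚ.m≤m+n 209 211))

-- For d ≥ 8 the residue is 420 - r with r = `root (15 ∸ d)`, and 420l + (420 - r) = -(420v + r) at
-- v = -(l+1). Hence the negative indices supply the upper eight residues.
value-square : ∀ l d → (l * 420 + residue d) * (l * 420 + residue d) ≡ 840 * value l d + 289
value-square l d = by-cases (d <ᵇ 8) (residue d) (value l d) refl refl
  where
  open ≡-Reasoning
  i s : ℕ
  i = 15 ∸ d
  s = 420 ∸ root i
  lem : ∀ l r s → ℤ.- (1ℤ ℤ.+ l) ℤ.* (r ℤ.+ s) ℤ.+ r ≡ ℤ.- (l ℤ.* (r ℤ.+ s) ℤ.+ s)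
  lem = ℤ-Solver.solve-∀
  split : + 420 ≡ + root i ℤ.+ + s
  split = trans (cong +_ (sym (root-complement i))) (ℤₚ.pos-+ (root i) s)
  flip : -[1+ l ] ℤ.* + 420 ℤ.+ + root i ≡ ℤ.- (+ (l * 420 + s))
  flip = begin
    -[1+ l ] ℤ.* + 420 ℤ.+ + root i
      ≡⟨ cong (λ z → -[1+ l ] ℤ.* z ℤ.+ + root i) split ⟩
    -[1+ l ] ℤ.* (+ root i ℤ.+ + s) ℤ.+ + root i
      ≡⟨ lem (+ l) (+ root i) (+ s) ⟩
    ℤ.- (+ l ℤ.* (+ root i ℤ.+ + s) ℤ.+ + s)
      ≡⟨ cong (λ z → ℤ.- (+ l ℤ.* z ℤ.+ + s)) (sym split) ⟩
    ℤ.- (+ l ℤ.* + 420 ℤ.+ + s)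
      ≡⟨ cong ℤ.-_ (sym (trans (ℤₚ.pos-+ (l * 420) s) (cong (ℤ._+ + s) (ℤₚ.pos-* l 420)))) ⟩
    ℤ.- (+ (l * 420 + s)) ∎
  -- The branches are passed as variables, since unifying 840 * x with 840 * y would unfold the product.
  by-cases : ∀ b r m → r ≡ (if b then root d else s) → m ≡ (if b then rootExpo d (+ l) else rootExpo i -[1+ l ]) →
    (l * 420 + r) * (l * 420 + r) ≡ 840 * m + 289
  by-cases true  _ _ refl refl = rootExpo-square d (+ l) (l * 420 + root d)
    (cong ∣_∣ (sym (trans (ℤₚ.pos-+ (l * 420) (root d)) (cong (ℤ._+ + root d) (ℤₚ.pos-* l 420)))))
  by-cases false _ _ refl refl = rootExpo-square i -[1+ l ] (l * 420 + s) (trans (cong ∣_∣ flip) (ℤₚ.∣-i∣≡∣i∣ (+ (l * 420 + s))))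

StrictlyIncreasing : (ℕ → ℕ) → Set
StrictlyIncreasing f = ∀ {m n} → m < n → f m < f n

increasing-≥ : ∀ {f} → StrictlyIncreasing f → ∀ n → n ≤ f n
increasing-≥ inc zero    = z≤n
increasing-≥ inc (suc n) = ℕₚ.≤-<-trans (increasing-≥ inc n) (inc (ℕₚ.n<1+n n))

increasing-mono : ∀ {f} → StrictlyIncreasing f → ∀ {m n} → m ≤ n → f m ≤ f n
increasing-mono {f} inc {m} {n} m≤n with ℕₚ.m≤n⇒m<n∨m≡n m≤n
... | inj₁ m<n  = ℕₚ.<⇒≤ (inc m<n)
... | inj₂ refl = ℕₚ.≤-refl

-- The reindexing π with g(π n) = f n is itself strictly increasing, so n ≤ π n and g n ≤ g(π n) = f
-- n. Used in both directions, this shows that an increasing enumeration is determined by its image.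
image-⊆⇒≤ : ∀ {f g} → StrictlyIncreasing f → StrictlyIncreasing g →
  (∀ n → ∃[ m ] g m ≡ f n) → ∀ n → g n ≤ f n
image-⊆⇒≤ {f} {g} f-inc g-inc sub n =
  subst (g n ≤_) (proj₂ (sub n)) (increasing-mono g-inc (increasing-≥ π-inc n))
  where
  π : ℕ → ℕ
  π n = proj₁ (sub n)
  π-inc : StrictlyIncreasing π
  π-inc {m} {n} m<n = ℕₚ.≰⇒> λ πn≤πm → ℕₚ.<⇒≱ (f-inc m<n)
    (subst₂ _≤_ (proj₂ (sub n)) (proj₂ (sub m)) (increasing-mono g-inc πn≤πm))

residue-< : ∀ {d} → d < 16 → residue d < 420
residue-< = toWitness {a? = ℕₚ.allUpTo? (λ d → residue d <? 420) 16} _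

residue-inc : ∀ {d} → d < 16 → ∀ {e} → e < 16 → d < e → residue d < residue e
residue-inc = toWitness {a? = ℕₚ.allUpTo? (λ d → ℕₚ.allUpTo? (λ e → (d <? e) →-dec (residue d <? residue e)) 16) 16} _

-- Checked by evaluation over all ρ < 420. Residues modulo 420 suffice for a congruence modulo 840,
-- because (ρ + 420l)² - ρ² is a multiple of 840.
residue-complete : ∀ {ρ} → ρ < 420 → (ρ * ρ) % 840 ≡ 289 → ∃[ d ] (d < 16 × residue d ≡ ρ)
residue-complete = toWitness {a? = ℕₚ.allUpTo? (λ ρ → ((ρ * ρ) % 840 ≟ 289) →-dec ℕₚ.anyUpTo? (λ d → residue d ≟ ρ) 16) 420} _

enum : ℕ → ℕ
enum n = value (n / 16) (n % 16)

enumRoot : ℕ → ℕ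
enumRoot n = (n / 16) * 420 + residue (n % 16)

enum-square : ∀ n → enumRoot n * enumRoot n ≡ 840 * enum n + 289
enum-square n = value-square (n / 16) (n % 16)

enumRoot-inc : StrictlyIncreasing enumRoot
enumRoot-inc {m} {n} m<n with ℕₚ.<-cmp (m / 16) (n / 16)
... | tri< l<l′ _ _ = begin-strict
  (m / 16) * 420 + residue (m % 16)   <⟨ ℕₚ.+-monoʳ-< ((m / 16) * 420) (residue-< (ℕ-DivMod.m%n<n m 16)) ⟩
  (m / 16) * 420 + 420                ≡⟨ ℕₚ.+-comm ((m / 16) * 420) 420 ⟩
  suc (m / 16) * 420                  ≤⟨ ℕₚ.*-monoˡ-≤ 420 l<l′ ⟩
  (n / 16) * 420                      ≤⟨ ℕₚ.m≤m+n ((n / 16) * 420) (residue (n % 16)) ⟩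
  enumRoot n                          ∎
  where open ℕₚ.≤-Reasoning
... | tri≈ _ l≡l′ _ = subst (λ l → l * 420 + residue (m % 16) < enumRoot n) (sym l≡l′)
  (ℕₚ.+-monoʳ-< ((n / 16) * 420) (residue-inc (ℕ-DivMod.m%n<n m 16) (ℕ-DivMod.m%n<n n 16)
    (ℕₚ.+-cancelʳ-< ((n / 16) * 16) (m % 16) (n % 16)
      (subst₂ _<_ (trans (ℕ-DivMod.m≡m%n+[m/n]*n m 16) (cong (λ l → m % 16 + l * 16) l≡l′)) (ℕ-DivMod.m≡m%n+[m/n]*n n 16) m<n))))
... | tri> _ _ l>l′ = contradiction (ℕ-DivMod./-monoˡ-≤ 16 (ℕₚ.<⇒≤ m<n)) (ℕₚ.<⇒≱ l>l′)

enum-inc : StrictlyIncreasing enum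
enum-inc {m} {n} m<n = ℕₚ.*-cancelˡ-< 840 (enum m) (enum n) (ℕₚ.+-cancelʳ-< 289 (840 * enum m) (840 * enum n)
  (subst₂ _<_ (enum-square m) (enum-square n) (ℕₚ.*-mono-< (enumRoot-inc m<n) (enumRoot-inc m<n))))

enum-at : ∀ l d → d < 16 → (l * 16 + d) / 16 ≡ l × (l * 16 + d) % 16 ≡ d
enum-at l d d<16 = quotient , remainder
  where
  remainder : (l * 16 + d) % 16 ≡ d
  remainder = trans (cong (_% 16) (ℕₚ.+-comm (l * 16) d))
    (trans (ℕ-DivMod.[m+kn]%n≡m%n d l 16) (ℕ-DivMod.m<n⇒m%n≡m d<16))
  quotient : (l * 16 + d) / 16 ≡ l
  quotient = ℕₚ.*-cancelʳ-≡ ((l * 16 + d) / 16) l 16 (ℕₚ.+-cancelˡ-≡ d _ _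
    (trans (cong (_+ (l * 16 + d) / 16 * 16) (sym remainder))
      (trans (sym (ℕ-DivMod.m≡m%n+[m/n]*n (l * 16 + d) 16)) (ℕₚ.+-comm (l * 16) d))))

enum-complete : ∀ m k → k * k ≡ 840 * m + 289 → ∃[ n ] enum n ≡ m
enum-complete m k kk = n , ℕₚ.*-cancelˡ-≡ (enum n) m 840 (ℕₚ.+-cancelʳ-≡ 289 _ _
    (trans (sym (enum-square n)) (trans (cong (λ x → x * x) root≡k) kk)))
  where
  ρ l : ℕ
  ρ = k % 420
  l = k / 420
  k≡ : k ≡ ρ + l * 420
  k≡ = ℕ-DivMod.m≡m%n+[m/n]*n k 420
  ρ-square : (ρ * ρ) % 840 ≡ 289
  ρ-square = begin
    (ρ * ρ) % 840                                            ≡⟨ sym (ℕ-DivMod.[m+kn]%n≡m%n (ρ * ρ) (l * ρ + 210 * (l * l)) 840) ⟩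
    (ρ * ρ + (l * ρ + 210 * (l * l)) * 840) % 840            ≡⟨ cong (_% 840) (lem ρ l) ⟩
    ((ρ + l * 420) * (ρ + l * 420)) % 840                    ≡⟨ cong (λ x → (x * x) % 840) (sym k≡) ⟩
    (k * k) % 840                                            ≡⟨ cong (_% 840) (trans kk (trans (ℕₚ.+-comm (840 * m) 289) (cong (_+_ 289) (ℕₚ.*-comm 840 m)))) ⟩
    (289 + m * 840) % 840                                    ≡⟨ ℕ-DivMod.[m+kn]%n≡m%n 289 m 840 ⟩
    289                                                      ∎
    where
    open ≡-Reasoning
    lem : ∀ ρ l → ρ * ρ + (l * ρ + 210 * (l * l)) * 840 ≡ (ρ + l * 420) * (ρ + l * 420)
    lem = ℕ-Solver.solve-∀
  found : ∃[ d ] (d < 16 × residue d ≡ ρ)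
  found = residue-complete (ℕ-DivMod.m%n<n k 420) ρ-square
  d n : ℕ
  d = proj₁ found
  n = l * 16 + d
  d<16 : d < 16
  d<16 = proj₁ (proj₂ found)
  root≡k : enumRoot n ≡ k
  root≡k = trans (cong₂ (λ x y → x * 420 + residue y) (proj₁ (enum-at l d d<16)) (proj₂ (enum-at l d d<16)))
    (trans (cong (_+_ (l * 420)) (proj₂ (proj₂ found))) (trans (ℕₚ.+-comm (l * 420) ρ) (sym k≡)))

enum-unique : ∀ a → StrictlyIncreasing a →
  (∀ m → (∃[ k ] k * k ≡ 840 * m + 289) ⇔ (∃[ n ] a n ≡ m)) → ∀ n → a n ≡ enum n
enum-unique a a-inc spec n = ℕₚ.≤-antisym
  (image-⊆⇒≤ enum-inc a-inc (λ n → Equivalence.to (spec (enum n)) (enumRoot n , enum-square n)) n)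
  (image-⊆⇒≤ a-inc enum-inc (λ n → let k , kk = Equivalence.from (spec (a n)) (n , refl) in enum-complete (a n) k kk) n)

rootSeries : FPS
rootSeries = ΣS 8 (λ i → gen (rootExpo i) (λ _ → sgnT i))

lhs-rootSeries : ∀ a → StrictlyIncreasing a →
  (∀ m → (∃[ k ] k * k ≡ 840 * m + 289) ⇔ (∃[ n ] a n ≡ m)) → ∀ N → lhsSeries a N ≡ rootSeries N
lhs-rootSeries a a-inc spec N = begin
  sumBelow M (λ n → if a n ≡ᵇ N then sgnT n else 0ℤ)
    ≡⟨ sum-cong M (λ n → cong (λ x → if x ≡ᵇ N then sgnT n else 0ℤ) (enum-unique a a-inc spec n)) ⟩
  sumBelow M h
    ≡⟨ sym (sum-extend (ℕₚ.m≤m*n M 16) (λ n N<n → if-cong (trans (≡ᵇ-sym (enum n) N) (≡ᵇ-< (ℕₚ.<-≤-trans N<n (increasing-≥ enum-inc n)))))) ⟩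
  sumBelow (M * 16) h
    ≡⟨ sum-blocks 16 M h ⟩
  sumBelow 16 (λ d → sumBelow M (λ l → h (l * 16 + d)))
    ≡⟨ sum-cong< 16 (λ d d<16 → sum-cong M (λ l → cong₂ (λ x s → if x ≡ᵇ N then s else 0ℤ)
         (cong₂ value (proj₁ (enum-at l d d<16)) (proj₂ (enum-at l d d<16))) (sgnT-at l d))) ⟩
  sumBelow 16 S
    -- Positions d and 15 - d of a block of sixteen are the non-negative and the negative v for the
    -- same root. They combine into one sum over ℤ because t takes equal values at d and 15 - d.
    ≡⟨ pair (S 0) (S 1) (S 2) (S 3) (S 4) (S 5) (S 6) (S 7) (S 8) (S 9) (S 10) (S 11) (S 12) (S 13) (S 14) (S 15) ⟩
  rootSeries N ∎
  where
  open ≡-Reasoning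
  M : ℕ
  M = suc N
  h : ℕ → ℤ
  h n = if enum n ≡ᵇ N then sgnT n else 0ℤ
  S : ℕ → ℤ
  S d = sumBelow M (λ l → if value l d ≡ᵇ N then sgnT d else 0ℤ)
  sgnT-at : ∀ l d → sgnT (l * 16 + d) ≡ sgnT d
  sgnT-at l d = cong (λ r → if f r then 1ℤ else -1ℤ)
    (trans (cong (_% 16) (ℕₚ.+-comm (l * 16) d)) (ℕ-DivMod.[m+kn]%n≡m%n d l 16))
    where
    f : ℕ → Bool
    f r = (r ≡ᵇ 0) ∨ (r ≡ᵇ 1) ∨ (r ≡ᵇ 3) ∨ (r ≡ᵇ 5) ∨ (r ≡ᵇ 10) ∨ (r ≡ᵇ 12) ∨ (r ≡ᵇ 14) ∨ (r ≡ᵇ 15)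
  pair : ∀ a b c d e f g h i j k l m n o p →
    0ℤ ℤ.+ a ℤ.+ b ℤ.+ c ℤ.+ d ℤ.+ e ℤ.+ f ℤ.+ g ℤ.+ h ℤ.+ i ℤ.+ j ℤ.+ k ℤ.+ l ℤ.+ m ℤ.+ n ℤ.+ o ℤ.+ p ≡
    0ℤ ℤ.+ (a ℤ.+ p) ℤ.+ (b ℤ.+ o) ℤ.+ (c ℤ.+ n) ℤ.+ (d ℤ.+ m) ℤ.+ (e ℤ.+ l) ℤ.+ (f ℤ.+ k) ℤ.+ (g ℤ.+ j) ℤ.+ (h ℤ.+ i)
  pair = ℤ-Solver.solve-∀

-- Comparison of coefficients through the quadratic form

≢⇒≡ᵇ-false : ∀ {m n} → m ≢ n → (m ≡ᵇ n) ≡ false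
≢⇒≡ᵇ-false {m} {n} m≢n with m ≡ᵇ n in eq
... | false = refl
... | true  = contradiction (ℕₚ.≡ᵇ⇒≡ m n (subst T (sym eq) tt)) m≢n

affine-≡ᵇ : ∀ p c m n → (suc p * m + c ≡ᵇ suc p * n + c) ≡ (m ≡ᵇ n)
affine-≡ᵇ p c m n with m ≟ n
... | yes refl = trans (≡ᵇ-refl (suc p * m + c)) (sym (≡ᵇ-refl m))
... | no m≢n   = trans
  (≢⇒≡ᵇ-false (λ eq → m≢n (ℕₚ.*-cancelˡ-≡ m n (suc p) (ℕₚ.+-cancelʳ-≡ c (suc p * m) (suc p * n) eq))))
  (sym (≢⇒≡ᵇ-false m≢n))

indicator : ℕ → ℤ → ℤ
indicator C z = if ∣ z ∣ ≡ᵇ C then 1ℤ else 0ℤ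

∣form∣ : ∀ K R → ∣ form K R ∣ ≡ 35 * (∣ K ∣ * ∣ K ∣) + ∣ R ∣ * ∣ R ∣
∣form∣ K R = cong ∣_∣ (trans (cong₂ (λ x y → + 35 ℤ.* x ℤ.+ y) (square-∣∣ K) (square-∣∣ R))
  (trans (cong (ℤ._+ + (∣ R ∣ * ∣ R ∣)) (sym (ℤₚ.pos-* 35 (∣ K ∣ * ∣ K ∣)))) (sym (ℤₚ.pos-+ (35 * (∣ K ∣ * ∣ K ∣)) (∣ R ∣ * ∣ R ∣)))))

n≤n*n : ∀ n → n ≤ n * n
n≤n*n zero    = z≤n
n≤n*n (suc n) = ℕₚ.m≤m*n (suc n) (suc n)

indicator-vanish : ∀ C K R → (∣ K ∣ ≤ C → ∣ R ∣ ≤ C → ⊥) → indicator C (form K R) ≡ 0ℤ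
indicator-vanish C K R outside = if-cong (≢⇒≡ᵇ-false λ eq → outside
  (subst (∣ K ∣ ≤_) (trans (sym (∣form∣ K R)) eq)
    (ℕₚ.≤-trans (n≤n*n ∣ K ∣) (ℕₚ.≤-trans (ℕₚ.m≤n*m (∣ K ∣ * ∣ K ∣) 35) (ℕₚ.m≤m+n _ (∣ R ∣ * ∣ R ∣)))))
  (subst (∣ R ∣ ≤_) (trans (sym (∣form∣ K R)) eq)
    (ℕₚ.≤-trans (n≤n*n ∣ R ∣) (ℕₚ.m≤n+m (∣ R ∣ * ∣ R ∣) (35 * (∣ K ∣ * ∣ K ∣))))))

-- Turns the condition that an exponent equals N into the condition that the form equals 840N + 324,
-- so that products of series become weighted counts of lattice points.
indicator-coeff : ∀ N e w z → z ≡ + 840 ℤ.* + e ℤ.+ + 324 →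
  (if e ≡ᵇ N then w else 0ℤ) ≡ w ℤ.* indicator (840 * N + 324) z
indicator-coeff N e w z eq = sym (trans
  (cong (ℤ._*_ w) (if-cong (trans (cong (_≡ᵇ 840 * N + 324) abs) (affine-≡ᵇ 839 324 e N))))
  (scaled (e ≡ᵇ N)))
  where
  abs : ∣ z ∣ ≡ 840 * e + 324
  abs = cong ∣_∣ (trans eq (trans (cong (ℤ._+ + 324) (sym (ℤₚ.pos-* 840 e))) (sym (ℤₚ.pos-+ (840 * e) 324))))
  scaled : ∀ b → w ℤ.* (if b then 1ℤ else 0ℤ) ≡ (if b then w else 0ℤ)
  scaled true  = ℤₚ.*-identityʳ w
  scaled false = ℤₚ.*-zeroʳ w

Θ₃ Θ₅ Θ₇ : FPS
Θ₃ = gen (expo 2 1) sg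
Θ₅ = gen (expo 4 1) sg
Θ₇ = gen (expo 5 2) sg

-- `C` is a variable tied to its value by an equation, so that it stays neutral instead of
-- unfolding.
module Coefficient (N : ℕ) (C : ℕ) (C≡ : C ≡ 840 * N + 324) where

  Φ : ℤ → ℤ
  Φ = indicator C

  open Lattice Φ C (indicator-vanish C)

  N<B : N < B
  N<B = ℕₚ.≤-<-trans (subst (N ≤_) (sym C≡) (ℕₚ.≤-trans (ℕₚ.m≤n*m N 840) (ℕₚ.m≤m+n (840 * N) 324))) (ℕₚ.m<m+n C (s≤s z≤n))

  Φ-coeff : ∀ e w z → z ≡ + 840 ℤ.* + e ℤ.+ + 324 → (if e ≡ᵇ N then w else 0ℤ) ≡ w ℤ.* Φ z
  Φ-coeff e w z eq = trans (indicator-coeff N e w z eq) (cong (λ c → w ℤ.* indicator c z) (sym C≡))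

  Θ₇Θ₅-summand : ℤ → ℤ → ℤ
  Θ₇Θ₅-summand m n = Φ (form (linK (+ 3) m n) (linR -[1+ 2 ] m n))

  Θ₇Θ₅-form : ∀ m n → form (linK (+ 3) m n) (linR -[1+ 2 ] m n) ≡ + 840 ℤ.* + (expo 5 2 m + expo 4 1 n) ℤ.+ + 324
  Θ₇Θ₅-form m n = sym (begin
    + 840 ℤ.* + (e + f) ℤ.+ + 324
      ≡⟨ cong (λ z → + 840 ℤ.* z ℤ.+ + 324) (ℤₚ.pos-+ e f) ⟩
    + 840 ℤ.* (+ e ℤ.+ + f) ℤ.+ + 324
      ≡⟨ double (+ e) (+ f) ⟩
    + 420 ℤ.* (+ 2 ℤ.* + e ℤ.+ + 2 ℤ.* + f) ℤ.+ + 324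
      ≡⟨ cong₂ (λ x y → + 420 ℤ.* (x ℤ.+ y) ℤ.+ + 324) (expo-closed 5 2 m) (expo-closed 4 1 n) ⟩
    + 420 ℤ.* ((+ 7 ℤ.* (m ℤ.* m) ℤ.+ + 3 ℤ.* m) ℤ.+ (+ 5 ℤ.* (n ℤ.* n) ℤ.+ + 3 ℤ.* n)) ℤ.+ + 324
      ≡⟨ lem m n ⟩
    form (linK (+ 3) m n) (linR -[1+ 2 ] m n) ∎)
    where
    open ≡-Reasoning
    e f : ℕ
    e = expo 5 2 m
    f = expo 4 1 n
    double : ∀ e f → + 840 ℤ.* (e ℤ.+ f) ℤ.+ + 324 ≡ + 420 ℤ.* (+ 2 ℤ.* e ℤ.+ + 2 ℤ.* f) ℤ.+ + 324
    double = ℤ-Solver.solve-∀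
    lem : ∀ m n → + 420 ℤ.* ((+ 7 ℤ.* (m ℤ.* m) ℤ.+ + 3 ℤ.* m) ℤ.+ (+ 5 ℤ.* (n ℤ.* n) ℤ.+ + 3 ℤ.* n)) ℤ.+ + 324 ≡
      + 35 ℤ.* ((+ 7 ℤ.* m ℤ.+ + 5 ℤ.* n ℤ.+ + 3) ℤ.* (+ 7 ℤ.* m ℤ.+ + 5 ℤ.* n ℤ.+ + 3)) ℤ.+ (+ 35 ℤ.* (m ℤ.- n) ℤ.+ -[1+ 2 ]) ℤ.* (+ 35 ℤ.* (m ℤ.- n) ℤ.+ -[1+ 2 ])
    lem = ℤ-Solver.solve-∀

  -- With s = (-1)^(m-n) this is 2s + (1 - s) = 1 + s, summed over the lattice: the signed sum is
  -- the even half minus the odd half, each occurring doubled.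
  Θ₇Θ₅-W : (Θ₇ · Θ₅) N ℤ.+ (Θ₇ · Θ₅) N ℤ.+ W -1ℤ (+ 3) -[1+ 2 ] ≡ W 1ℤ (+ 3) -[1+ 2 ]
  Θ₇Θ₅-W = begin
    (Θ₇ · Θ₅) N ℤ.+ (Θ₇ · Θ₅) N ℤ.+ W -1ℤ (+ 3) -[1+ 2 ]
      ≡⟨ cong (λ x → x ℤ.+ x ℤ.+ W -1ℤ (+ 3) -[1+ 2 ]) expand ⟩
    ΣΣ f ℤ.+ ΣΣ f ℤ.+ ΣΣ g
      ≡⟨ cong (ℤ._+ ΣΣ g) (sym (ΣΣ-+ f f)) ⟩
    ΣΣ (λ m n → f m n ℤ.+ f m n) ℤ.+ ΣΣ g
      ≡⟨ sym (ΣΣ-+ (λ m n → f m n ℤ.+ f m n) g) ⟩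
    ΣΣ (λ m n → f m n ℤ.+ f m n ℤ.+ g m n)
      ≡⟨ ΣZ-cong B (λ m → ΣZ-cong B (λ n → trans
           (cong (λ s → s ℤ.* Θ₇Θ₅-summand m n ℤ.+ s ℤ.* Θ₇Θ₅-summand m n ℤ.+ g m n) (sign m n))
           (lem (sg (m ℤ.- n)) (Θ₇Θ₅-summand m n)))) ⟩
    W 1ℤ (+ 3) -[1+ 2 ] ∎
    where
    open ≡-Reasoning
    ΣΣ : (ℤ → ℤ → ℤ) → ℤ
    ΣΣ f = ΣZ B (λ m → ΣZ B (f m))
    ΣΣ-+ : ∀ f g → ΣΣ (λ m n → f m n ℤ.+ g m n) ≡ ΣΣ f ℤ.+ ΣΣ g
    ΣΣ-+ f g = trans (ΣZ-cong B (λ m → ΣZ-+ B (f m) (g m))) (ΣZ-+ B (λ m → ΣZ B (f m)) (λ m → ΣZ B (g m)))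
    f g : ℤ → ℤ → ℤ
    f m n = sg m ℤ.* sg n ℤ.* Θ₇Θ₅-summand m n
    g m n = parityWeight -1ℤ (m ℤ.- n) ℤ.* Θ₇Θ₅-summand m n
    expand : (Θ₇ · Θ₅) N ≡ ΣΣ f
    expand = trans (gen-· (expo 5 2) sg (expo 4 1) sg (expo-≥ 4 1) (expo-≥ 3 0) N B N<B)
      (ΣZ-cong B (λ m → ΣZ-cong B (λ n → Φ-coeff (expo 5 2 m + expo 4 1 n) (sg m ℤ.* sg n) _ (Θ₇Θ₅-form m n))))
    sign : ∀ m n → sg m ℤ.* sg n ≡ sg (m ℤ.- n)
    sign m n = sym (trans (sg-+ m (ℤ.- n)) (cong (ℤ._*_ (sg m)) (sg-neg n)))
    lem : ∀ s x → s ℤ.* x ℤ.+ s ℤ.* x ℤ.+ (1ℤ ℤ.+ -1ℤ ℤ.* s) ℤ.* x ≡ (1ℤ ℤ.+ 1ℤ ℤ.* s) ℤ.* x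
    lem = ℤ-Solver.solve-∀

  rootΘ₃-form : ∀ i v k → form (k ℤ.* + 6 ℤ.+ 1ℤ) (v ℤ.* + 420 ℤ.+ + root i) ≡ + 840 ℤ.* + (rootExpo i v + expo 2 1 k) ℤ.+ + 324
  rootΘ₃-form i v k = sym (begin
    + 840 ℤ.* + (e + f) ℤ.+ + 324
      ≡⟨ cong (λ z → + 840 ℤ.* z ℤ.+ + 324) (ℤₚ.pos-+ e f) ⟩
    + 840 ℤ.* (+ e ℤ.+ + f) ℤ.+ + 324
      ≡⟨ double (+ e) (+ f) ⟩
    + 840 ℤ.* + e ℤ.+ + 420 ℤ.* (+ 2 ℤ.* + f) ℤ.+ + 324
      ≡⟨ cong₂ (λ x y → x ℤ.+ + 420 ℤ.* y ℤ.+ + 324) (rootExpo-closed i v) (expo-closed 2 1 k) ⟩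
    (z ℤ.* z ℤ.- + 289) ℤ.+ + 420 ℤ.* (+ 3 ℤ.* (k ℤ.* k) ℤ.+ 1ℤ ℤ.* k) ℤ.+ + 324
      ≡⟨ lem (z ℤ.* z) k ⟩
    form (k ℤ.* + 6 ℤ.+ 1ℤ) z ∎)
    where
    open ≡-Reasoning
    e f : ℕ
    e = rootExpo i v
    f = expo 2 1 k
    z : ℤ
    z = v ℤ.* + 420 ℤ.+ + root i
    double : ∀ e f → + 840 ℤ.* (e ℤ.+ f) ℤ.+ + 324 ≡ + 840 ℤ.* e ℤ.+ + 420 ℤ.* (+ 2 ℤ.* f) ℤ.+ + 324
    double = ℤ-Solver.solve-∀
    lem : ∀ y k → (y ℤ.- + 289) ℤ.+ + 420 ℤ.* (+ 3 ℤ.* (k ℤ.* k) ℤ.+ 1ℤ ℤ.* k) ℤ.+ + 324 ≡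
      + 35 ℤ.* ((k ℤ.* + 6 ℤ.+ 1ℤ) ℤ.* (k ℤ.* + 6 ℤ.+ 1ℤ)) ℤ.+ y
    lem = ℤ-Solver.solve-∀

  -- In K = 6k + 1 an even k gives K ≡ 1 (mod 12), while an odd k gives K ≡ 7 ≡ -5 with sign -1;
  -- hence the difference of `P₁` and `P₅`.
  rootΘ₃ : ∀ i s → (gen (rootExpo i) (λ _ → s) · Θ₃) N ≡ s ℤ.* (P₁ (root i) ℤ.- P₅ (root i))
  rootΘ₃ i s = begin
    (gen (rootExpo i) (λ _ → s) · Θ₃) N
      ≡⟨ gen-· (rootExpo i) (λ _ → s) (expo 2 1) sg (rootExpo-≥ i) (expo-≥ 1 0) N B N<B ⟩
    ΣZ B (λ v → ΣZ B (λ k → if rootExpo i v + expo 2 1 k ≡ᵇ N then s ℤ.* sg k else 0ℤ))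
      ≡⟨ ΣZ-cong B (λ v → trans (ΣZ-cong B (λ k → trans
           (Φ-coeff (rootExpo i v + expo 2 1 k) (s ℤ.* sg k) _ (rootΘ₃-form i v k))
           (ℤₚ.*-assoc s (sg k) (φ v k)))) (ΣZ-*ˡ B s (λ k → sg k ℤ.* φ v k))) ⟩
    ΣZ B (λ v → s ℤ.* ΣZ B (λ k → sg k ℤ.* φ v k))
      ≡⟨ ΣZ-*ˡ B s (λ v → ΣZ B (λ k → sg k ℤ.* φ v k)) ⟩
    s ℤ.* ΣZ B (λ v → ΣZ B (λ k → sg k ℤ.* φ v k))
      ≡⟨ cong (ℤ._*_ s) (trans (ΣZ-cong B split) (trans
           (ΣZ-+ B (λ v → ΣZ B (ψ (+ 1) v)) (λ v → -1ℤ ℤ.* ΣZ B (ψ (+ 7) v)))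
           (cong (ℤ._+_ (P₁ (root i))) (trans (ΣZ-*ˡ B -1ℤ (λ v → ΣZ B (ψ (+ 7) v)))
             (trans (cong (ℤ._*_ -1ℤ) (P-flip₁ (+ 1) (+ 5) (+ root i))) (ℤₚ.-1*i≡-i (P₅ (root i)))))))) ⟩
    s ℤ.* (P₁ (root i) ℤ.- P₅ (root i)) ∎
    where
    open ≡-Reasoning
    φ : ℤ → ℤ → ℤ
    φ v k = Φ (form (k ℤ.* + 6 ℤ.+ 1ℤ) (v ℤ.* + 420 ℤ.+ + root i))
    ψ : ℤ → ℤ → ℤ → ℤ
    ψ j v u = Φ (form (u ℤ.* + 12 ℤ.+ j) (v ℤ.* + 420 ℤ.+ + root i))
    φ-supp : ∀ v → Supp B (λ k → sg k ℤ.* φ v k)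
    φ-supp v k B≤k = *-zero (sg k) (form-supp 5 1ℤ 0ℤ -1ℤ k (k ℤ.* + 6 ℤ.+ 1ℤ) (v ℤ.* + 420 ℤ.+ + root i)
      (lem k (v ℤ.* + 420 ℤ.+ + root i)) (s≤s z≤n) (s≤s (s≤s z≤n)) B≤k)
      where
      lem : ∀ k R → + 6 ℤ.* k ≡ 1ℤ ℤ.* (k ℤ.* + 6 ℤ.+ 1ℤ) ℤ.+ 0ℤ ℤ.* R ℤ.+ -1ℤ
      lem = ℤ-Solver.solve-∀
    sg-twice : ∀ u d → sg (u ℤ.* + 2 ℤ.+ d) ≡ sg d
    sg-twice u d = trans (sg-+ (u ℤ.* + 2) d)
      (trans (cong (ℤ._* sg d) (trans (cong sg (lem u)) (sg-double u))) (ℤₚ.*-identityˡ (sg d)))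
      where
      lem : ∀ u → u ℤ.* + 2 ≡ u ℤ.+ u
      lem = ℤ-Solver.solve-∀
    split : ∀ v → ΣZ B (λ k → sg k ℤ.* φ v k) ≡ ΣZ B (ψ (+ 1) v) ℤ.+ -1ℤ ℤ.* ΣZ B (ψ (+ 7) v)
    split v = trans (ΣZ-blocks 1 (φ-supp v)) (cong₂ ℤ._+_
      (trans (ℤₚ.+-identityˡ _) (ΣZ-cong B (λ u → trans
        (cong₂ (λ s K → s ℤ.* Φ (form K (v ℤ.* + 420 ℤ.+ + root i))) (sg-twice u (+ 0)) (even u))
        (ℤₚ.*-identityˡ (ψ (+ 1) v u)))))
      (trans (ΣZ-cong B (λ u →
        cong₂ (λ s K → s ℤ.* Φ (form K (v ℤ.* + 420 ℤ.+ + root i))) (sg-twice u (+ 1)) (odd u)))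
        (ΣZ-*ˡ B -1ℤ (ψ (+ 7) v))))
      where
      even : ∀ u → (u ℤ.* + 2 ℤ.+ + 0) ℤ.* + 6 ℤ.+ 1ℤ ≡ u ℤ.* + 12 ℤ.+ + 1
      even = ℤ-Solver.solve-∀
      odd : ∀ u → (u ℤ.* + 2 ℤ.+ + 1) ℤ.* + 6 ℤ.+ 1ℤ ≡ u ℤ.* + 12 ℤ.+ + 7
      odd = ℤ-Solver.solve-∀

  -- Once everything is written in `P₁`, `P₃` and `P₅`, the difference of the two sides is exactly
  -- the difference of the two sides of `exchange`. What remains is linear, and is done doubled
  -- because `Θ₇Θ₅-W` is.
  coefficients-agree : (rootSeries · Θ₃) N ≡ (Θ₇ · Θ₅) N
  coefficients-agree = trans expand (collect
    (P₁ 17) (P₁ 53) (P₁ 67) (P₁ 73) (P₁ 137) (P₁ 143) (P₁ 157) (P₁ 193)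
    (P₅ 17) (P₅ 53) (P₅ 67) (P₅ 73) (P₅ 137) (P₅ 143) (P₅ 157) (P₅ 193)
    (P₃ 3) (P₃ 207) (P₃ 87) (P₃ 123) ((Θ₇ · Θ₅) N) exchange
    (trans (cong (ℤ._+_ ((Θ₇ · Θ₅) N ℤ.+ (Θ₇ · Θ₅) N)) (sym W-odd)) (trans Θ₇Θ₅-W W-even)))
    where
    open ≡-Reasoning
    D : ℕ → ℤ
    D r = P₁ r ℤ.- P₅ r
    expand : (rootSeries · Θ₃) N ≡
      0ℤ ℤ.+ 1ℤ ℤ.* D 17 ℤ.+ 1ℤ ℤ.* D 53 ℤ.+ -1ℤ ℤ.* D 67 ℤ.+ 1ℤ ℤ.* D 73 ℤ.+ -1ℤ ℤ.* D 137 ℤ.+ 1ℤ ℤ.* D 143 ℤ.+ -1ℤ ℤ.* D 157 ℤ.+ -1ℤ ℤ.* D 193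
    expand = trans (at (R.trans (R.*-comm rootSeries Θ₃) (ΣS-·ˡ 8 Θ₃ (λ i → gen (rootExpo i) (λ _ → sgnT i)))) N)
      (sum-cong 8 {λ i → (Θ₃ · gen (rootExpo i) (λ _ → sgnT i)) N} {λ i → sgnT i ℤ.* D (root i)}
        (λ i → trans (at (R.*-comm Θ₃ (gen (rootExpo i) (λ _ → sgnT i))) N) (rootΘ₃ i (sgnT i))))
    regroup : ∀ a₁ b₁ c₁ d₁ e₁ f₁ g₁ h₁ a₅ b₅ c₅ d₅ e₅ f₅ g₅ h₅ →
      0ℤ ℤ.+ 1ℤ ℤ.* (a₁ ℤ.- a₅) ℤ.+ 1ℤ ℤ.* (b₁ ℤ.- b₅) ℤ.+ -1ℤ ℤ.* (c₁ ℤ.- c₅) ℤ.+ 1ℤ ℤ.* (d₁ ℤ.- d₅) ℤ.+ -1ℤ ℤ.* (e₁ ℤ.- e₅) ℤ.+ 1ℤ ℤ.* (f₁ ℤ.- f₅) ℤ.+ -1ℤ ℤ.* (g₁ ℤ.- g₅) ℤ.+ -1ℤ ℤ.* (h₁ ℤ.- h₅)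
      ≡ ((a₁ ℤ.+ b₁) ℤ.+ (d₁ ℤ.+ f₁) ℤ.- (c₁ ℤ.+ e₁) ℤ.- (g₁ ℤ.+ h₁)) ℤ.- ((a₅ ℤ.+ b₅) ℤ.+ (d₅ ℤ.+ f₅) ℤ.- (c₅ ℤ.+ e₅) ℤ.- (g₅ ℤ.+ h₅))
    regroup = ℤ-Solver.solve-∀
    collect : ∀ a₁ b₁ c₁ d₁ e₁ f₁ g₁ h₁ a₅ b₅ c₅ d₅ e₅ f₅ g₅ h₅ w x y z t →
      a₁ ℤ.+ y ℤ.+ g₅ ℤ.+ h₅ ℤ.+ z ℤ.+ b₁ ≡ w ℤ.+ d₅ ℤ.+ f₅ ℤ.+ x ℤ.+ e₁ ℤ.+ c₁ →
      t ℤ.+ t ℤ.+ + 2 ℤ.* (b₅ ℤ.+ z ℤ.+ h₁ ℤ.+ g₁ ℤ.+ y ℤ.+ a₅) ≡ + 2 ℤ.* (w ℤ.+ c₅ ℤ.+ e₅ ℤ.+ x ℤ.+ f₁ ℤ.+ d₁) →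
      0ℤ ℤ.+ 1ℤ ℤ.* (a₁ ℤ.- a₅) ℤ.+ 1ℤ ℤ.* (b₁ ℤ.- b₅) ℤ.+ -1ℤ ℤ.* (c₁ ℤ.- c₅) ℤ.+ 1ℤ ℤ.* (d₁ ℤ.- d₅) ℤ.+ -1ℤ ℤ.* (e₁ ℤ.- e₅) ℤ.+ 1ℤ ℤ.* (f₁ ℤ.- f₅) ℤ.+ -1ℤ ℤ.* (g₁ ℤ.- g₅) ℤ.+ -1ℤ ℤ.* (h₁ ℤ.- h₅) ≡ t
    collect a₁ b₁ c₁ d₁ e₁ f₁ g₁ h₁ a₅ b₅ c₅ d₅ e₅ f₅ g₅ h₅ w x y z t exch dbl =
      trans (regroup a₁ b₁ c₁ d₁ e₁ f₁ g₁ h₁ a₅ b₅ c₅ d₅ e₅ f₅ g₅ h₅)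
        -- The classes enter only through these pairwise sums, so `final` has eleven unknowns in
        -- place of twenty-one.
        (ℤₚ.*-cancelˡ-≡ (+ 2) _ _ (final (a₁ ℤ.+ b₁) (c₁ ℤ.+ e₁) (d₁ ℤ.+ f₁) (g₁ ℤ.+ h₁) (a₅ ℤ.+ b₅) (c₅ ℤ.+ e₅) (d₅ ℤ.+ f₅) (g₅ ℤ.+ h₅) (w ℤ.+ x) (y ℤ.+ z) t
          (trans (lem₁ a₁ b₁ y z g₅ h₅) (trans exch (lem₂ w x d₅ f₅ c₁ e₁)))
          (trans (lem₃ t a₅ b₅ y z g₁ h₁) (trans dbl (lem₄ w x c₅ e₅ d₁ f₁)))))
      where
      lem₁ : ∀ a b y z g h → (a ℤ.+ b) ℤ.+ (y ℤ.+ z) ℤ.+ (g ℤ.+ h) ≡ a ℤ.+ y ℤ.+ g ℤ.+ h ℤ.+ z ℤ.+ b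
      lem₁ = ℤ-Solver.solve-∀
      lem₂ : ∀ w x d f c e → w ℤ.+ d ℤ.+ f ℤ.+ x ℤ.+ e ℤ.+ c ≡ (w ℤ.+ x) ℤ.+ (d ℤ.+ f) ℤ.+ (c ℤ.+ e)
      lem₂ = ℤ-Solver.solve-∀
      lem₃ : ∀ t a b y z g h → t ℤ.+ t ℤ.+ + 2 ℤ.* ((a ℤ.+ b) ℤ.+ (y ℤ.+ z) ℤ.+ (g ℤ.+ h)) ≡ t ℤ.+ t ℤ.+ + 2 ℤ.* (b ℤ.+ z ℤ.+ h ℤ.+ g ℤ.+ y ℤ.+ a)
      lem₃ = ℤ-Solver.solve-∀
      lem₄ : ∀ w x c e d f → + 2 ℤ.* (w ℤ.+ c ℤ.+ e ℤ.+ x ℤ.+ f ℤ.+ d) ≡ + 2 ℤ.* ((w ℤ.+ x) ℤ.+ (c ℤ.+ e) ℤ.+ (d ℤ.+ f))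
      lem₄ = ℤ-Solver.solve-∀
      final : ∀ a₁ c₁ d₁ g₁ a₅ c₅ d₅ g₅ w y t →
        a₁ ℤ.+ y ℤ.+ g₅ ≡ w ℤ.+ d₅ ℤ.+ c₁ →
        t ℤ.+ t ℤ.+ + 2 ℤ.* (a₅ ℤ.+ y ℤ.+ g₁) ≡ + 2 ℤ.* (w ℤ.+ c₅ ℤ.+ d₁) →
        + 2 ℤ.* ((a₁ ℤ.+ d₁ ℤ.- c₁ ℤ.- g₁) ℤ.- (a₅ ℤ.+ d₅ ℤ.- c₅ ℤ.- g₅)) ≡ + 2 ℤ.* t
      final a₁ c₁ d₁ g₁ a₅ c₅ d₅ g₅ w y t p q = begin
        + 2 ℤ.* ((a₁ ℤ.+ d₁ ℤ.- c₁ ℤ.- g₁) ℤ.- (a₅ ℤ.+ d₅ ℤ.- c₅ ℤ.- g₅))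
          ≡⟨ s₁ a₁ c₁ d₁ g₁ a₅ c₅ d₅ g₅ w y ⟩
        + 2 ℤ.* (a₁ ℤ.+ y ℤ.+ g₅) ℤ.- + 2 ℤ.* (w ℤ.+ d₅ ℤ.+ c₁) ℤ.+ (+ 2 ℤ.* (w ℤ.+ c₅ ℤ.+ d₁) ℤ.- + 2 ℤ.* (a₅ ℤ.+ y ℤ.+ g₁))
          ≡⟨ cong₂ (λ u v → + 2 ℤ.* u ℤ.- + 2 ℤ.* (w ℤ.+ d₅ ℤ.+ c₁) ℤ.+ (v ℤ.- + 2 ℤ.* (a₅ ℤ.+ y ℤ.+ g₁))) p (sym q) ⟩
        + 2 ℤ.* (w ℤ.+ d₅ ℤ.+ c₁) ℤ.- + 2 ℤ.* (w ℤ.+ d₅ ℤ.+ c₁) ℤ.+ (t ℤ.+ t ℤ.+ + 2 ℤ.* (a₅ ℤ.+ y ℤ.+ g₁) ℤ.- + 2 ℤ.* (a₅ ℤ.+ y ℤ.+ g₁))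
          ≡⟨ s₂ (+ 2 ℤ.* (w ℤ.+ d₅ ℤ.+ c₁)) (+ 2 ℤ.* (a₅ ℤ.+ y ℤ.+ g₁)) t ⟩
        + 2 ℤ.* t ∎
        where
        s₁ : ∀ a₁ c₁ d₁ g₁ a₅ c₅ d₅ g₅ w y →
          + 2 ℤ.* ((a₁ ℤ.+ d₁ ℤ.- c₁ ℤ.- g₁) ℤ.- (a₅ ℤ.+ d₅ ℤ.- c₅ ℤ.- g₅)) ≡
          + 2 ℤ.* (a₁ ℤ.+ y ℤ.+ g₅) ℤ.- + 2 ℤ.* (w ℤ.+ d₅ ℤ.+ c₁) ℤ.+ (+ 2 ℤ.* (w ℤ.+ c₅ ℤ.+ d₁) ℤ.- + 2 ℤ.* (a₅ ℤ.+ y ℤ.+ g₁))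
        s₁ = ℤ-Solver.solve-∀
        s₂ : ∀ u v t → u ℤ.- u ℤ.+ (t ℤ.+ t ℤ.+ v ℤ.- v) ≡ + 2 ℤ.* t
        s₂ = ℤ-Solver.solve-∀

-- Return to infinite products

rootSeries-Θ : rootSeries · Θ₃ ≋ Θ₇ · Θ₅
rootSeries-Θ = mk λ N → Coefficient.coefficients-agree N (840 * N + 324) refl

module T₃ = JacobiTripleProduct 1 0
module T₅ = JacobiTripleProduct 3 0
module T₇ = JacobiTripleProduct 4 1

-- Euler's pentagonal number theorem: the triple product with a = 2, b = 1 runs over all classes
-- modulo 3.
Θ₃-product : Θ₃ ≋ qPoch 0 0
Θ₃-product = R.trans (R.sym T₃.triple-product) (R.trans
  (solve 3 (λ a b c → b :* a :* c := a :* b :* c) R.refl (qPoch 0 2) (qPoch 1 2) (qPoch 2 2))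
  (R.trans (R.*-congʳ (R.*-congʳ (R.sym (R.*-identityˡ (qPoch 0 2))))) (R.sym (qPoch-dissect 2))))
  where open FPS-Solver

rhs-· : rhsSeries ≋ qPoch 1 6 · qPoch 4 6 · qPoch 6 6 · qPochInv 1 4 · qPochInv 2 4
rhs-· = step (qPochInv 2 4) (step (qPochInv 1 4) (step (qPoch 6 6) (step (qPoch 4 6) R.refl)))
  where
  step : ∀ {f g} h → f ≋ g → f ⊛ h ≋ g · h
  step {f} h e = R.trans (R.sym (·-def f h)) (R.*-congʳ e)

cancel : ∀ {p i} → p · i ≋ oneS → ∀ f → f · (p · i) ≋ f
cancel e f = R.trans (R.*-congˡ e) (R.*-identityʳ f)

rootSeries-rhs : rootSeries ≋ rhsSeries
rootSeries-rhs = R.sym (begin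
  rhsSeries
    ≈⟨ rhs-· ⟩
  qPoch 1 6 · qPoch 4 6 · qPoch 6 6 · i 1 · i 2
    ≈⟨ R.*-congʳ (R.*-congʳ (R.trans (R.*-congʳ (R.*-comm (qPoch 1 6) (qPoch 4 6))) T₇.triple-product)) ⟩
  Θ₇ · i 1 · i 2
    -- Inserts (q,q⁴,q⁵;q⁵)_∞ divided by itself: the numerator becomes `Θ₅`, and the denominator
    -- completes the inverses to `I`, the inverse of (q;q)_∞.
    ≈⟨ R.sym (R.trans (cancel (inv 4) _) (R.trans (cancel (inv 3) _) (cancel (inv 0) (Θ₇ · i 1 · i 2)))) ⟩
  Θ₇ · i 1 · i 2 · (p 0 · i 0) · (p 3 · i 3) · (p 4 · i 4)
    ≈⟨ solve 9 (λ t i₀ i₁ i₂ i₃ i₄ p₀ p₃ p₄ → t :* i₁ :* i₂ :* (p₀ :* i₀) :* (p₃ :* i₃) :* (p₄ :* i₄) := (t :* (p₃ :* p₀ :* p₄)) :* (i₀ :* i₁ :* i₂ :* i₃ :* i₄))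
         R.refl Θ₇ (i 0) (i 1) (i 2) (i 3) (i 4) (p 0) (p 3) (p 4) ⟩
  (Θ₇ · (p 3 · p 0 · p 4)) · I
    ≈⟨ R.*-congʳ (R.*-congˡ T₅.triple-product) ⟩
  (Θ₇ · Θ₅) · I
    ≈⟨ R.*-congʳ (R.sym rootSeries-Θ) ⟩
  (rootSeries · Θ₃) · I
    ≈⟨ R.*-congʳ (R.*-congˡ (R.trans Θ₃-product (qPoch-dissect 4))) ⟩
  (rootSeries · (oneS · p 0 · p 1 · p 2 · p 3 · p 4)) · I
    ≈⟨ solve 12 (λ l o p₀ p₁ p₂ p₃ p₄ i₀ i₁ i₂ i₃ i₄ →
           (l :* (o :* p₀ :* p₁ :* p₂ :* p₃ :* p₄)) :* (i₀ :* i₁ :* i₂ :* i₃ :* i₄)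
           := l :* (p₀ :* i₀) :* (p₁ :* i₁) :* (p₂ :* i₂) :* (p₃ :* i₃) :* (p₄ :* i₄) :* o)
         R.refl rootSeries oneS (p 0) (p 1) (p 2) (p 3) (p 4) (i 0) (i 1) (i 2) (i 3) (i 4) ⟩
  rootSeries · (p 0 · i 0) · (p 1 · i 1) · (p 2 · i 2) · (p 3 · i 3) · (p 4 · i 4) · oneS
    ≈⟨ R.trans (R.*-identityʳ _) (R.trans (cancel (inv 4) _) (R.trans (cancel (inv 3) _) (R.trans (cancel (inv 2) _)
         (R.trans (cancel (inv 1) _) (cancel (inv 0) rootSeries))))) ⟩
  rootSeries ∎)
  where
  open ≋-Reasoning
  open FPS-Solver
  p i : ℕ → FPS
  p r = qPoch r 4
  i r = qPochInv r 4
  inv : ∀ r → p r · i r ≋ oneS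
  inv r = qPoch-inverse r 4
  I : FPS
  I = i 0 · i 1 · i 2 · i 3 · i 4

theorem4 : (a : ℕ → ℕ)
    → (∀ {m n} → m < n → a m < a n)
    → (∀ m → (∃[ k ] k * k ≡ 840 * m + 289) ⇔ (∃[ n ] a n ≡ m))
    → ∀ N → lhsSeries a N ≡ rhsSeries N
theorem4 a a-inc spec N = trans (lhs-rootSeries a a-inc spec N) (at rootSeries-rhs N)
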